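{- Let $G(V,E)$ be a graph on $n$ vertices, let $k\ge 1$, and let $G^{(1)},\ldots,G^{(k)}$ be a random $k$-partition of $G$. For any $\varepsilon\in(0,1)$, set $\lambda:=\Theta\big((\varepsilon/\log n)^2\big)$ and $\beta:=\Theta(\varepsilon^{ -6}\log^{7} n)$ (for suitable absolute constants in the $\Theta$-notation). Then the algorithm that, on input $G^{(i)}$, outputs an arbitrary $\mathrm{EDCS}(G^{(i)},\beta,(1-\lambda)\beta)$ is a $(3/2+\varepsilon)$-approximation randomized composable coreset of size $O(n\cdot\beta)$ for the maximum matching problem. That is, for arbitrary choices of EDCSs $C^{(i)}$ of $G^{(i)}$ with these parameters, with high probability (over the random $k$-partition) the graph $C^{(1)}\cup\cdots\cup C^{(k)}$ contains a matching of size at least $\mathrm{MM}(G)/(3/2+\varepsilon)$, and each $C^{(i)}$ has $O(n\beta)$ edges.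
   Context: For a graph $G$, $\mathrm{MM}(G)$ denotes the size of a maximum matching of $G$, and $\deg_H(v)$ the degree of $v$ in a subgraph $H$. A random $k$-partition of $G(V,E)$ is obtained by sending each edge of $E$ independently to one of $k$ sets $E^{(1)},\ldots,E^{(k)}$ chosen uniformly at random, and letting $G^{(i)}=(V,E^{(i)})$. For parameters $\beta>\beta^-$, an edge degree constrained subgraph $\mathrm{EDCS}(G,\beta,\beta^-)$ is a subgraph $H$ of $G$ such that (P1) every edge $(u,v)\in H$ satisfies $\deg_H(u)+\deg_H(v)\le\beta$, and (P2) every edge $(u,v)\in G\setminus H$ satisfies $\deg_H(u)+\deg_H(v)\ge\beta^-$. An algorithm ALG mapping graphs to subgraphs is an $\alpha$-approximation randomized composable coreset for maximum matching if for any graph $G$ and a random $k$-partition of $G$, the maximum matching of $\mathrm{ALG}(G^{(1)})\cup\cdots\cup\mathrm{ALG}(G^{(k)})$ has size at least $\mathrm{MM}(G)/\alpha$ with high probability; its size is the number of edges of the returned subgraph. "With high probability" means with probability $1-1/\mathrm{poly}(n)$. -}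

module Defs where

open import Data.Nat as ℕ using (ℕ; zero; suc; _+_; _*_; _≤_)
open import Data.Nat.Logarithm using (⌊log₂_⌋)
open import Data.Integer as ℤ using (ℤ; +_)
open import Data.Rational as ℚ using (ℚ; 0ℚ; 1ℚ; 1/_)
open import Data.Rational.Properties as ℚP using ()
open import Data.Fin as Fin using (Fin)
open import Data.Fin.Properties as FinP using ()
open import Data.Fin.Subset using (Subset; _∈_; _∉_; ⋃)
open import Data.Vec as Vec using (Vec; lookup)
open import Data.List as List using (List; allFin; map)
open import Data.Nat.ListAction using (sum)
open import Data.Bool using (Bool; true; false; if_then_else_; _∧_; _∨_)
open import Data.Product using (_×_; _,_; proj₁; proj₂)
open import Data.Sum using (_⊎_)
open import Relation.Binary.PropositionalEquality using (_≡_; _≢_)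
open import Relation.Nullary using (¬_; yes; no)
open import Relation.Nullary.Decidable using (⌊_⌋)

-- Simple graphs on vertex set Fin n with m edges, edges indexed by Fin m.
-- Each edge is an unordered pair {u,v} (stored as an ordered pair),
-- with no loops and no parallel edges.

SameEdge : ∀ {n} → Fin n × Fin n → Fin n × Fin n → Set
SameEdge (a , b) (c , d) = (a ≡ c × b ≡ d) ⊎ (a ≡ d × b ≡ c)

record Graph (n m : ℕ) : Set where
  field
    edge   : Fin m → Fin n × Fin n
    noLoop : ∀ j → proj₁ (edge j) ≢ proj₂ (edge j)
    simple : ∀ j j' → SameEdge (edge j) (edge j') → j ≡ j'
open Graph public

incident : ∀ {n} → Fin n → Fin n × Fin n → Bool
incident v (a , b) = ⌊ v Fin.≟ a ⌋ ∨ ⌊ v Fin.≟ b ⌋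

deg : ∀ {n m} → Graph n m → Subset m → Fin n → ℕ
deg G H v = sum (map (λ j → if lookup H j ∧ incident v (edge G j) then 1 else 0) (allFin _))

edgeDeg : ∀ {n m} → Graph n m → Subset m → Fin m → ℕ
edgeDeg G H j = deg G H (proj₁ (edge G j)) + deg G H (proj₂ (edge G j))

ShareVertex : ∀ {n} → Fin n × Fin n → Fin n × Fin n → Set
ShareVertex (a , b) (c , d) = (a ≡ c ⊎ a ≡ d) ⊎ (b ≡ c ⊎ b ≡ d)

IsMatching : ∀ {n m} → Graph n m → Subset m → Set
IsMatching G M = ∀ j j' → j ∈ M → j' ∈ M → j ≢ j' → ¬ ShareVertex (edge G j) (edge G j')

-- k-partitions of the edge set: edge j is sent to part (lookup p j).
Partition : ℕ → ℕ → Set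
Partition m k = Vec (Fin k) m

-- H is EDCS(G^(i), β, β⁻), where G^(i) = (V, {j | p j = i}).
record IsEDCS {n m k} (G : Graph n m) (p : Partition m k) (i : Fin k)
              (H : Subset m) (β : ℕ) (β⁻ : ℚ) : Set where
  field
    subgraph : ∀ j → j ∈ H → lookup p j ≡ i
    P1 : ∀ j → j ∈ H → edgeDeg G H j ≤ β
    P2 : ∀ j → lookup p j ≡ i → j ∉ H → β⁻ ℚ.≤ (+ edgeDeg G H j ℚ./ 1)

unionAll : ∀ {m k} → (Fin k → Subset m) → Subset m
unionAll {k = k} C = ⋃ (map C (allFin k))

toℚ : ℕ → ℚ
toℚ a = + a ℚ./ 1

_^ℚ_ : ℚ → ℕ → ℚ
q ^ℚ zero = 1ℚ
q ^ℚ suc e = q ℚ.* (q ^ℚ e)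

-- total inverse on ℚ (inv 0 = 0); agrees with 1/_ on nonzero inputs
inv : ℚ → ℚ
inv (ℚ.mkℚ (+ zero) _ _) = 0ℚ
inv q@(ℚ.mkℚ (+ suc a) _ _) = 1/ q
inv q@(ℚ.mkℚ (ℤ.-[1+ a ]) _ _) = 1/ q

-- Θ(log n): the logarithm proxy L(n) = ⌊log₂ n⌋ + 1 (≥ 1)
Lg : ℕ → ℕ
Lg n = suc ⌊log₂ n ⌋

lambdaOf : ℚ → ℕ → ℚ → ℚ
lambdaOf cλ n ε = cλ ℚ.* ((ε ℚ.* inv (toℚ (Lg n))) ^ℚ 2)

betaOf : ℚ → ℕ → ℚ → ℕ
betaOf cβ n ε = ℤ.∣ ℚ.ceiling (cβ ℚ.* (inv ε ^ℚ 6) ℚ.* (toℚ (Lg n) ^ℚ 7)) ∣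

{-
Fix an EDCS H of G with parameters (kβ, kβ - 1); it exists by minimising a
potential. By Chernoff bounds the part of H sent to G^(i) has, at every vertex,
degree close to deg_H / k, so it is close to an EDCS of G^(i). Any two EDCSs of
one graph have nearly equal degrees: a vertex with a large discrepancy forces
exponentially many vertices with a slightly smaller one. Hence each C^(i) has
degrees close to deg_H / k, all parts agree with each other, and their union is
nearly an EDCS of G with parameter kβ.

Given a matching M of G, a random bipartition crossed by all of M halves all
degrees of the union up to small errors (again by Chernoff). In the resulting
bipartite graph take a minimum vertex cover X (König). An edge of M missed by X
has degree sum about kβ/2 and its ends have all their neighbours in X; double
counting Σ deg² against the upper bound on degree sums shows that there are at
most about |X|/2 such edges, so |M| is at most about 3/2 |X|.
-}
module Submission where

open import Defs
open import Data.Nat using (ℕ; zero; suc; _+_; _*_; _∸_; _^_; _≤_; _<_; z≤n; s≤s; NonZero; >-nonZero; >-nonZero⁻¹; _/_)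
open import Data.Nat.Properties
open import Data.Nat.DivMod using (m≡m%n+[m/n]*n; m%n<n; m/n*n≤m; m*n/n≡m; /-monoˡ-≤; m≥n⇒m/n>0)
open import Data.Nat.Logarithm using (⌊log₂_⌋; ⌊log₂⌋-mono-≤; ⌊log₂[2^n]⌋≡n)
open import Data.Nat.Tactic.RingSolver using (solve-∀)
import Data.Nat.ListAction as ListAction
open import Data.Integer as ℤ using (ℤ) renaming (+_ to pos)
import Data.Integer.DivMod as ℤD
import Data.Integer.Properties as ℤP
open import Data.Rational as ℚ using (ℚ; 0ℚ; 1ℚ; ½)
import Data.Rational.Properties as ℚP
import Data.Rational.Solver as ℚS
import Data.Rational.Unnormalised as ℚᵘ
import Data.Rational.Unnormalised.Properties as ℚᵘP
open import Data.Fin as Fin using (Fin; zero; suc)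
import Data.Fin.Properties as FinP
open import Data.Fin.Subset as Subset using (Subset; _⊆_; ∣_∣)
open import Data.Fin.Subset.Properties using (anySubset?; x∈p∪q⁺)
open import Data.Bool as Bool using (Bool; true; false; if_then_else_; _∧_; _∨_; not; _xor_)
open import Data.Bool.Properties using (xor-comm; ∧-identityʳ)
open import Data.Maybe as Maybe using (Maybe; just; nothing; maybe′)
open import Data.List as List using (List; []; _∷_; length; _++_)
open import Data.List.Properties using (length-++; length-map; map-tabulate)
open import Data.List.Membership.Propositional using (_∉_; _∈_)
open import Data.List.Membership.Propositional.Properties using (∈-++⁺ˡ; ∈-++⁺ʳ; ∈-map⁺; ∈-allFin)
open import Data.List.Relation.Unary.Any using (here; there)
open import Data.Vec as Vec using (Vec; lookup; tabulate)
open import Data.Vec.Properties using (lookup∘tabulate; []=⇒lookup; lookup⇒[]=)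
open import Data.Product using (Σ; _×_; _,_; proj₁; proj₂; ∃; ∃-syntax)
open import Data.Sum using (_⊎_; inj₁; inj₂; [_,_]′)
open import Data.Empty using (⊥; ⊥-elim)
open import Relation.Binary.PropositionalEquality using (_≡_; _≢_; refl; sym; trans; cong; cong₂; subst; subst₂; module ≡-Reasoning)
open import Relation.Nullary using (¬_; Dec; yes; no; contradiction)
open import Relation.Nullary.Decidable using (⌊_⌋; _×-dec_; _→-dec_; ¬?; decidable-stable)
open import Function using (_∘_; id; _$_)
open import Algebra.Properties.Semiring.Sum +-*-semiring using (sum; sum-syntax; sum-cong-≗; ∑-comm; ∑-distrib-+; *-distribˡ-sum; *-distribʳ-sum)

-- The coresets and the matching are chosen after the partition, so the failure event may mention
-- neither. It is therefore an event about the fixed reference subgraph alone; on every other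
-- partition the statements about arbitrary coresets are deterministic. The bipartition is a second
-- random choice, made for a given matching, and only its existence matters. Probabilities are
-- numbers of vectors over finite types, so Chernoff's method runs in natural numbers: weights `a`
-- and `b` replace the exponential, and inequalities between quotients are cross-multiplied. Two
-- precisions govern the constants. Errors must stay below about `kβ / R`, with `R` a constant times
-- `1/ε`. Comparing two EDCSs multiplies an initial error by about `R * L`, where `L` is the
-- logarithm: one doubling takes `R` levels, and a contradiction takes `L` doublings. The sampling
-- error and the EDCS slack must therefore be of order `β / σ` with `σ = R * R * L`. Sampling with
-- relative precision `1/σ` also costs an additive `σ * L`, whence `β` is at least of order
-- `σ * σ * L`.

⟦_⟧ : Bool → ℕ
⟦ b ⟧ = if b then 1 else 0

-- Finite sums and indicators.

∑-mono : ∀ {n} {f g : Fin n → ℕ} → (∀ i → f i ≤ g i) → sum f ≤ sum g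
∑-mono {zero} h = z≤n
∑-mono {suc n} h = +-mono-≤ (h zero) (∑-mono (h ∘ suc))

∑-const : ∀ n c → ∑[ i < n ] c ≡ n * c
∑-const zero c = refl
∑-const (suc n) c = cong (c +_) (∑-const n c)

∑-all : ∀ n {f : Fin n → ℕ} c → (∀ i → f i ≡ c) → sum f ≡ n * c
∑-all n {f} c h = trans (sum-cong-≗ h) (∑-const n c)

∑-zero : ∀ {n} {f : Fin n → ℕ} → (∀ i → f i ≡ 0) → sum f ≡ 0
∑-zero {zero} h = refl
∑-zero {suc n} h rewrite h zero = ∑-zero (h ∘ suc)

term≤∑ : ∀ {n} (f : Fin n → ℕ) i → f i ≤ sum f
term≤∑ f zero = m≤m+n _ _
term≤∑ f (suc i) = ≤-trans (term≤∑ (f ∘ suc) i) (m≤n+m _ _)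

∑-single : ∀ {n} (f : Fin n → ℕ) i → (∀ j → j ≢ i → f j ≡ 0) → sum f ≡ f i
∑-single f zero h = trans (cong (f zero +_) (∑-zero (λ j → h (suc j) λ ()))) (+-identityʳ _)
∑-single f (suc i) h rewrite h zero (λ ()) =
  ∑-single (f ∘ suc) i (λ j j≢i → h (suc j) (λ { refl → j≢i refl }))

∑-bounded : ∀ {n c} {f : Fin n → ℕ} → (∀ i → f i ≤ c) → sum f ≤ n * c
∑-bounded {n} {c} h = ≤-trans (∑-mono h) (≤-reflexive (∑-const n c))

≟-refl : ∀ {n} (a : Fin n) → ⌊ a Fin.≟ a ⌋ ≡ true
≟-refl a with a Fin.≟ a
... | yes _ = refl
... | no ¬p = contradiction refl ¬p

≟-≢ : ∀ {n} {a b : Fin n} → a ≢ b → ⌊ a Fin.≟ b ⌋ ≡ false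
≟-≢ {a = a} {b} a≢b with a Fin.≟ b
... | yes p = contradiction p a≢b
... | no _ = refl

∑-δ : ∀ {n} (φ : Fin n → ℕ) a → ∑[ v < n ] (φ v * ⟦ ⌊ v Fin.≟ a ⌋ ⟧) ≡ φ a
∑-δ φ a = trans (∑-single _ a (λ v v≢a → trans (cong (λ b → φ v * ⟦ b ⟧) (≟-≢ v≢a)) (*-zeroʳ (φ v))))
  (trans (cong (λ b → φ a * ⟦ b ⟧) (≟-refl a)) (*-identityʳ (φ a)))

⟦⟧≤1 : ∀ b → ⟦ b ⟧ ≤ 1
⟦⟧≤1 true = ≤-refl
⟦⟧≤1 false = z≤n

⟦∧⟧ : ∀ a b → ⟦ a ∧ b ⟧ ≡ ⟦ a ⟧ * ⟦ b ⟧
⟦∧⟧ true b = sym (+-identityʳ _)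
⟦∧⟧ false b = refl

anyB : ∀ {n} → (Fin n → Bool) → Bool
anyB {zero} f = false
anyB {suc n} f = f zero ∨ anyB (f ∘ suc)

⟦∨⟧≤ : ∀ a b → ⟦ a ∨ b ⟧ ≤ ⟦ a ⟧ + ⟦ b ⟧
⟦∨⟧≤ true b = s≤s z≤n
⟦∨⟧≤ false b = ≤-refl

⟦anyB⟧≤∑ : ∀ {n} (f : Fin n → Bool) → ⟦ anyB f ⟧ ≤ ∑[ i < n ] ⟦ f i ⟧
⟦anyB⟧≤∑ {zero} f = z≤n
⟦anyB⟧≤∑ {suc n} f = ≤-trans (⟦∨⟧≤ (f zero) _) (+-monoʳ-≤ ⟦ f zero ⟧ (⟦anyB⟧≤∑ (f ∘ suc)))

∨-false : ∀ a b → a ∨ b ≡ false → a ≡ false × b ≡ false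
∨-false false false refl = refl , refl

anyB-false : ∀ {n} (f : Fin n → Bool) → anyB f ≡ false → ∀ i → f i ≡ false
anyB-false f e zero = proj₁ (∨-false (f zero) _ e)
anyB-false f e (suc i) = anyB-false (f ∘ suc) (proj₂ (∨-false (f zero) _ e)) i

-- Linear-arithmetic step: a ≤ b is certified by one inequality A ≤ B and a ring identity.
by-ineq : ∀ {a b A B} r → A ≤ B → a + B + r ≡ b + A → a ≤ b
by-ineq {a} {b} {A} {B} r A≤B eq = +-cancelʳ-≤ B a b (begin
  a + B      ≤⟨ m≤m+n _ r ⟩
  a + B + r  ≡⟨ eq ⟩
  b + A      ≤⟨ +-monoʳ-≤ b A≤B ⟩
  b + B      ∎)
  where open ≤-Reasoning

-- Exponential inequalities in cross-multiplied form.

-- Ratio x y z t is the inequality x/y ≤ z/t.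
record Ratio (x y z t : ℕ) : Set where
  constructor ratio
  field cross-≤ : x * t ≤ z * y
open Ratio

ratio-trans : ∀ {x y z t w u} → 0 < t → Ratio x y z t → Ratio z t w u → Ratio x y w u
ratio-trans {x} {y} {z} {suc t} {w} {u} _ (ratio p) (ratio q) = ratio $ *-cancelʳ-≤ (x * u) (w * y) (suc t) (begin
  x * u * suc t  ≡⟨ e₁ x u (suc t) ⟩
  x * suc t * u  ≤⟨ *-monoˡ-≤ u p ⟩
  z * y * u      ≡⟨ e₁ z y u ⟩
  z * u * y      ≤⟨ *-monoˡ-≤ y q ⟩
  w * suc t * y  ≡⟨ e₁ w (suc t) y ⟩
  w * y * suc t  ∎)
  where
  open ≤-Reasoning
  e₁ : ∀ a b c → a * b * c ≡ a * c * b
  e₁ = solve-∀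

*-interchange : ∀ a b c d → (a * b) * (c * d) ≡ (a * c) * (b * d)
*-interchange = solve-∀

ratio-* : ∀ {x y z t x′ y′ z′ t′} → Ratio x y z t → Ratio x′ y′ z′ t′ →
          Ratio (x * x′) (y * y′) (z * z′) (t * t′)
ratio-* {x} {y} {z} {t} {x′} {y′} {z′} {t′} (ratio p) (ratio q) =
  ratio $ subst₂ _≤_ (*-interchange x t x′ t′) (*-interchange z y z′ y′) (*-mono-≤ p q)

^-distrib-* : ∀ x y e → (x * y) ^ e ≡ x ^ e * y ^ e
^-distrib-* x y zero = refl
^-distrib-* x y (suc e) = trans (cong ((x * y) *_) (^-distrib-* x y e)) (*-interchange x y (x ^ e) (y ^ e))

ratio-^ : ∀ {x y z t} e → Ratio x y z t → Ratio (x ^ e) (y ^ e) (z ^ e) (t ^ e)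
ratio-^ {x} {y} {z} {t} e (ratio p) =
  ratio $ subst₂ _≤_ (^-distrib-* x t e) (^-distrib-* z y e) (^-monoˡ-≤ e p)

0<^ : ∀ x e → 0 < x → 0 < x ^ e
0<^ (suc x) e _ = m^n>0 (suc x) e

-- (1 + r/N)^j ≤ 1 / (1 - jr/N)
bernoulli-above : ∀ N r j u → j * r + u ≤ N → (N + r) ^ j * u ≤ N ^ suc j
bernoulli-above N r zero u h = subst₂ _≤_ (sym (+-identityʳ u)) (sym (*-identityʳ N)) h
bernoulli-above N r (suc j) u h = begin
  (N + r) * (N + r) ^ j * u        ≡⟨ e₁ N r ((N + r) ^ j) u ⟩
  (N + r) ^ j * (N * u + r * u)    ≤⟨ *-monoʳ-≤ ((N + r) ^ j) (+-monoʳ-≤ (N * u) (*-monoʳ-≤ r (≤-trans (m≤n+m u _) h))) ⟩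
  (N + r) ^ j * (N * u + r * N)    ≡⟨ e₂ N r ((N + r) ^ j) u ⟩
  N * ((N + r) ^ j * (r + u))      ≤⟨ *-monoʳ-≤ N (bernoulli-above N r j (r + u) (subst (_≤ N) (e₃ r (j * r) u) h)) ⟩
  N * N ^ suc j                    ∎
  where
  open ≤-Reasoning
  e₁ : ∀ N r p u → (N + r) * p * u ≡ p * (N * u + r * u)
  e₁ = solve-∀
  e₂ : ∀ N r p u → p * (N * u + r * N) ≡ N * (p * (r + u))
  e₂ = solve-∀
  e₃ : ∀ r x u → r + x + u ≡ x + (r + u)
  e₃ = solve-∀

-- (1 - 1/(N+1))^j ≤ 1 / (1 + j/(N+1))
bernoulli-below : ∀ N j → N ^ j * (suc N + j) ≤ suc N ^ suc j
bernoulli-below N zero = ≤-reflexive (e N)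
  where
  e : ∀ N → 1 * (suc N + 0) ≡ suc N * 1
  e = solve-∀
bernoulli-below N (suc j) = begin
  N * N ^ j * (suc N + suc j)    ≤⟨ m≤m+n _ (N ^ j * suc j) ⟩
  N * N ^ j * (suc N + suc j) + N ^ j * suc j  ≡⟨ e N (N ^ j) j ⟩
  suc N * (N ^ j * (suc N + j))  ≤⟨ *-monoʳ-≤ (suc N) (bernoulli-below N j) ⟩
  suc N * suc N ^ suc j          ∎
  where
  open ≤-Reasoning
  e : ∀ N p j → N * p * (suc N + suc j) + p * suc j ≡ suc N * (p * (suc N + j))
  e = solve-∀

-- Bernoulli with `σ` instead of `σ + 1` factors produces exactly the 2. In the tail bounds each
-- extra block of `σ + 1` weights thus contributes one factor 2.
two-≤-growth : ∀ σ → 2 * suc σ ^ suc σ ≤ suc (suc σ) ^ suc σ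
two-≤-growth σ = begin
  2 * (suc σ * suc σ ^ σ)             ≡⟨ e σ (suc σ ^ σ) ⟩
  suc σ ^ σ * (suc (suc σ) + σ)       ≤⟨ bernoulli-below (suc σ) σ ⟩
  suc (suc σ) ^ suc σ                 ∎
  where
  open ≤-Reasoning
  e : ∀ σ p → 2 * (suc σ * p) ≡ p * (suc (suc σ) + σ)
  e = solve-∀

-- (1 + 1/σ)^σ ≤ (1 + 1/(σ+1))^(σ+1)
growth-mono : ∀ σ .{{_ : NonZero σ}} → Ratio (suc σ ^ σ) (σ ^ σ) (suc (suc σ) ^ suc σ) (suc σ ^ suc σ)
growth-mono σ = ratio $ *-cancelˡ-≤ σ (begin
  σ * (suc σ ^ σ * (suc σ * suc σ ^ σ))                ≡⟨ e₁ σ (suc σ ^ σ) ⟩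
  (suc σ ^ σ * suc σ ^ σ) * (σ * suc σ)                ≡⟨ cong (_* (σ * suc σ)) (sym (^-distrib-* (suc σ) (suc σ) σ)) ⟩
  -- With `N = σ(σ + 2)` one has `(σ + 1)² = N + 1`, so the quotient to be bounded is `(1 + 1/N)^σ`,
  -- and `N - σ = σ(σ + 1)` is the remainder that Bernoulli needs.
  (suc σ * suc σ) ^ σ * (σ * suc σ)                    ≡⟨ cong (λ z → z ^ σ * (σ * suc σ)) (e₂ σ) ⟩
  (σ * suc (suc σ) + 1) ^ σ * (σ * suc σ)              ≤⟨ bernoulli-above (σ * suc (suc σ)) 1 σ (σ * suc σ) (≤-reflexive (e₃ σ)) ⟩
  (σ * suc (suc σ)) * (σ * suc (suc σ)) ^ σ            ≡⟨ cong ((σ * suc (suc σ)) *_) (^-distrib-* σ (suc (suc σ)) σ) ⟩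
  (σ * suc (suc σ)) * (σ ^ σ * suc (suc σ) ^ σ)        ≡⟨ e₄ σ (σ ^ σ) (suc (suc σ) ^ σ) ⟩
  σ * ((suc (suc σ) * suc (suc σ) ^ σ) * σ ^ σ)        ∎)
  where
  open ≤-Reasoning
  e₁ : ∀ σ p → σ * (p * (suc σ * p)) ≡ (p * p) * (σ * suc σ)
  e₁ = solve-∀
  e₂ : ∀ σ → suc σ * suc σ ≡ σ * suc (suc σ) + 1
  e₂ = solve-∀
  e₃ : ∀ σ → σ * 1 + σ * suc σ ≡ σ * suc (suc σ)
  e₃ = solve-∀
  e₄ : ∀ σ p r → (σ * suc (suc σ)) * (p * r) ≡ σ * ((suc (suc σ) * r) * p)
  e₄ = solve-∀

ratio-growth : ∀ σ .{{_ : NonZero σ}} w →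
  Ratio (suc σ ^ (σ * w)) (σ ^ (σ * w)) (suc (suc σ) ^ (suc σ * w)) (suc σ ^ (suc σ * w))
ratio-growth σ w = ratio $ subst₂ _≤_
  (cong₂ _*_ (^-*-assoc (suc σ) σ w) (^-*-assoc (suc σ) (suc σ) w))
  (cong₂ _*_ (^-*-assoc (suc (suc σ)) (suc σ) w) (^-*-assoc σ σ w))
  (cross-≤ (ratio-^ w (growth-mono σ)))

ratio-two : ∀ σ s → Ratio (2 ^ s) 1 (suc (suc σ) ^ (suc σ * s)) (suc σ ^ (suc σ * s))
ratio-two σ s = ratio $ subst₂ _≤_
  (cong (2 ^ s *_) (^-*-assoc (suc σ) (suc σ) s))
  (cong₂ _*_ (^-*-assoc (suc (suc σ)) (suc σ) s) (^-zeroˡ s))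
  (cross-≤ $ ratio-^ {2} {1} {suc (suc σ) ^ suc σ} {suc σ ^ suc σ} s (ratio $ subst (2 * suc σ ^ suc σ ≤_) (sym (*-identityʳ _)) (two-≤-growth σ)))

module _ (σ k w s D : ℕ) .{{_ : NonZero σ}} .{{_ : NonZero k}} where

  private
    τ = suc σ
    K = k * τ

    ratio-w+s : Ratio (2 ^ s * τ ^ (σ * w)) (1 * σ ^ (σ * w)) (suc τ ^ (τ * (w + s))) (τ ^ (τ * (w + s)))
    ratio-w+s = subst₂ (Ratio (2 ^ s * τ ^ (σ * w)) (1 * σ ^ (σ * w))) (eq (suc τ)) (eq τ)
      (ratio-* (ratio-two σ s) (ratio-growth σ w))
      where
      eq : ∀ x → x ^ (τ * s) * x ^ (τ * w) ≡ x ^ (τ * (w + s))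
      eq x = trans (sym (^-distribˡ-+-* x (τ * s) (τ * w)))
        (cong (x ^_) (trans (+-comm (τ * s) (τ * w)) (sym (*-distribˡ-+ τ w s))))

    0<K : 0 < K
    0<K = >-nonZero⁻¹ K {{m*n≢0 k τ}}

  -- With `k` colours, `(K + 1) / K` is the normalised moment of one coordinate when a hit weighs
  -- `τ + 1` and a miss `τ`. By Bernoulli its `k`-th power is at most `τ / σ`, so its `D`-th power
  -- is at most `(τ / σ)^(σ w)`, hence at most `((τ + 1) / τ)^(τ w)` by `growth-mono`. The other
  -- `τ s` factors of the threshold yield `2 ^ s`.
  upper-tail-ratio : D ≤ k * (σ * w) →
    2 ^ s * (τ ^ (τ * (w + s)) * (K + 1) ^ D) ≤ suc τ ^ (τ * (w + s)) * K ^ D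
  upper-tail-ratio h = subst₂ _≤_ (eq (2 ^ s)) eq′
    (cross-≤ (ratio-* one-block ratio-s))
    where
    E = σ * w
    one : Ratio ((K + 1) ^ k) (K ^ k) τ σ
    one = ratio $ *-cancelʳ-≤ _ _ k (begin
      (K + 1) ^ k * σ * k     ≡⟨ *-assoc ((K + 1) ^ k) σ k ⟩
      (K + 1) ^ k * (σ * k)   ≤⟨ bernoulli-above K 1 k (σ * k) (≤-reflexive (e k σ)) ⟩
      K * K ^ k               ≡⟨ e′ k τ (K ^ k) ⟩
      τ * K ^ k * k           ∎)
      where
      open ≤-Reasoning
      e : ∀ k σ → k * 1 + σ * k ≡ k * suc σ
      e = solve-∀
      e′ : ∀ k τ p → k * τ * p ≡ τ * p * k
      e′ = solve-∀
    all : Ratio ((K + 1) ^ (k * E)) (K ^ (k * E)) (τ ^ E) (σ ^ E)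
    all = ratio $ subst₂ _≤_ (cong (_* σ ^ E) (^-*-assoc (K + 1) k E)) (cong (τ ^ E *_) (^-*-assoc K k E))
      (cross-≤ $ ratio-^ E one)
    pad : Ratio ((K + 1) ^ D) (K ^ D) ((K + 1) ^ (k * E)) (K ^ (k * E))
    pad = ratio $ begin
      (K + 1) ^ D * K ^ (k * E)        ≡⟨ cong (λ z → (K + 1) ^ D * K ^ z) (sym (m+[n∸m]≡n h)) ⟩
      (K + 1) ^ D * K ^ (D + (k * E ∸ D))     ≡⟨ cong ((K + 1) ^ D *_) (^-distribˡ-+-* K D _) ⟩
      (K + 1) ^ D * (K ^ D * K ^ (k * E ∸ D)) ≤⟨ *-monoʳ-≤ ((K + 1) ^ D) (*-monoʳ-≤ (K ^ D) (^-monoˡ-≤ (k * E ∸ D) (m≤m+n K 1))) ⟩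
      (K + 1) ^ D * (K ^ D * (K + 1) ^ (k * E ∸ D)) ≡⟨ e ((K + 1) ^ D) (K ^ D) _ ⟩
      (K + 1) ^ D * (K + 1) ^ (k * E ∸ D) * K ^ D ≡⟨ cong (_* K ^ D) (sym (^-distribˡ-+-* (K + 1) D _)) ⟩
      (K + 1) ^ (D + (k * E ∸ D)) * K ^ D ≡⟨ cong (λ z → (K + 1) ^ z * K ^ D) (m+[n∸m]≡n h) ⟩
      (K + 1) ^ (k * E) * K ^ D ∎
      where
      open ≤-Reasoning
      e : ∀ a b c → a * (b * c) ≡ a * c * b
      e = solve-∀
    one-block : Ratio ((K + 1) ^ D) (K ^ D) (suc τ ^ (τ * w)) (τ ^ (τ * w))
    one-block = ratio-trans (0<^ σ E (>-nonZero⁻¹ σ))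
      (ratio-trans (0<^ K (k * E) 0<K) pad all) (ratio-growth σ w)
    ratio-s : Ratio (2 ^ s) 1 (suc τ ^ (τ * s)) (τ ^ (τ * s))
    ratio-s = ratio-two σ s
    sp : ∀ x → x ^ (τ * w) * x ^ (τ * s) ≡ x ^ (τ * (w + s))
    sp x = trans (sym (^-distribˡ-+-* x (τ * w) (τ * s))) (cong (x ^_) (sym (*-distribˡ-+ τ w s)))
    eq : ∀ p → ((K + 1) ^ D * p) * (τ ^ (τ * w) * τ ^ (τ * s)) ≡ p * (τ ^ (τ * (w + s)) * (K + 1) ^ D)
    eq p = trans (e ((K + 1) ^ D) p (τ ^ (τ * w)) (τ ^ (τ * s))) (cong (λ z → p * (z * (K + 1) ^ D)) (sp τ))
      where
      e : ∀ a c b d → (a * c) * (b * d) ≡ c * (b * d * a)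
      e = solve-∀
    eq′ : (suc τ ^ (τ * w) * suc τ ^ (τ * s)) * (K ^ D * 1) ≡ suc τ ^ (τ * (w + s)) * K ^ D
    eq′ = trans (e (suc τ ^ (τ * w)) (suc τ ^ (τ * s)) (K ^ D)) (cong (_* K ^ D) (sp (suc τ)))
      where
      e : ∀ a c b → (a * c) * (b * 1) ≡ a * c * b
      e = solve-∀

  -- Here a hit weighs `σ` and a miss `τ`, with normalised moment `(K - 1) / K`, whose `k`-th power
  -- is at most `τ / (τ + 1)`. The growth estimates are the same as before, with the fractions
  -- inverted in `swap`.
  lower-tail-ratio : ∀ K⁻ → suc K⁻ ≡ K → k * (τ * (w + s)) ≤ D →
    2 ^ s * (τ ^ (σ * w) * K⁻ ^ D) ≤ σ ^ (σ * w) * K ^ D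
  lower-tail-ratio K⁻ K⁻≡ h = subst₂ _≤_ (eq (2 ^ s) (τ ^ (σ * w)) (K⁻ ^ D)) (eq′ (σ ^ (σ * w)) (K ^ D)) (cross-≤ main)
    where
    E = τ * (w + s)
    one : Ratio (K⁻ ^ k) (K ^ k) τ (suc τ)
    one = ratio $ *-cancelʳ-≤ _ _ k (begin
      K⁻ ^ k * suc τ * k      ≡⟨ e k τ (K⁻ ^ k) ⟩
      K⁻ ^ k * (k * τ + k)    ≡⟨ cong (λ z → K⁻ ^ k * (z + k)) (sym K⁻≡) ⟩
      K⁻ ^ k * (suc K⁻ + k)   ≤⟨ bernoulli-below K⁻ k ⟩
      suc K⁻ ^ suc k          ≡⟨ cong (_^ suc k) K⁻≡ ⟩
      K * K ^ k               ≡⟨ e′ k τ (K ^ k) ⟩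
      τ * K ^ k * k           ∎)
      where
      open ≤-Reasoning
      e : ∀ k τ p → p * suc τ * k ≡ p * (k * τ + k)
      e = solve-∀
      e′ : ∀ k τ p → k * τ * p ≡ τ * p * k
      e′ = solve-∀
    all : Ratio (K⁻ ^ (k * E)) (K ^ (k * E)) (τ ^ E) (suc τ ^ E)
    all = ratio $ subst₂ _≤_ (cong (_* suc τ ^ E) (^-*-assoc K⁻ k E)) (cong (τ ^ E *_) (^-*-assoc K k E))
      (cross-≤ $ ratio-^ E one)
    K⁻≤K : K⁻ ≤ K
    K⁻≤K = subst (K⁻ ≤_) K⁻≡ (n≤1+n K⁻)
    pad : Ratio (K⁻ ^ D) (K ^ D) (K⁻ ^ (k * E)) (K ^ (k * E))
    pad = ratio $ begin
      K⁻ ^ D * K ^ (k * E)        ≡⟨ cong (λ z → K⁻ ^ z * K ^ (k * E)) (sym (m+[n∸m]≡n h)) ⟩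
      K⁻ ^ (k * E + r) * K ^ (k * E)  ≡⟨ cong (_* K ^ (k * E)) (^-distribˡ-+-* K⁻ (k * E) r) ⟩
      K⁻ ^ (k * E) * K⁻ ^ r * K ^ (k * E) ≤⟨ *-monoˡ-≤ (K ^ (k * E)) (*-monoʳ-≤ (K⁻ ^ (k * E)) (^-monoˡ-≤ r K⁻≤K)) ⟩
      K⁻ ^ (k * E) * K ^ r * K ^ (k * E) ≡⟨ e (K⁻ ^ (k * E)) (K ^ r) (K ^ (k * E)) ⟩
      K⁻ ^ (k * E) * (K ^ (k * E) * K ^ r) ≡⟨ cong (K⁻ ^ (k * E) *_) (sym (^-distribˡ-+-* K (k * E) r)) ⟩
      K⁻ ^ (k * E) * K ^ (k * E + r) ≡⟨ cong (λ z → K⁻ ^ (k * E) * K ^ z) (m+[n∸m]≡n h) ⟩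
      K⁻ ^ (k * E) * K ^ D ∎
      where
      open ≤-Reasoning
      r = D ∸ k * E
      e : ∀ a b c → a * b * c ≡ a * (c * b)
      e = solve-∀
    shrink : Ratio (K⁻ ^ D) (K ^ D) (τ ^ E) (suc τ ^ E)
    shrink = ratio-trans (0<^ K (k * E) 0<K) pad all
    swap : Ratio (τ ^ E) (suc τ ^ E) (1 * σ ^ (σ * w)) (2 ^ s * τ ^ (σ * w))
    swap = ratio $ subst₂ _≤_ (*-comm (2 ^ s * τ ^ (σ * w)) (τ ^ E)) (*-comm (suc τ ^ E) (1 * σ ^ (σ * w))) (cross-≤ ratio-w+s)
    main : Ratio (K⁻ ^ D) (K ^ D) (1 * σ ^ (σ * w)) (2 ^ s * τ ^ (σ * w))
    main = ratio-trans (0<^ (suc τ) E (s≤s z≤n)) shrink swap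
    eq : ∀ a b c → c * (a * b) ≡ a * (b * c)
    eq = solve-∀
    eq′ : ∀ a b → 1 * a * b ≡ a * b
    eq′ = solve-∀

-- Counting over vectors.

-- Sums over Vec (Fin k) N stand for expectations over independent uniform coordinates.
∑V : ∀ k N → (Vec (Fin k) N → ℕ) → ℕ
∑V k zero f = f Vec.[]
∑V k (suc N) f = ∑[ c < k ] ∑V k N (λ x → f (c Vec.∷ x))

count : ∀ {k N} → (Vec (Fin k) N → Bool) → ℕ
count {k} {N} P = ∑V k N (λ x → ⟦ P x ⟧)

∑V-mono : ∀ {k} N {f g : Vec (Fin k) N → ℕ} → (∀ x → f x ≤ g x) → ∑V k N f ≤ ∑V k N g
∑V-mono zero h = h Vec.[]
∑V-mono (suc N) h = ∑-mono (λ c → ∑V-mono N (λ x → h (c Vec.∷ x)))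

∑V-scaleʳ : ∀ {k} N c (f : Vec (Fin k) N → ℕ) → ∑V k N f * c ≡ ∑V k N (λ x → f x * c)
∑V-scaleʳ zero c f = refl
∑V-scaleʳ {k} (suc N) c f = trans (*-distribʳ-sum c (λ d → ∑V k N (λ x → f (d Vec.∷ x)))) (sum-cong-≗ (λ d → ∑V-scaleʳ {k} N c (λ x → f (d Vec.∷ x))))

∑V-∑ : ∀ {k} N {I} (f : Fin I → Vec (Fin k) N → ℕ) →
       ∑V k N (λ x → ∑[ i < I ] f i x) ≡ ∑[ i < I ] ∑V k N (f i)
∑V-∑ zero f = refl
∑V-∑ (suc N) f = trans (sum-cong-≗ (λ c → ∑V-∑ N (λ i x → f i (c Vec.∷ x)))) (∑-comm (λ c i → ∑V _ N (λ x → f i (c Vec.∷ x))))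

∑V-+ : ∀ {k} N (f g : Vec (Fin k) N → ℕ) → ∑V k N (λ x → f x + g x) ≡ ∑V k N f + ∑V k N g
∑V-+ zero f g = refl
∑V-+ (suc N) f g = trans (sum-cong-≗ (λ c → ∑V-+ N (λ x → f (c Vec.∷ x)) (λ x → g (c Vec.∷ x)))) (∑-distrib-+ (λ c → ∑V _ N (λ x → f (c Vec.∷ x))) (λ c → ∑V _ N (λ x → g (c Vec.∷ x))))

count-anyB : ∀ {k N I} (P : Fin I → Vec (Fin k) N → Bool) →
             count (λ x → anyB (λ i → P i x)) ≤ ∑[ i < I ] count (P i)
count-anyB {N = N} P = ≤-trans (∑V-mono N (λ x → ⟦anyB⟧≤∑ (λ i → P i x)))
  (≤-reflexive (∑V-∑ N (λ i x → ⟦ P i x ⟧)))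

count-∨ : ∀ {k N} (P Q : Vec (Fin k) N → Bool) → count (λ x → P x ∨ Q x) ≤ count P + count Q
count-∨ {N = N} P Q = ≤-trans (∑V-mono N (λ x → ⟦∨⟧≤ (P x) (Q x)))
  (≤-reflexive (∑V-+ N (λ x → ⟦ P x ⟧) (λ x → ⟦ Q x ⟧)))

concatF : ∀ {n} {A : Set} → (Fin n → List A) → List A
concatF {zero} f = []
concatF {suc n} f = f zero ++ concatF (f ∘ suc)

length-concatF : ∀ {n} {A : Set} (f : Fin n → List A) → length (concatF f) ≡ ∑[ i < n ] length (f i)
length-concatF {zero} f = refl
length-concatF {suc n} f = trans (length-++ (f zero)) (cong (length (f zero) +_) (length-concatF (f ∘ suc)))

∈-concatF : ∀ {n} {A : Set} {x : A} (f : Fin n → List A) i → x ∈ f i → x ∈ concatF f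
∈-concatF f zero p = ∈-++⁺ˡ p
∈-concatF f (suc i) p = ∈-++⁺ʳ (f zero) (∈-concatF (f ∘ suc) i p)

-- An event becomes the explicit list of exceptional partitions that the theorem asks for;
-- `length-select` identifies the length of the list with the count.
select : ∀ {k} N → (Vec (Fin k) N → Bool) → List (Vec (Fin k) N)
select zero P = if P Vec.[] then Vec.[] ∷ [] else []
select (suc N) P = concatF (λ c → List.map (c Vec.∷_) (select N (λ x → P (c Vec.∷ x))))

length-select : ∀ {k} N (P : Vec (Fin k) N → Bool) → length (select N P) ≡ count P
length-select zero P with P Vec.[]
... | true = refl
... | false = refl
length-select (suc N) P = trans (length-concatF (λ c → List.map (c Vec.∷_) (select N (λ x → P (c Vec.∷ x)))))
  (sum-cong-≗ (λ c → trans (length-map (c Vec.∷_) (select N (λ x → P (c Vec.∷ x)))) (length-select N (λ x → P (c Vec.∷ x)))))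

∈-select : ∀ {k} N (P : Vec (Fin k) N → Bool) x → P x ≡ true → x ∈ select N P
∈-select zero P Vec.[] e rewrite e = here refl
∈-select (suc N) P (c Vec.∷ x) e =
  ∈-concatF _ c (∈-map⁺ (c Vec.∷_) (∈-select N (λ y → P (c Vec.∷ y)) x e))

∉-select : ∀ {k} N (P : Vec (Fin k) N → Bool) x → x ∉ select N P → P x ≡ false
∉-select N P x x∉ with P x in e
... | true = contradiction (∈-select N P x e) x∉
... | false = refl

∀⊎∃false : ∀ {n} (P : Fin n → Set) (Q : Set) → (∀ c → P c ⊎ Q) → (∀ c → P c) ⊎ Q
∀⊎∃false {zero} P Q h = inj₁ λ ()
∀⊎∃false {suc n} P Q h with h zero | ∀⊎∃false (P ∘ suc) Q (h ∘ suc)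
... | inj₂ q | _ = inj₂ q
... | inj₁ _ | inj₂ q = inj₂ q
... | inj₁ p | inj₁ ps = inj₁ λ { zero → p ; (suc i) → ps i }

count-full⊎avoid : ∀ {k} N (P : Vec (Fin k) N → Bool) → (count P ≡ k ^ N) ⊎ (∃[ x ] P x ≡ false)
count-full⊎avoid zero P with P Vec.[] in e
... | true = inj₁ refl
... | false = inj₂ (Vec.[] , e)
count-full⊎avoid {k} (suc N) P
  with ∀⊎∃false (λ c → count (λ x → P (c Vec.∷ x)) ≡ k ^ N) (∃[ x ] P x ≡ false)
         (λ c → [ inj₁ , (λ { (x , e) → inj₂ (c Vec.∷ x , e) }) ]′ (count-full⊎avoid N (λ x → P (c Vec.∷ x))))
... | inj₁ h = inj₁ (∑-all k (k ^ N) h)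
... | inj₂ q = inj₂ q

-- The probabilistic method in constructive form: the search through all vectors either certifies
-- the full count or meets a vector outside `P`.
avoid : ∀ {k} N (P : Vec (Fin k) N → Bool) → count P < k ^ N → ∃[ x ] P x ≡ false
avoid N P lt with count-full⊎avoid N P
... | inj₁ e = contradiction (subst (_< _) e lt) (n≮n _)
... | inj₂ q = q

-- Exponential moments and Markov's inequality.

module _ {k : ℕ} (a b : ℕ) where

  -- Exponential tilting without division: up to a constant factor, the product of these weights
  -- over the tracked coordinates is `(a/b)^hits`.
  weight : Maybe (Fin k) → Fin k → ℕ
  weight nothing c = 1
  weight (just t) c = if ⌊ c Fin.≟ t ⌋ then a else b

  weights : ∀ {N} → (Fin N → Maybe (Fin k)) → Vec (Fin k) N → ℕ
  weights J Vec.[] = 1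
  weights J (c Vec.∷ x) = weight (J zero) c * weights (J ∘ suc) x

is-just is-nothing : ∀ {A : Set} → Maybe A → ℕ
is-just (just _) = 1
is-just nothing = 0
is-nothing (just _) = 0
is-nothing nothing = 1

hit miss : ∀ {k} → Maybe (Fin k) → Fin k → ℕ
hit (just t) c = ⟦ ⌊ c Fin.≟ t ⌋ ⟧
hit nothing c = 0
miss (just t) c = ⟦ not ⌊ c Fin.≟ t ⌋ ⟧
miss nothing c = 0

module _ {k N} (J : Fin N → Maybe (Fin k)) where
  tracked free : ℕ
  tracked = ∑[ r < N ] is-just (J r)
  free = ∑[ r < N ] is-nothing (J r)

  hits misses : Vec (Fin k) N → ℕ
  hits x = ∑[ r < N ] hit (J r) (lookup x r)
  misses x = ∑[ r < N ] miss (J r) (lookup x r)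

  hits+misses : ∀ x → hits x + misses x ≡ tracked
  hits+misses x = trans (sym (∑-distrib-+ (λ r → hit (J r) (lookup x r)) (λ r → miss (J r) (lookup x r))))
    (sum-cong-≗ (λ r → go (J r) (lookup x r)))
    where
    go : ∀ j c → hit {k} j c + miss j c ≡ is-just j
    go nothing c = refl
    go (just t) c with ⌊ c Fin.≟ t ⌋
    ... | true = refl
    ... | false = refl

  free+tracked : free + tracked ≡ N
  free+tracked = trans (sym (∑-distrib-+ (is-nothing ∘ J) (is-just ∘ J)))
    (trans (sum-cong-≗ (λ r → go (J r))) (trans (∑-const N 1) (*-identityʳ N)))
    where
    go : ∀ (j : Maybe (Fin k)) → is-nothing j + is-just j ≡ 1
    go nothing = refl
    go (just t) = refl

weight-sum : ∀ {k} a b (t : Fin (suc k)) → ∑[ c < suc k ] weight a b (just t) c ≡ a + k * b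
weight-sum {k} a b zero = cong (a +_) (∑-const k b)
weight-sum {suc k} a b (suc t) = trans (cong (b +_) (trans (sum-cong-≗ (λ c → cong (if_then a else b) (suc≟ c t))) (weight-sum a b t))) (e a b (k * b))
  where
  suc≟ : ∀ {n} (c t : Fin n) → ⌊ Fin.suc c Fin.≟ suc t ⌋ ≡ ⌊ c Fin.≟ t ⌋
  suc≟ c t with c Fin.≟ t
  ... | yes _ = refl
  ... | no _ = refl
  e : ∀ a b x → b + (a + x) ≡ a + (b + x)
  e = solve-∀

∑V-scaleˡ : ∀ {k} N c (f : Vec (Fin k) N → ℕ) → ∑V k N (λ x → c * f x) ≡ c * ∑V k N f
∑V-scaleˡ zero c f = refl
∑V-scaleˡ {k} (suc N) c f = trans (sum-cong-≗ (λ d → ∑V-scaleˡ {k} N c (λ x → f (d Vec.∷ x)))) (sym (*-distribˡ-sum c (λ d → ∑V k N (λ x → f (d Vec.∷ x)))))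

-- Independence of the coordinates: the sum of a product over all vectors factors, and a tracked
-- coordinate has one hit and `k` misses among its `suc k` values.
moment : ∀ {k} N a b (J : Fin N → Maybe (Fin (suc k))) →
  ∑V (suc k) N (weights a b J) ≡ suc k ^ free J * (a + k * b) ^ tracked J
moment zero a b J = refl
moment {k} (suc N) a b J = trans (trans (sum-cong-≗ (λ c → ∑V-scaleˡ N (weight a b (J zero) c) (weights a b (J ∘ suc))))
  (sym (*-distribʳ-sum (∑V (suc k) N (weights a b (J ∘ suc))) (weight a b (J zero)))))
  (trans (cong (sum (weight a b (J zero)) *_) (moment N a b (J ∘ suc))) (go (J zero)))
  where
  Z = suc k ^ free (J ∘ suc)
  W = (a + k * b) ^ tracked (J ∘ suc)
  go : ∀ j → sum (weight a b j) * (Z * W) ≡ suc k ^ (is-nothing j + free (J ∘ suc)) * (a + k * b) ^ (is-just j + tracked (J ∘ suc))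
  go nothing = trans (cong (_* (Z * W)) (trans (∑-const (suc k) 1) (*-identityʳ (suc k)))) (sym (*-assoc (suc k) Z W))
  go (just t) = trans (cong (_* (Z * W)) (weight-sum a b t)) (e (a + k * b) Z W)
    where
    e : ∀ x z w → x * (z * w) ≡ z * (x * w)
    e = solve-∀

weights≡ : ∀ {k N} a b (J : Fin N → Maybe (Fin k)) x → weights a b J x ≡ a ^ hits J x * b ^ misses J x
weights≡ a b J Vec.[] = refl
weights≡ a b J (c Vec.∷ x) rewrite weights≡ a b (J ∘ suc) x = go (J zero)
  where
  X = hits (J ∘ suc) x
  Y = misses (J ∘ suc) x
  go : ∀ j → weight a b j c * (a ^ X * b ^ Y) ≡ a ^ (hit j c + X) * b ^ (miss j c + Y)
  go nothing = +-identityʳ _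
  go (just t) with ⌊ c Fin.≟ t ⌋
  ... | true = sym (*-assoc a _ _)
  ... | false = e b (a ^ X) (b ^ Y)
    where
    e : ∀ b x y → b * (x * y) ≡ x * (b * y)
    e = solve-∀

-- Markov's inequality for the tilted weight, with `p` the reciprocal of the failure probability.
-- The extra powers of `b` keep the threshold `(a/b)^S` free of quotients. The last hypothesis is
-- the purely numerical comparison of moment and threshold.
markov : ∀ {k N} a b p S (J : Fin N → Maybe (Fin (suc k))) (P : Vec (Fin (suc k)) N → Bool) → 0 < a → 0 < b →
  (∀ x → P x ≡ true → a ^ S * b ^ tracked J ≤ a ^ hits J x * b ^ misses J x * b ^ S) →
  p * (b ^ S * (a + k * b) ^ tracked J) ≤ a ^ S * (suc k * b) ^ tracked J →
  count P * p ≤ suc k ^ N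
markov {k} {N} a b p S J P 0<a 0<b h hp = *-cancelʳ-≤ _ _ M {{>-nonZero 0<M}} (begin
  count P * p * M                             ≡⟨ e₁ (count P) p M ⟩
  p * (count P * M)                           ≤⟨ *-monoʳ-≤ p cM ⟩
  p * (suc k ^ free J * (a + k * b) ^ D * b ^ S)  ≡⟨ e₂ p (suc k ^ free J) ((a + k * b) ^ D) (b ^ S) ⟩
  suc k ^ free J * (p * (b ^ S * (a + k * b) ^ D))  ≤⟨ *-monoʳ-≤ (suc k ^ free J) hp ⟩
  suc k ^ free J * (a ^ S * (suc k * b) ^ D)        ≡⟨ cong (λ z → suc k ^ free J * (a ^ S * z)) (^-distrib-* (suc k) b D) ⟩
  suc k ^ free J * (a ^ S * (suc k ^ D * b ^ D))    ≡⟨ e₃ (suc k ^ free J) (a ^ S) (suc k ^ D) (b ^ D) ⟩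
  suc k ^ free J * suc k ^ D * M                    ≡⟨ cong (_* M) (trans (sym (^-distribˡ-+-* (suc k) (free J) D)) (cong (suc k ^_) (free+tracked J))) ⟩
  suc k ^ N * M                                     ∎)
  where
  open ≤-Reasoning
  D = tracked J
  M = a ^ S * b ^ D
  0<M : 0 < M
  0<M = *-mono-< (0<^ a S 0<a) (0<^ b D 0<b)
  e₁ : ∀ c p m → c * p * m ≡ p * (c * m)
  e₁ = solve-∀
  e₂ : ∀ p f w s → p * (f * w * s) ≡ f * (p * (s * w))
  e₂ = solve-∀
  e₃ : ∀ f s x y → f * (s * (x * y)) ≡ f * x * (s * y)
  e₃ = solve-∀
  pointwise : ∀ x → ⟦ P x ⟧ * M ≤ weights a b J x * b ^ S
  pointwise x with P x in eq
  ... | true = subst₂ _≤_ (sym (+-identityʳ M)) (cong (_* b ^ S) (sym (weights≡ a b J x))) (h x eq)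
  ... | false = z≤n
  cM : count P * M ≤ suc k ^ free J * (a + k * b) ^ D * b ^ S
  cM = begin
    count P * M                                         ≡⟨ ∑V-scaleʳ N M (λ x → ⟦ P x ⟧) ⟩
    ∑V (suc k) N (λ x → ⟦ P x ⟧ * M)                    ≤⟨ ∑V-mono N pointwise ⟩
    ∑V (suc k) N (λ x → weights a b J x * b ^ S)        ≡⟨ sym (∑V-scaleʳ N (b ^ S) (weights a b J)) ⟩
    ∑V (suc k) N (weights a b J) * b ^ S                ≡⟨ cong (_* b ^ S) (moment N a b J) ⟩
    suc k ^ free J * (a + k * b) ^ D * b ^ S            ∎

^-swap-≤ : ∀ {a b} z → b ≤ a → ∀ X Y T → X ≡ T + z → a ^ T * b ^ (X + Y) ≤ a ^ X * b ^ Y * b ^ T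
^-swap-≤ {a} {b} z b≤a X Y T refl = begin
  a ^ T * b ^ (T + z + Y)            ≡⟨ cong (a ^ T *_) (trans (^-distribˡ-+-* b (T + z) Y) (cong (_* b ^ Y) (^-distribˡ-+-* b T z))) ⟩
  a ^ T * (b ^ T * b ^ z * b ^ Y)    ≤⟨ *-monoʳ-≤ (a ^ T) (*-monoˡ-≤ (b ^ Y) (*-monoʳ-≤ (b ^ T) (^-monoˡ-≤ z b≤a))) ⟩
  a ^ T * (b ^ T * a ^ z * b ^ Y)    ≡⟨ e (a ^ T) (b ^ T) (a ^ z) (b ^ Y) ⟩
  a ^ T * a ^ z * b ^ Y * b ^ T      ≡⟨ cong (λ w → w * b ^ Y * b ^ T) (sym (^-distribˡ-+-* a T z)) ⟩
  a ^ (T + z) * b ^ Y * b ^ T        ∎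
  where
  open ≤-Reasoning
  e : ∀ p q r s → p * (q * r * s) ≡ p * r * s * q
  e = solve-∀

^-swap-≤′ : ∀ {a b} z → a ≤ b → ∀ X Y T → T ≡ X + z → a ^ T * b ^ (X + Y) ≤ a ^ X * b ^ Y * b ^ T
^-swap-≤′ {a} {b} z a≤b X Y T refl = begin
  a ^ (X + z) * b ^ (X + Y)          ≡⟨ cong₂ _*_ (^-distribˡ-+-* a X z) (^-distribˡ-+-* b X Y) ⟩
  a ^ X * a ^ z * (b ^ X * b ^ Y)    ≤⟨ *-monoˡ-≤ (b ^ X * b ^ Y) (*-monoʳ-≤ (a ^ X) (^-monoˡ-≤ z a≤b)) ⟩
  a ^ X * b ^ z * (b ^ X * b ^ Y)    ≡⟨ e (a ^ X) (b ^ z) (b ^ X) (b ^ Y) ⟩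
  a ^ X * b ^ Y * (b ^ X * b ^ z)    ≡⟨ cong (a ^ X * b ^ Y *_) (sym (^-distribˡ-+-* b X z)) ⟩
  a ^ X * b ^ Y * b ^ (X + z)        ∎
  where
  open ≤-Reasoning
  e : ∀ p q r s → p * q * (r * s) ≡ p * s * (r * q)
  e = solve-∀

⌊⌋-true : ∀ {P : Set} (d : Dec P) → ⌊ d ⌋ ≡ true → P
⌊⌋-true (yes p) _ = p

⌊⌋-false : ∀ {P : Set} (d : Dec P) → ⌊ d ⌋ ≡ false → ¬ P
⌊⌋-false (no ¬p) _ = ¬p

true-⌊⌋ : ∀ {P : Set} (d : Dec P) → P → ⌊ d ⌋ ≡ true
true-⌊⌋ (yes _) _ = refl
true-⌊⌋ (no ¬p) p = contradiction p ¬p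

∧-true : ∀ {a b} → a ∧ b ≡ true → a ≡ true × b ≡ true
∧-true {true} {true} _ = refl , refl

-- Chernoff bounds for numbers of independent matches.

find : ∀ {I} → (Fin I → Bool) → Maybe (Fin I)
find {zero} f = nothing
find {suc I} f = if f zero then just zero else Maybe.map suc (find (f ∘ suc))

-- An item `u` of `F` inspects coordinate `ρ u` and succeeds on the value `t u`. As `ρ` is injective
-- on `F`, each coordinate serves at most one item; so the successes are independent, and `J` can
-- record the one target of each coordinate.
module _ {I N k : ℕ} (F : Fin I → Bool) (ρ : Fin I → Fin N) (t : Fin I → Fin (suc k))
  (injective : ∀ u u′ → F u ≡ true → F u′ ≡ true → ρ u ≡ ρ u′ → u ≡ u′) where

  private
    at : Fin N → Fin I → Bool
    at r u = F u ∧ ⌊ r Fin.≟ ρ u ⌋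

    J : Fin N → Maybe (Fin (suc k))
    J r = Maybe.map t (find (at r))

    AtMostOne : ∀ {I} → (Fin I → Bool) → Set
    AtMostOne f = ∀ u u′ → f u ≡ true → f u′ ≡ true → u ≡ u′

    find-∑ : ∀ {I} (f : Fin I → Bool) (φ : Fin I → ℕ) → AtMostOne f →
             maybe′ φ 0 (find f) ≡ ∑[ u < I ] (φ u * ⟦ f u ⟧)
    find-∑ {zero} f φ h = refl
    find-∑ {suc I} f φ h with f zero in e
    ... | true = sym (trans (cong₂ _+_ (*-identityʳ (φ zero)) (∑-zero (λ u → trans (cong (λ b → φ (suc u) * ⟦ b ⟧) (none u)) (*-zeroʳ (φ (suc u)))))) (+-identityʳ _))
      where
      none : ∀ u → f (suc u) ≡ false
      none u with f (suc u) in e′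
      ... | false = refl
      ... | true = contradiction (h zero (suc u) e e′) λ ()
    ... | false = trans (go (find (f ∘ suc))) (trans (find-∑ (f ∘ suc) (φ ∘ suc) (λ u u′ p q → FinP.suc-injective (h (suc u) (suc u′) p q)))
             (cong (_+ ∑[ u < I ] (φ (suc u) * ⟦ f (suc u) ⟧)) (sym (*-zeroʳ (φ zero)))))
      where
      go : ∀ j → maybe′ φ 0 (Maybe.map suc j) ≡ maybe′ (φ ∘ suc) 0 j
      go nothing = refl
      go (just _) = refl

    one : ∀ r → AtMostOne (at r)
    one r u u′ p q with ∧-true {F u} p | ∧-true {F u′} q
    ... | Fu , e | Fu′ , e′ = injective u u′ Fu Fu′ (trans (sym (⌊⌋-true (r Fin.≟ ρ u) e)) (⌊⌋-true (r Fin.≟ ρ u′) e′))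

    reindex : (φ : Fin N → Fin I → ℕ) →
      ∑[ r < N ] maybe′ (φ r) 0 (find (at r)) ≡ ∑[ u < I ] (φ (ρ u) u * ⟦ F u ⟧)
    reindex φ = begin
      ∑[ r < N ] maybe′ (φ r) 0 (find (at r))           ≡⟨ sum-cong-≗ (λ r → find-∑ (at r) (φ r) (one r)) ⟩
      ∑[ r < N ] ∑[ u < I ] (φ r u * ⟦ at r u ⟧)        ≡⟨ ∑-comm (λ r u → φ r u * ⟦ at r u ⟧) ⟩
      ∑[ u < I ] ∑[ r < N ] (φ r u * ⟦ at r u ⟧)        ≡⟨ sum-cong-≗ (λ u → trans (sum-cong-≗ (λ r → split (φ r u) (F u) _)) (∑-δ (λ r → φ r u * ⟦ F u ⟧) (ρ u))) ⟩
      ∑[ u < I ] (φ (ρ u) u * ⟦ F u ⟧)                  ∎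
      where
      open ≡-Reasoning
      split : ∀ p a b → p * ⟦ a ∧ b ⟧ ≡ p * ⟦ a ⟧ * ⟦ b ⟧
      split p a b = trans (cong (p *_) (⟦∧⟧ a b)) (sym (*-assoc p ⟦ a ⟧ ⟦ b ⟧))

  size : ℕ
  size = ∑[ u < I ] ⟦ F u ⟧

  matches : Vec (Fin (suc k)) N → ℕ
  matches x = ∑[ u < I ] ⟦ F u ∧ ⌊ lookup x (ρ u) Fin.≟ t u ⌋ ⟧

  private
    tracked≡size : tracked J ≡ size
    tracked≡size = trans (sum-cong-≗ (λ r → go (find (at r)))) (trans (reindex (λ _ _ → 1)) (sum-cong-≗ (λ u → +-identityʳ ⟦ F u ⟧)))
      where
      go : ∀ j → is-just (Maybe.map t j) ≡ maybe′ (λ _ → 1) 0 j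
      go nothing = refl
      go (just _) = refl

    hits≡matches : ∀ x → hits J x ≡ matches x
    hits≡matches x = trans (sum-cong-≗ (λ r → go (lookup x r) (find (at r)))) (trans (reindex (λ r u → ⟦ ⌊ lookup x r Fin.≟ t u ⌋ ⟧))
      (sum-cong-≗ (λ u → trans (*-comm _ ⟦ F u ⟧) (sym (⟦∧⟧ (F u) _)))))
      where
      go : ∀ c j → hit (Maybe.map t j) c ≡ maybe′ (λ u → ⟦ ⌊ c Fin.≟ t u ⌋ ⟧) 0 j
      go c nothing = refl
      go c (just _) = refl

    total : ∀ x → tracked J ≡ matches x + misses J x
    total x = trans (sym (hits+misses J x)) (cong (_+ misses J x) (hits≡matches x))

    above : ∀ {a b} S x → b ≤ a → S ≤ matches x →
      a ^ S * b ^ tracked J ≤ a ^ hits J x * b ^ misses J x * b ^ S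
    above {a} {b} S x b≤a h = subst₂ _≤_ (cong (λ z → a ^ S * b ^ z) (sym (total x)))
      (cong (λ z → a ^ z * b ^ misses J x * b ^ S) (sym (hits≡matches x)))
      (^-swap-≤ (matches x ∸ S) b≤a (matches x) (misses J x) S (sym (m+[n∸m]≡n h)))

    below : ∀ {a b} S x → a ≤ b → matches x ≤ S →
      a ^ S * b ^ tracked J ≤ a ^ hits J x * b ^ misses J x * b ^ S
    below {a} {b} S x a≤b h = subst₂ _≤_ (cong (λ z → a ^ S * b ^ z) (sym (total x)))
      (cong (λ z → a ^ z * b ^ misses J x * b ^ S) (sym (hits≡matches x)))
      (^-swap-≤′ (S ∸ matches x) a≤b (matches x) (misses J x) S (sym (m+[n∸m]≡n h)))

  size≤N : size ≤ N
  size≤N = subst (_≤ N) tracked≡size (subst (tracked J ≤_) (free+tracked J) (m≤n+m _ _))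

  -- The Chernoff bound with weights a/b = 1 + 1/(σ+1); the excess s over the mean w costs a factor 2^s.
  upper-tail : ∀ σ w s .{{_ : NonZero σ}} → size ≤ suc k * (σ * w) →
    count (λ x → ⌊ suc σ * (w + s) ≤? matches x ⌋) * 2 ^ s ≤ suc k ^ N
  upper-tail σ w s h = markov (suc (suc σ)) (suc σ) (2 ^ s) S J (λ x → ⌊ suc σ * (w + s) ≤? matches x ⌋) (s≤s z≤n) (s≤s z≤n)
    (λ x e → above S x (n≤1+n _) (⌊⌋-true (S ≤? matches x) e))
    (subst (λ z → 2 ^ s * (suc σ ^ S * z ^ tracked J) ≤ suc (suc σ) ^ S * (suc k * suc σ) ^ tracked J)
      (e₁ σ (k * suc σ))
      (upper-tail-ratio σ (suc k) w s (tracked J) (subst (_≤ suc k * (σ * w)) (sym tracked≡size) h)))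
    where
    S = suc σ * (w + s)
    e₁ : ∀ σ x → suc σ + x + 1 ≡ suc (suc σ) + x
    e₁ = solve-∀

  -- Hits now weigh less than misses, in the ratio `σ / (σ + 1)`, so that few matches mean a large
  -- weight.
  lower-tail : ∀ σ w s .{{_ : NonZero σ}} → suc k * (suc σ * (w + s)) ≤ size →
    count (λ x → ⌊ matches x ≤? σ * w ⌋) * 2 ^ s ≤ suc k ^ N
  lower-tail σ w s h = markov σ (suc σ) (2 ^ s) (σ * w) J (λ x → ⌊ matches x ≤? σ * w ⌋) (>-nonZero⁻¹ σ) (s≤s z≤n)
    (λ x e → below (σ * w) x (n≤1+n _) (⌊⌋-true (matches x ≤? σ * w) e))
    (lower-tail-ratio σ (suc k) w s (tracked J) (σ + k * suc σ) refl (subst (suc k * (suc σ * (w + s)) ≤_) (sym tracked≡size) h))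

  -- For many colours the tilt `r + 1` may grow with their number: the total moment factor
  -- `(1 + r/(k + 1))^size` stays at most 2, while each of the `S` hits gains `r + 1`.
  sparse-tail : ∀ r p S → 2 * (size * r) ≤ suc k → 2 * p ≤ suc r ^ S →
    count (λ x → ⌊ S ≤? matches x ⌋) * p ≤ suc k ^ N
  sparse-tail r p S h hp = markov (suc r) 1 p S J (λ x → ⌊ S ≤? matches x ⌋) (s≤s z≤n) (s≤s z≤n)
    (λ x e → above S x (s≤s z≤n) (⌊⌋-true (S ≤? matches x) e))
    (begin
      p * (1 ^ S * (suc r + k * 1) ^ D)   ≡⟨ cong₂ (λ y z → p * (y * z ^ D)) (^-zeroˡ S) (e₁ r k) ⟩
      p * (1 * (suc k + r) ^ D)           ≤⟨ *-monoʳ-≤ p (subst (_≤ 2 * suc k ^ D) (sym (+-identityʳ _)) double) ⟩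
      p * (2 * suc k ^ D)                 ≡⟨ e₂ p (suc k ^ D) ⟩
      2 * p * suc k ^ D                   ≤⟨ *-monoˡ-≤ (suc k ^ D) hp ⟩
      suc r ^ S * suc k ^ D               ≡⟨ cong (λ z → suc r ^ S * z ^ D) (sym (*-identityʳ (suc k))) ⟩
      suc r ^ S * (suc k * 1) ^ D         ∎)
    where
    open ≤-Reasoning
    D = tracked J
    e₁ : ∀ r k → suc r + k * 1 ≡ suc k + r
    e₁ = solve-∀
    e₂ : ∀ p q → p * (2 * q) ≡ 2 * p * q
    e₂ = solve-∀
    h′ : 2 * (D * r) ≤ suc k
    h′ = subst (λ z → 2 * (z * r) ≤ suc k) (sym tracked≡size) h
    Dr≤ : D * r ≤ suc k
    Dr≤ = ≤-trans (m≤n*m (D * r) 2) h′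
    u = suc k ∸ D * r
    sum-u : D * r + u ≡ suc k
    sum-u = m+[n∸m]≡n Dr≤
    k≤2u : suc k ≤ 2 * u
    k≤2u = by-ineq 0 h′ (trans (cong (λ z → z + z + 0) (sym sum-u)) (e₄ (D * r) u))
      where
      e₄ : ∀ x u → (x + u) + (x + u) + 0 ≡ 2 * u + 2 * x
      e₄ = solve-∀
    double : (suc k + r) ^ D ≤ 2 * suc k ^ D
    double = *-cancelʳ-≤ _ _ (suc k) (begin
      (suc k + r) ^ D * suc k        ≤⟨ *-monoʳ-≤ ((suc k + r) ^ D) k≤2u ⟩
      (suc k + r) ^ D * (2 * u)      ≡⟨ e₅ ((suc k + r) ^ D) u ⟩
      2 * ((suc k + r) ^ D * u)      ≤⟨ *-monoʳ-≤ 2 (bernoulli-above (suc k) r D u (≤-reflexive sum-u)) ⟩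
      2 * (suc k * suc k ^ D)        ≡⟨ e₆ (suc k) (suc k ^ D) ⟩
      2 * suc k ^ D * suc k          ∎)
      where
      e₅ : ∀ x u → x * (2 * u) ≡ 2 * (x * u)
      e₅ = solve-∀
      e₆ : ∀ k x → 2 * (k * x) ≡ 2 * x * k
      e₆ = solve-∀

-- Degrees and double counting.

module Degrees {n m : ℕ} (G : Graph n m) where

  fst snd : Fin m → Fin n
  fst j = proj₁ (edge G j)
  snd j = proj₂ (edge G j)

  touches : Fin n → Fin m → Bool
  touches v j = incident v (edge G j)

  touches-split : ∀ v j → ⟦ touches v j ⟧ ≡ ⟦ ⌊ v Fin.≟ fst j ⌋ ⟧ + ⟦ ⌊ v Fin.≟ snd j ⌋ ⟧
  touches-split v j with v Fin.≟ fst j | v Fin.≟ snd j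
  ... | yes refl | yes e = contradiction e (noLoop G j)
  ... | yes _ | no _ = refl
  ... | no _ | yes _ = refl
  ... | no _ | no _ = refl

  -- Edge sets are Boolean functions from here on, so that differences, crossings and unions are
  -- pointwise formulas; `deg≡dg` links back to subsets.
  dg : (Fin m → Bool) → Fin n → ℕ
  dg F v = ∑[ j < m ] ⟦ F j ∧ touches v j ⟧

  deg≡dg : ∀ H v → deg G H v ≡ dg (lookup H) v
  deg≡dg H v = trans (cong ListAction.sum (map-tabulate id (λ j → ⟦ lookup H j ∧ touches v j ⟧))) (go (λ j → ⟦ lookup H j ∧ touches v j ⟧))
    where
    go : ∀ {I} (f : Fin I → ℕ) → ListAction.sum (List.tabulate f) ≡ sum f
    go {zero} f = refl
    go {suc I} f = cong (f zero +_) (go (f ∘ suc))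

  ends : (Fin n → ℕ) → Fin m → ℕ
  ends φ j = φ (fst j) + φ (snd j)

  ∑-touches : ∀ (φ : Fin n → ℕ) j → ∑[ v < n ] (φ v * ⟦ touches v j ⟧) ≡ ends φ j
  ∑-touches φ j = begin
    ∑[ v < n ] (φ v * ⟦ touches v j ⟧)
      ≡⟨ sum-cong-≗ (λ v → trans (cong (φ v *_) (touches-split v j)) (*-distribˡ-+ (φ v) _ _)) ⟩
    ∑[ v < n ] (φ v * ⟦ ⌊ v Fin.≟ fst j ⌋ ⟧ + φ v * ⟦ ⌊ v Fin.≟ snd j ⌋ ⟧)
      ≡⟨ ∑-distrib-+ (λ v → φ v * ⟦ ⌊ v Fin.≟ fst j ⌋ ⟧) (λ v → φ v * ⟦ ⌊ v Fin.≟ snd j ⌋ ⟧) ⟩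
    ∑[ v < n ] (φ v * ⟦ ⌊ v Fin.≟ fst j ⌋ ⟧) + ∑[ v < n ] (φ v * ⟦ ⌊ v Fin.≟ snd j ⌋ ⟧)
      ≡⟨ cong₂ _+_ (∑-δ φ (fst j)) (∑-δ φ (snd j)) ⟩
    ends φ j ∎
    where open ≡-Reasoning

  -- Double counting of incidences with vertex weights. For `φ` constant 1 it counts edges, for an
  -- indicator it counts edge ends in a set, and for a degree function it turns bounds on edge
  -- degrees into bounds on sums of products of degrees.
  handshake : ∀ (φ : Fin n → ℕ) F → ∑[ v < n ] (φ v * dg F v) ≡ ∑[ j < m ] (⟦ F j ⟧ * ends φ j)
  handshake φ F = begin
    ∑[ v < n ] (φ v * dg F v)                                      ≡⟨ sum-cong-≗ (λ v → *-distribˡ-sum (φ v) (λ j → ⟦ F j ∧ touches v j ⟧)) ⟩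
    ∑[ v < n ] ∑[ j < m ] (φ v * ⟦ F j ∧ touches v j ⟧)            ≡⟨ ∑-comm (λ v j → φ v * ⟦ F j ∧ touches v j ⟧) ⟩
    ∑[ j < m ] ∑[ v < n ] (φ v * ⟦ F j ∧ touches v j ⟧)            ≡⟨ sum-cong-≗ (λ j → trans (sum-cong-≗ (λ v → e (φ v) (F j) (touches v j))) (sym (*-distribˡ-sum ⟦ F j ⟧ (λ v → φ v * ⟦ touches v j ⟧)))) ⟩
    ∑[ j < m ] (⟦ F j ⟧ * ∑[ v < n ] (φ v * ⟦ touches v j ⟧))      ≡⟨ sum-cong-≗ (λ j → cong (⟦ F j ⟧ *_) (∑-touches φ j)) ⟩
    ∑[ j < m ] (⟦ F j ⟧ * ends φ j)                                ∎
    where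
    open ≡-Reasoning
    e : ∀ p a b → p * ⟦ a ∧ b ⟧ ≡ ⟦ a ⟧ * (p * ⟦ b ⟧)
    e p a b = trans (cong (p *_) (⟦∧⟧ a b)) (trans (sym (*-assoc p ⟦ a ⟧ ⟦ b ⟧)) (trans (cong (_* ⟦ b ⟧) (*-comm p ⟦ a ⟧)) (*-assoc ⟦ a ⟧ p ⟦ b ⟧)))

  dg-mono : ∀ {F F′} → (∀ j → F j ≡ true → F′ j ≡ true) → ∀ v → dg F v ≤ dg F′ v
  dg-mono {F} {F′} h v = ∑-mono (λ j → go (F j) (F′ j) (touches v j) (h j))
    where
    go : ∀ a a′ b → (a ≡ true → a′ ≡ true) → ⟦ a ∧ b ⟧ ≤ ⟦ a′ ∧ b ⟧
    go false a′ b h = z≤n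
    go true a′ b h rewrite h refl = ≤-refl

  dg-cong : ∀ {F F′} → (∀ j → F j ≡ F′ j) → ∀ v → dg F v ≡ dg F′ v
  dg-cong h v = sum-cong-≗ (λ j → cong (λ a → ⟦ a ∧ touches v j ⟧) (h j))

  ends-cong : ∀ {φ ψ : Fin n → ℕ} → (∀ v → φ v ≡ ψ v) → ∀ j → ends φ j ≡ ends ψ j
  ends-cong h j = cong₂ _+_ (h (fst j)) (h (snd j))

  Touching : Fin n → Fin m → Set
  Touching v j = (v ≡ fst j) ⊎ (v ≡ snd j)

  touching : ∀ v j → touches v j ≡ true → Touching v j
  touching v j e with v Fin.≟ fst j | v Fin.≟ snd j
  ... | yes p | _ = inj₁ p
  ... | no _ | yes p = inj₂ p

  touching⁻ : ∀ v j → Touching v j → touches v j ≡ true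
  touching⁻ v j h with v Fin.≟ fst j | v Fin.≟ snd j
  ... | yes p | _ = refl
  ... | no _ | yes p = refl
  ... | no ¬p | no ¬q = ⊥-elim ([ ¬p , ¬q ]′ h)

  Matching : (Fin m → Bool) → Set
  Matching F = ∀ {v} j j′ → F j ≡ true → F j′ ≡ true → Touching v j → Touching v j′ → j ≡ j′

  touching≤ends : ∀ {v j} (φ : Fin n → ℕ) → Touching v j → φ v ≤ ends φ j
  touching≤ends φ (inj₁ refl) = m≤m+n _ _
  touching≤ends φ (inj₂ refl) = m≤n+m _ _

  -- An end of some edge of F has degree at most any bound on the edge degrees of F.
  dg-bounded : ∀ F b → (∀ j → F j ≡ true → ends (dg F) j ≤ b) → ∀ v → dg F v ≤ b
  dg-bounded F b h v with FinP.any? (λ j → (F j ∧ touches v j) Bool.≟ true)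
  ... | yes (j , e) = ≤-trans (touching≤ends (dg F) (touching v j (proj₂ (∧-true {F j} e)))) (h j (proj₁ (∧-true {F j} e)))
  ... | no ¬∃ = subst (_≤ b) (sym (∑-zero (λ j → go j))) z≤n
    where
    go : ∀ j → ⟦ F j ∧ touches v j ⟧ ≡ 0
    go j with F j ∧ touches v j in e
    ... | true = contradiction (j , e) ¬∃
    ... | false = refl

  other : Fin n → Fin m → Fin n
  other v j = if ⌊ v Fin.≟ fst j ⌋ then snd j else fst j

  other-spec : ∀ v j → Touching v j → (v ≡ fst j × other v j ≡ snd j) ⊎ (v ≡ snd j × other v j ≡ fst j)
  other-spec v j h with v Fin.≟ fst j
  ... | yes p = inj₁ (p , refl)
  ... | no ¬p = inj₂ ([ (λ p → contradiction p ¬p) , id ]′ h , refl)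

  other-injective : ∀ v j j′ → Touching v j → Touching v j′ → other v j ≡ other v j′ → j ≡ j′
  other-injective v j j′ h h′ e with other-spec v j h | other-spec v j′ h′
  ... | inj₁ (p , q) | inj₁ (p′ , q′) = simple G j j′ (inj₁ (trans (sym p) p′ , trans (sym q) (trans e q′)))
  ... | inj₁ (p , q) | inj₂ (p′ , q′) = simple G j j′ (inj₂ (trans (sym p) p′ , trans (sym q) (trans e q′)))
  ... | inj₂ (p , q) | inj₁ (p′ , q′) = simple G j j′ (inj₂ (trans (sym q) (trans e q′) , trans (sym p) p′))
  ... | inj₂ (p , q) | inj₂ (p′ , q′) = simple G j j′ (inj₁ (trans (sym q) (trans e q′) , trans (sym p) p′))

  other-≢ : ∀ v j → Touching v j → other v j ≢ v
  other-≢ v j h e with other-spec v j h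
  ... | inj₁ (p , q) = noLoop G j (trans (sym p) (trans (sym e) q))
  ... | inj₂ (p , q) = noLoop G j (trans (sym q) (trans e p))

  -- `other v` injects the edges at `v` into the vertices because `G` is simple; the single colour
  -- and the constant target are dummies for the counting lemma.
  dg≤n : ∀ F v → dg F v ≤ n
  dg≤n F v = size≤N {k = 0} (λ j → F j ∧ touches v j) (other v) (λ _ → zero)
    (λ j j′ p p′ → other-injective v j j′ (touching v j (proj₂ (∧-true {F j} p))) (touching v j′ (proj₂ (∧-true {F j′} p′))))

-- Existence of the reference subgraph.

-- Local minima of Σ deg² + (2B - 1)·|complement| are EDCSs with parameters (B, B - 1), for B = suc b.
module Existence {n m : ℕ} (G : Graph n m) (b : ℕ) where
  open Degrees G

  private
    set : (Fin m → Bool) → Fin m → Bool → Fin m → Bool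
    set H j c i = if ⌊ i Fin.≟ j ⌋ then c else H i

    set-same : ∀ H j c → H j ≡ c → ∀ i → H i ≡ set H j c i
    set-same H j c e i with i Fin.≟ j
    ... | yes refl = e
    ... | no _ = refl

    outsiders : (Fin m → Bool) → ℕ
    outsiders H = ∑[ j < m ] ⟦ not (H j) ⟧

    Ψ : (Fin m → Bool) → ℕ
    Ψ H = ∑[ v < n ] (dg H v * dg H v) + (2 * b + 1) * outsiders H

    Ψ-cong : ∀ {H H′} → (∀ j → H j ≡ H′ j) → Ψ H ≡ Ψ H′
    Ψ-cong h = cong₂ (λ x y → x + (2 * b + 1) * y)
      (sum-cong-≗ (λ v → cong₂ _*_ (dg-cong h v) (dg-cong h v)))
      (sum-cong-≗ (λ j → cong (λ c → ⟦ not c ⟧) (h j)))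

    module _ (H : Fin m → Bool) (j : Fin m) where
      H₀ H₁ : Fin m → Bool
      H₀ = set H j false
      H₁ = set H j true

      dg-set : ∀ v → dg H₁ v ≡ dg H₀ v + ⟦ touches v j ⟧
      dg-set v = trans (sum-cong-≗ go)
        (trans (∑-distrib-+ (λ i → ⟦ H₀ i ∧ touches v i ⟧) (λ i → ⟦ touches v i ⟧ * ⟦ ⌊ i Fin.≟ j ⌋ ⟧))
          (cong (dg H₀ v +_) (∑-δ (λ i → ⟦ touches v i ⟧) j)))
        where
        go : ∀ i → ⟦ H₁ i ∧ touches v i ⟧ ≡ ⟦ H₀ i ∧ touches v i ⟧ + ⟦ touches v i ⟧ * ⟦ ⌊ i Fin.≟ j ⌋ ⟧
        go i with i Fin.≟ j
        ... | yes _ = sym (*-identityʳ _)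
        ... | no _ = sym (trans (cong (⟦ H i ∧ touches v i ⟧ +_) (*-zeroʳ ⟦ touches v i ⟧)) (+-identityʳ _))

      outsiders-set : outsiders H₀ ≡ outsiders H₁ + 1
      outsiders-set = trans (sum-cong-≗ go)
        (trans (∑-distrib-+ (λ i → ⟦ not (H₁ i) ⟧) (λ i → 1 * ⟦ ⌊ i Fin.≟ j ⌋ ⟧)) (cong (outsiders H₁ +_) (∑-δ (λ _ → 1) j)))
        where
        go : ∀ i → ⟦ not (H₀ i) ⟧ ≡ ⟦ not (H₁ i) ⟧ + 1 * ⟦ ⌊ i Fin.≟ j ⌋ ⟧
        go i with i Fin.≟ j
        ... | yes _ = refl
        ... | no _ = sym (+-identityʳ _)

      ends-set : ends (dg H₁) j ≡ ends (dg H₀) j + 2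
      ends-set = trans (cong₂ _+_ (at (fst j) (inj₁ refl)) (at (snd j) (inj₂ refl))) (e (dg H₀ (fst j)) (dg H₀ (snd j)))
        where
        at : ∀ v → Touching v j → dg H₁ v ≡ dg H₀ v + 1
        at v t = trans (dg-set v) (cong (λ c → dg H₀ v + ⟦ c ⟧) (touching⁻ v j t))
        e : ∀ x y → (x + 1) + (y + 1) ≡ x + y + 2
        e = solve-∀

      squares-set : ∑[ v < n ] (dg H₁ v * dg H₁ v) ≡ ∑[ v < n ] (dg H₀ v * dg H₀ v) + (2 * ends (dg H₀) j + 2)
      squares-set = trans (sum-cong-≗ (λ v → trans (cong (λ d → d * d) (dg-set v)) (square (dg H₀ v) (touches v j))))
        (trans (∑-distrib-+ (λ v → dg H₀ v * dg H₀ v) (λ v → (2 * dg H₀ v + 1) * ⟦ touches v j ⟧))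
          (cong (∑[ v < n ] (dg H₀ v * dg H₀ v) +_) (trans (∑-touches (λ v → 2 * dg H₀ v + 1) j) (e (dg H₀ (fst j)) (dg H₀ (snd j))))))
        where
        square : ∀ d t → (d + ⟦ t ⟧) * (d + ⟦ t ⟧) ≡ d * d + (2 * d + 1) * ⟦ t ⟧
        square d true = s d
          where
          s : ∀ d → (d + 1) * (d + 1) ≡ d * d + (2 * d + 1) * 1
          s = solve-∀
        square d false = s d
          where
          s : ∀ d → (d + 0) * (d + 0) ≡ d * d + (2 * d + 1) * 0
          s = solve-∀
        e : ∀ x y → (2 * x + 1) + (2 * y + 1) ≡ 2 * (x + y) + 2
        e = solve-∀

      -- Let `x` be the edge degree of `j` before insertion. Inserting `j` adds `2x + 2` to the
      -- squares and saves `2b + 1`. One is even and the other odd, so there is never a tie: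
      -- insertion pays strictly for `x < b` and removal for `x ≥ b`.
      Ψ-set : Ψ H₁ + (2 * b + 1) ≡ Ψ H₀ + (2 * ends (dg H₀) j + 2)
      Ψ-set = trans (cong (λ z → z + (2 * b + 1) * outsiders H₁ + (2 * b + 1)) squares-set)
        (trans (e (∑[ v < n ] (dg H₀ v * dg H₀ v)) (2 * ends (dg H₀) j + 2) b (outsiders H₁))
          (cong (λ z → ∑[ v < n ] (dg H₀ v * dg H₀ v) + (2 * b + 1) * z + (2 * ends (dg H₀) j + 2)) (sym outsiders-set)))
        where
        e : ∀ s x b o → s + x + (2 * b + 1) * o + (2 * b + 1) ≡ s + (2 * b + 1) * (o + 1) + x
        e = solve-∀

      removal-improves : H j ≡ true → suc b < ends (dg H) j → Ψ H₀ < Ψ H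
      removal-improves e lt = subst (Ψ H₀ <_) (Ψ-cong (λ i → sym (set-same H j true e i))) (lin (Ψ H₀) (Ψ H₁) (ends (dg H₀) j) lt′ Ψ-set)
        where
        lt′ : suc b < ends (dg H₀) j + 2
        lt′ = subst (suc b <_) (trans (ends-cong (dg-cong (set-same H j true e)) j) ends-set) lt
        lin : ∀ p q x → suc b < x + 2 → q + (2 * b + 1) ≡ p + (2 * x + 2) → p < q
        lin p q x h eq = by-ineq 0 (*-monoʳ-≤ 2 h)
          (trans (s₁ p x) (trans (cong (_+ 3) (sym eq)) (s₂ q b)))
          where
          s₁ : ∀ p x → suc p + 2 * (x + 2) + 0 ≡ p + (2 * x + 2) + 3
          s₁ = solve-∀
          s₂ : ∀ q b → q + (2 * b + 1) + 3 ≡ q + 2 * suc (suc b)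
          s₂ = solve-∀

      insertion-improves : H j ≡ false → suc (ends (dg H) j) < suc b → Ψ H₁ < Ψ H
      insertion-improves e lt = subst (Ψ H₁ <_) (Ψ-cong (λ i → sym (set-same H j false e i))) (lin (Ψ H₁) (Ψ H₀) (ends (dg H₀) j) lt′ Ψ-set)
        where
        lt′ : suc (suc (ends (dg H₀) j)) ≤ suc b
        lt′ = subst (λ z → suc z < suc b) (ends-cong (dg-cong (set-same H j false e)) j) lt
        lin : ∀ p q x → suc (suc x) ≤ suc b → p + (2 * b + 1) ≡ q + (2 * x + 2) → p < q
        lin p q x h eq = by-ineq 0 (*-monoʳ-≤ 2 h)
          (trans (s₁ p b) (trans (cong (_+ 2) eq) (s₂ q x)))
          where
          s₁ : ∀ p b → suc p + 2 * suc b + 0 ≡ p + (2 * b + 1) + 2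
          s₁ = solve-∀
          s₂ : ∀ q x → q + (2 * x + 2) + 2 ≡ q + 2 * suc (suc x)
          s₂ = solve-∀

  IsReference : (Fin m → Bool) → Set
  IsReference H = (∀ j → H j ≡ true → ends (dg H) j ≤ suc b) × (∀ j → H j ≡ false → suc b ≤ suc (ends (dg H) j))

  private
    descend : ∀ fuel H → Ψ H < fuel → ∃ IsReference
    descend (suc fuel) H (s≤s lt) with FinP.any? (λ j → (H j Bool.≟ true) ×-dec (suc b <? ends (dg H) j))
    ... | yes (j , e , viol) = descend fuel (H₀ H j) (<-≤-trans (removal-improves H j e viol) lt)
    ... | no ¬over with FinP.any? (λ j → (H j Bool.≟ false) ×-dec (suc (ends (dg H) j) <? suc b))
    ...   | yes (j , e , viol) = descend fuel (H₁ H j) (<-≤-trans (insertion-improves H j e viol) lt)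
    ...   | no ¬under = H , (λ j e → ≮⇒≥ (λ viol → ¬over (j , e , viol))) , (λ j e → ≮⇒≥ (λ viol → ¬under (j , e , viol)))

  reference : ∃ IsReference
  reference = descend _ (λ _ → false) ≤-refl

-- Comparison of degrees by expansion.

-- Two edge sets P and N whose degrees satisfy the exchange inequalities cannot differ much at a vertex:
-- the vertices where P exceeds N by many levels expand towards lower levels.
module Exchange {n m : ℕ} (G : Graph n m) (P N : Fin m → Bool) (g b E R L : ℕ)
  (exchange-P : ∀ j → P j ≡ true → Degrees.ends G (Degrees.dg G P) j ≤ Degrees.ends G (Degrees.dg G N) j + g)
  (exchange-N : ∀ j → N j ≡ true → Degrees.ends G (Degrees.dg G N) j ≤ Degrees.ends G (Degrees.dg G P) j + g)
  (dg-N≤b : ∀ v → Degrees.dg G N v ≤ b) (0<b : 0 < b) (b≤RE : b ≤ R * E) (n<2^L : n < 2 ^ L) where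

  open Degrees G

  private
    dP dN : Fin n → ℕ
    dP = dg P
    dN = dg N

    excess deficit : ℕ → Fin n → Bool
    excess ℓ v = ⌊ dN v + (E + 2 * g * ℓ) ≤? dP v ⌋
    deficit ℓ v = ⌊ dP v + (E + 2 * g * ℓ + g) ≤? dN v ⌋

    ⟦⌊⌋⟧-mono : ∀ {A B : Set} (d : Dec A) (d′ : Dec B) → (A → B) → ⟦ ⌊ d ⌋ ⟧ ≤ ⟦ ⌊ d′ ⌋ ⟧
    ⟦⌊⌋⟧-mono (no _) d′ h = z≤n
    ⟦⌊⌋⟧-mono (yes a) (yes _) h = ≤-refl
    ⟦⌊⌋⟧-mono (yes a) (no ¬b) h = contradiction (h a) ¬b

    -- Along an edge of `P`, an excess at one end forces a deficit at the other, at the price of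
    -- `g`; the way back along an edge of `N` costs another `g`. This is why successive levels
    -- differ by `2 * g`.
    P-to-deficit : ∀ ℓ s t → dP s + dP t ≤ dN s + dN t + g → ⟦ excess (suc ℓ) s ⟧ ≤ ⟦ deficit ℓ t ⟧
    P-to-deficit ℓ s t h = ⟦⌊⌋⟧-mono (dN s + (E + 2 * g * suc ℓ) ≤? dP s) (dP t + (E + 2 * g * ℓ + g) ≤? dN t)
      (λ h′ → lin (dN s) (dN t) (dP s) (dP t) h h′)
      where
      lin : ∀ a c p q → p + q ≤ a + c + g → a + (E + 2 * g * suc ℓ) ≤ p → q + (E + 2 * g * ℓ + g) ≤ c
      lin a c p q h h′ = by-ineq 0 (+-mono-≤ h h′) (e a c p q E g ℓ)
        where
        e : ∀ a c p q E g ℓ → q + (E + 2 * g * ℓ + g) + (a + c + g + p) + 0 ≡ c + (p + q + (a + (E + 2 * g * suc ℓ)))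
        e = solve-∀

    N-to-excess : ∀ ℓ s t → dN s + dN t ≤ dP s + dP t + g → ⟦ deficit ℓ s ⟧ ≤ ⟦ excess ℓ t ⟧
    N-to-excess ℓ s t h = ⟦⌊⌋⟧-mono (dP s + (E + 2 * g * ℓ + g) ≤? dN s) (dN t + (E + 2 * g * ℓ) ≤? dP t)
      (λ h′ → lin (dN s) (dN t) (dP s) (dP t) h h′)
      where
      lin : ∀ a c p q → a + c ≤ p + q + g → p + (E + 2 * g * ℓ + g) ≤ a → c + (E + 2 * g * ℓ) ≤ q
      lin a c p q h h′ = by-ineq 0 (+-mono-≤ h h′) (e a c p q E g ℓ)
        where
        e : ∀ a c p q E g ℓ → c + (E + 2 * g * ℓ) + (p + q + g + a) + 0 ≡ q + (a + c + (p + (E + 2 * g * ℓ + g)))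
        e = solve-∀

    mass count-excess : ℕ → ℕ
    mass ℓ = ∑[ v < n ] (⟦ excess ℓ v ⟧ * dN v)
    count-excess ℓ = ∑[ v < n ] ⟦ excess ℓ v ⟧

    transfer : ∀ (φ ψ : Fin n → ℕ) F → (∀ j → F j ≡ true → ends φ j ≤ ends ψ j) →
      ∑[ v < n ] (φ v * dg F v) ≤ ∑[ v < n ] (ψ v * dg F v)
    transfer φ ψ F h = subst₂ _≤_ (sym (handshake φ F)) (sym (handshake ψ F)) (∑-mono go)
      where
      go : ∀ j → ⟦ F j ⟧ * ends φ j ≤ ⟦ F j ⟧ * ends ψ j
      go j with F j in e
      ... | true = *-monoʳ-≤ 1 (h j e)
      ... | false = z≤n

    -- At an excess vertex the `P`-degree beats the `N`-degree by at least `E`. The `P`-edges there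
    -- end in deficit vertices, whose `N`-degrees exceed their `P`-degrees, and the `N`-edges of
    -- these lead to excess vertices one level down.
    expansion : ∀ ℓ → mass (suc ℓ) + E * count-excess (suc ℓ) ≤ mass ℓ
    expansion ℓ = begin
      mass (suc ℓ) + E * count-excess (suc ℓ)
        ≡⟨ cong (mass (suc ℓ) +_) (*-distribˡ-sum E (λ v → ⟦ excess (suc ℓ) v ⟧)) ⟩
      mass (suc ℓ) + ∑[ v < n ] (E * ⟦ excess (suc ℓ) v ⟧)
        ≡⟨ sym (∑-distrib-+ (λ v → ⟦ excess (suc ℓ) v ⟧ * dN v) (λ v → E * ⟦ excess (suc ℓ) v ⟧)) ⟩
      ∑[ v < n ] (⟦ excess (suc ℓ) v ⟧ * dN v + E * ⟦ excess (suc ℓ) v ⟧)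
        ≤⟨ ∑-mono gain ⟩
      ∑[ v < n ] (⟦ excess (suc ℓ) v ⟧ * dP v)
        ≤⟨ transfer (λ v → ⟦ excess (suc ℓ) v ⟧) (λ v → ⟦ deficit ℓ v ⟧) P (λ j e → swap
             (P-to-deficit ℓ (fst j) (snd j) (exchange-P j e))
             (P-to-deficit ℓ (snd j) (fst j) (subst₂ (λ x y → x ≤ y + g) (+-comm (dP (fst j)) _) (+-comm (dN (fst j)) _) (exchange-P j e)))) ⟩
      ∑[ v < n ] (⟦ deficit ℓ v ⟧ * dP v)
        ≤⟨ ∑-mono drop ⟩
      ∑[ v < n ] (⟦ deficit ℓ v ⟧ * dN v)
        ≤⟨ transfer (λ v → ⟦ deficit ℓ v ⟧) (λ v → ⟦ excess ℓ v ⟧) N (λ j e → swap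
             (N-to-excess ℓ (fst j) (snd j) (exchange-N j e))
             (N-to-excess ℓ (snd j) (fst j) (subst₂ (λ x y → x ≤ y + g) (+-comm (dN (fst j)) _) (+-comm (dP (fst j)) _) (exchange-N j e)))) ⟩
      mass ℓ ∎
      where
      open ≤-Reasoning
      swap : ∀ {a b c d} → a ≤ d → b ≤ c → a + b ≤ c + d
      swap {c = c} {d} p q = ≤-trans (+-mono-≤ p q) (≤-reflexive (+-comm d c))
      gain : ∀ v → ⟦ excess (suc ℓ) v ⟧ * dN v + E * ⟦ excess (suc ℓ) v ⟧ ≤ ⟦ excess (suc ℓ) v ⟧ * dP v
      gain v with dN v + (E + 2 * g * suc ℓ) ≤? dP v
      ... | no _ = ≤-reflexive (*-zeroʳ E)
      ... | yes h = subst₂ _≤_ (e (dN v) E) (sym (+-identityʳ (dP v)))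
              (≤-trans (+-monoʳ-≤ (dN v) (m≤m+n E _)) h)
        where
        e : ∀ x E → x + E ≡ x + 0 + E * 1
        e = solve-∀
      drop : ∀ v → ⟦ deficit ℓ v ⟧ * dP v ≤ ⟦ deficit ℓ v ⟧ * dN v
      drop v with dP v + (E + 2 * g * ℓ + g) ≤? dN v
      ... | no _ = z≤n
      ... | yes h = *-monoʳ-≤ 1 (≤-trans (m≤m+n _ _) h)

    count-step : ∀ ℓ → count-excess (suc ℓ) ≤ count-excess ℓ
    count-step ℓ = ∑-mono (λ v → ⟦⌊⌋⟧-mono (dN v + (E + 2 * g * suc ℓ) ≤? dP v) (dN v + (E + 2 * g * ℓ) ≤? dP v)
      (≤-trans (+-monoʳ-≤ (dN v) (+-monoʳ-≤ E (*-monoʳ-≤ (2 * g) (n≤1+n ℓ))))))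

    mass≤ : ∀ ℓ → mass ℓ ≤ b * count-excess ℓ
    mass≤ ℓ = subst (mass ℓ ≤_) (sym (*-distribˡ-sum b (λ v → ⟦ excess ℓ v ⟧)))
      (∑-mono (λ v → ≤-trans (*-monoʳ-≤ ⟦ excess ℓ v ⟧ (dg-N≤b v)) (≤-reflexive (*-comm ⟦ excess ℓ v ⟧ b))))

    expansions : ∀ i ℓ → mass (i + ℓ) + i * E * count-excess (i + ℓ) ≤ mass ℓ
    expansions zero ℓ = ≤-reflexive (+-identityʳ (mass ℓ))
    expansions (suc i) ℓ = begin
      mass (suc (i + ℓ)) + suc i * E * c′        ≡⟨ e (mass (suc (i + ℓ))) i E c′ ⟩
      mass (suc (i + ℓ)) + E * c′ + i * E * c′   ≤⟨ +-mono-≤ (expansion (i + ℓ)) (*-monoʳ-≤ (i * E) (count-step (i + ℓ))) ⟩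
      mass (i + ℓ) + i * E * count-excess (i + ℓ) ≤⟨ expansions i ℓ ⟩
      mass ℓ ∎
      where
      open ≤-Reasoning
      c′ = count-excess (suc (i + ℓ))
      e : ∀ p i E c → p + suc i * E * c ≡ p + E * c + i * E * c
      e = solve-∀

    block : ∀ ℓ → mass (R + ℓ) + b * count-excess (R + ℓ) ≤ mass ℓ
    block ℓ = ≤-trans (+-monoʳ-≤ (mass (R + ℓ)) (*-monoˡ-≤ (count-excess (R + ℓ)) b≤RE)) (expansions R ℓ)

    -- A single level gains only `E` per vertex. Over `R` levels the gain is `b` per vertex, which
    -- is at least the remaining mass because `N`-degrees are at most `b`.
    doubling : ∀ i ℓ → 2 ^ i * mass (i * R + ℓ) ≤ mass ℓ
    doubling zero ℓ = ≤-reflexive (+-identityʳ (mass ℓ))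
    doubling (suc i) ℓ = begin
      2 * 2 ^ i * mass (R + i * R + ℓ)    ≡⟨ e (2 ^ i) (mass (R + i * R + ℓ)) ⟩
      2 ^ i * (mass (R + i * R + ℓ) + mass (R + i * R + ℓ)) ≡⟨ cong (λ z → 2 ^ i * (mass z + mass z)) (+-assoc R (i * R) ℓ) ⟩
      2 ^ i * (mass (R + (i * R + ℓ)) + mass (R + (i * R + ℓ))) ≤⟨ *-monoʳ-≤ (2 ^ i) (≤-trans (+-monoʳ-≤ (mass (R + (i * R + ℓ))) (mass≤ (R + (i * R + ℓ)))) (block (i * R + ℓ))) ⟩
      2 ^ i * mass (i * R + ℓ)            ≤⟨ doubling i ℓ ⟩
      mass ℓ ∎
      where
      open ≤-Reasoning
      e : ∀ x y → 2 * x * y ≡ x * (y + y)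
      e = solve-∀

    -- The first `R` levels turn one surviving vertex into mass at least `b`; then `L` doublings
    -- push the mass beyond `b * n`. The `+ 0` is the bottom level, where `doubling` ends.
    top : ℕ
    top = R + (L * R + 0)

    no-excess : count-excess top ≡ 0
    no-excess with count-excess top in eq
    ... | zero = refl
    ... | suc c = contradiction contra (n≮n (b * n))
      where
      open ≤-Reasoning
      contra : b * n < b * n
      contra = begin-strict
        b * n                        <⟨ *-monoʳ-< b {{>-nonZero 0<b}} n<2^L ⟩
        b * 2 ^ L                    ≡⟨ *-comm b (2 ^ L) ⟩
        2 ^ L * b                    ≤⟨ *-monoʳ-≤ (2 ^ L) (≤-trans (subst (λ z → b ≤ b * z) (sym eq) (m≤m*n b (suc c))) (≤-trans (m≤n+m _ (mass top)) (block (L * R + 0)))) ⟩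
        2 ^ L * mass (L * R + 0)     ≤⟨ doubling L 0 ⟩
        mass 0                       ≤⟨ mass≤ 0 ⟩
        b * count-excess 0           ≤⟨ *-monoʳ-≤ b (≤-trans (∑-bounded (λ v → ⟦⟧≤1 (excess 0 v))) (≤-reflexive (*-identityʳ n))) ⟩
        b * n ∎

  degrees-close : ∀ v → dP v ≤ dN v + (E + 2 * g * (R * suc L))
  degrees-close v with dN v + (E + 2 * g * top) ≤? dP v in eq
  ... | yes h = contradiction (subst₂ _≤_ (cong (λ d → ⟦ ⌊ d ⌋ ⟧) eq) no-excess (term≤∑ (λ u → ⟦ excess top u ⟧) v)) λ ()
  ... | no h = subst (λ z → dP v ≤ dN v + (E + 2 * g * z)) (e R L) (<⇒≤ (≰⇒> h))
    where
    e : ∀ R L → R + (L * R + 0) ≡ R * suc L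
    e = solve-∀

-- Vertex covers and matchings in bipartite graphs.

anyB-true : ∀ {n} (f : Fin n → Bool) i → f i ≡ true → anyB f ≡ true
anyB-true f zero e rewrite e = refl
anyB-true f (suc i) e with f zero
... | true = refl
... | false = anyB-true (f ∘ suc) i e

∨-trueʳ : ∀ {a b} → b ≡ true → a ∨ b ≡ true
∨-trueʳ {true} _ = refl
∨-trueʳ {false} e = e

∨-trueˡ : ∀ {a b} → a ≡ true → a ∨ b ≡ true
∨-trueˡ refl = refl

∨-true : ∀ {a b} → a ∨ b ≡ true → a ≡ true ⊎ b ≡ true
∨-true {true} _ = inj₁ refl
∨-true {false} e = inj₂ e

card : ∀ {n} → (Fin n → Bool) → ℕ
card {n} S = ∑[ v < n ] ⟦ S v ⟧

-- König's theorem, by Lovász's argument: in an edge set for which removing any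
-- edge lowers the covering number, two adjacent edges would let one combine
-- their two small covers into a small cover of everything.
module König {n m : ℕ} (G : Graph n m) (side : Fin n → Bool) where
  open Degrees G

  Cover : (Fin m → Bool) → (Fin n → Bool) → Set
  Cover F S = ∀ j → F j ≡ true → S (fst j) ∨ S (snd j) ≡ true

  Bipartite : (Fin m → Bool) → Set
  Bipartite F = ∀ j → F j ≡ true → side (snd j) ≡ not (side (fst j))

  private
    remove : (Fin m → Bool) → Fin m → Fin m → Bool
    remove F j i = if ⌊ i Fin.≟ j ⌋ then false else F i

    remove-⊆ : ∀ F j i → remove F j i ≡ true → F i ≡ true
    remove-⊆ F j i e with i Fin.≟ j
    ... | no _ = e

    ∈-remove : ∀ F j i → F i ≡ true → i ≢ j → remove F j i ≡ true
    ∈-remove F j i e i≢j with i Fin.≟ j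
    ... | yes p = contradiction p i≢j
    ... | no _ = e

    card-remove : ∀ F j → F j ≡ true → card (remove F j) < card F
    card-remove F j e = ≤-reflexive (trans (cong suc (sym (+-identityʳ _))) (trans (sym (+-suc _ 0)) (sym split)))
      where
      split : card F ≡ card (remove F j) + 1
      split = trans (sum-cong-≗ go) (trans (∑-distrib-+ (λ i → ⟦ remove F j i ⟧) (λ i → 1 * ⟦ ⌊ i Fin.≟ j ⌋ ⟧)) (cong (card (remove F j) +_) (∑-δ (λ _ → 1) j)))
        where
        go : ∀ i → ⟦ F i ⟧ ≡ ⟦ remove F j i ⟧ + 1 * ⟦ ⌊ i Fin.≟ j ⌋ ⟧
        go i with i Fin.≟ j
        ... | yes refl rewrite e = refl
        ... | no _ = sym (+-identityʳ _)

    cover-touching : ∀ {F S v} j → Cover (remove F j) S → Touching v j → S v ≡ true → Cover F S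
    cover-touching {F} {S} {v} j c t Sv i Fi with i Fin.≟ j
    ... | no i≢j = c i (∈-remove F j i Fi i≢j)
    ... | yes refl = at t
      where
      at : Touching v i → S (fst i) ∨ S (snd i) ≡ true
      at (inj₁ refl) = ∨-trueˡ Sv
      at (inj₂ refl) = ∨-trueʳ {S (fst i)} Sv

    not-true : ∀ {a} → ¬ a ≡ true → a ≡ false
    not-true {true} h = contradiction refl h
    not-true {false} _ = refl

    module Combine (F : Fin m → Bool) (bip : Bipartite F) (s : ℕ) (large : ∀ S → Cover F S → s ≤ card S)
      (x : Fin n) (j j′ : Fin m) (j≢j′ : j ≢ j′) (Fj : F j ≡ true) (Fj′ : F j′ ≡ true)
      (x∈j : Touching x j) (x∈j′ : Touching x j′)
      (S S′ : Fin n → Bool) (cS : Cover (remove F j) S) (cS′ : Cover (remove F j′) S′)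
      (smallS : card S < s) (smallS′ : card S′ < s) where

      -- Otherwise `S` would cover `j` too, and be a cover of all of `F` with fewer than `s`
      -- vertices.
      missS : ∀ v → Touching v j → S v ≡ false
      missS v t = not-true (λ e → n≮n s (≤-<-trans (large S (cover-touching {F} {S} {v} j cS t e)) smallS))

      missS′ : ∀ v → Touching v j′ → S′ v ≡ false
      missS′ v t = not-true (λ e → n≮n s (≤-<-trans (large S′ (cover-touching {F} {S′} {v} j′ cS′ t e)) smallS′))

      core middle : Fin n → Bool
      core v = S v ∧ S′ v
      middle v = ⌊ v Fin.≟ x ⌋ ∨ (S v xor S′ v)

      -- The bipartition splits `middle`, the symmetric difference together with `x`. An edge inside
      -- `middle` has an end on either side, so each half together with the common `core` covers
      -- `F`.
      half : Bool → Fin n → Bool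
      half c v = core v ∨ (middle v ∧ (side v xor c))

      middle-x : ∀ {v} → v ≡ x → middle v ≡ true
      middle-x {v} p = ∨-trueˡ (true-⌊⌋ (v Fin.≟ x) p)

      middle-xor : ∀ {v} → S v xor S′ v ≡ true → middle v ≡ true
      middle-xor {v} e = ∨-trueʳ {⌊ v Fin.≟ x ⌋} e

      Located : Fin m → Set
      Located i = (core (fst i) ∨ core (snd i) ≡ true) ⊎ (middle (fst i) ≡ true × middle (snd i) ≡ true)

      locate-bits : ∀ a a′ b b′ → a ∨ b ≡ true → a′ ∨ b′ ≡ true →
        ((a ∧ a′) ∨ (b ∧ b′) ≡ true) ⊎ (a xor a′ ≡ true × b xor b′ ≡ true)
      locate-bits true true b b′ _ _ = inj₁ refl
      locate-bits true false true true _ _ = inj₁ refl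
      locate-bits true false false true _ _ = inj₂ (refl , refl)
      locate-bits false true true true _ _ = inj₁ refl
      locate-bits false true true false _ _ = inj₂ (refl , refl)
      locate-bits false false true true _ _ = inj₁ refl

      -- The edge j is covered by S′ but not by S, so apart from x its other end lies in S′ only.
      located-end : ∀ (A A′ : Fin n → Bool) i → (∀ v → A v xor A′ v ≡ true → middle v ≡ true) →
        (∀ v → Touching v i → A v ≡ false) → A′ (fst i) ∨ A′ (snd i) ≡ true → A′ x ≡ false → Touching x i → Located i
      located-end A A′ i mid miss c A′x (inj₁ refl) rewrite A′x =
        inj₂ (middle-x refl , mid (snd i) (trans (cong (_xor A′ (snd i)) (miss (snd i) (inj₂ refl))) c))
      located-end A A′ i mid miss c A′x (inj₂ refl) with ∨-true {A′ (fst i)} c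
      ... | inj₁ e = inj₂ (mid (fst i) (trans (cong (_xor A′ (fst i)) (miss (fst i) (inj₁ refl))) e) , middle-x refl)
      ... | inj₂ e = contradiction (trans (sym A′x) e) λ ()

      xor-sym : ∀ a b → a xor b ≡ true → b xor a ≡ true
      xor-sym true false _ = refl
      xor-sym false true _ = refl

      locate : ∀ i → F i ≡ true → Located i
      locate i Fi with i Fin.≟ j | i Fin.≟ j′
      ... | yes refl | _ = located-end S S′ i (λ v → middle-xor) missS (cS′ i (∈-remove F j′ i Fi j≢j′)) (missS′ x x∈j′) x∈j
      ... | no _ | yes refl = located-end S′ S i (λ v e → middle-xor (xor-sym (S′ v) (S v) e)) missS′ (cS i (∈-remove F j i Fi (j≢j′ ∘ sym))) (missS x x∈j) x∈j′
      ... | no i≢j | no i≢j′ with locate-bits (S (fst i)) (S′ (fst i)) (S (snd i)) (S′ (snd i)) (cS i (∈-remove F j i Fi i≢j)) (cS′ i (∈-remove F j′ i Fi i≢j′))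
      ...   | inj₁ e = inj₁ e
      ...   | inj₂ (e , e′) = inj₂ (middle-xor e , middle-xor e′)

      half-cover : ∀ c → Cover F (half c)
      half-cover c i Fi with locate i Fi
      ... | inj₁ e = [ (λ e → ∨-trueˡ (∨-trueˡ e)) , (λ e → ∨-trueʳ {half c (fst i)} (∨-trueˡ e)) ]′ (∨-true {core (fst i)} e)
      ... | inj₂ (e , e′) rewrite e | e′ | bip i Fi = bits (core (fst i)) (core (snd i)) (side (fst i)) c
        where
        bits : ∀ a b s c → (a ∨ (s xor c)) ∨ (b ∨ (not s xor c)) ≡ true
        bits true b s c = refl
        bits false true s c = ∨-trueʳ {s xor c} refl
        bits false false true true = refl
        bits false false true false = refl
        bits false false false true = refl
        bits false false false false = refl

      -- Over the two halves, `core` counts twice and `middle` once: at most `card S + card S′ + 1`,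
      -- the 1 being due to `x`. Each half has at least `s` vertices, whereas `card S + card S′` is
      -- at most `2s - 2`.
      impossible : ⊥
      impossible = n≮n (card S + card S′ + 1) (begin-strict
        card S + card S′ + 1                <⟨ by-ineq 0 (+-mono-≤ smallS smallS′) (e (card S) (card S′) s) ⟩
        s + s                               ≤⟨ +-mono-≤ (large (half true) (half-cover true)) (large (half false) (half-cover false)) ⟩
        card (half true) + card (half false) ≡⟨ sym (∑-distrib-+ (λ v → ⟦ half true v ⟧) (λ v → ⟦ half false v ⟧)) ⟩
        ∑[ v < n ] (⟦ half true v ⟧ + ⟦ half false v ⟧) ≤⟨ ∑-mono (λ v → bits (S v) (S′ v) (side v) ⌊ v Fin.≟ x ⌋) ⟩
        ∑[ v < n ] (⟦ S v ⟧ + ⟦ S′ v ⟧ + 1 * ⟦ ⌊ v Fin.≟ x ⌋ ⟧) ≡⟨ ∑-distrib-+ (λ v → ⟦ S v ⟧ + ⟦ S′ v ⟧) (λ v → 1 * ⟦ ⌊ v Fin.≟ x ⌋ ⟧) ⟩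
        ∑[ v < n ] (⟦ S v ⟧ + ⟦ S′ v ⟧) + ∑[ v < n ] (1 * ⟦ ⌊ v Fin.≟ x ⌋ ⟧) ≡⟨ cong₂ _+_ (∑-distrib-+ (λ v → ⟦ S v ⟧) (λ v → ⟦ S′ v ⟧)) (∑-δ (λ _ → 1) x) ⟩
        card S + card S′ + 1 ∎)
        where
        open ≤-Reasoning
        e : ∀ a b s → suc (a + b + 1) + (s + s) + 0 ≡ s + s + (suc a + suc b)
        e = solve-∀
        bits : ∀ a b s x → ⟦ (a ∧ b) ∨ ((x ∨ (a xor b)) ∧ (s xor true)) ⟧ + ⟦ (a ∧ b) ∨ ((x ∨ (a xor b)) ∧ (s xor false)) ⟧ ≤ ⟦ a ⟧ + ⟦ b ⟧ + 1 * ⟦ x ⟧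
        bits true true s x = s≤s (s≤s z≤n)
        bits true false true x rewrite ∨-trueʳ {x} {true} refl = s≤s z≤n
        bits true false false x rewrite ∨-trueʳ {x} {true} refl = s≤s z≤n
        bits false true true x rewrite ∨-trueʳ {x} {true} refl = s≤s z≤n
        bits false true false x rewrite ∨-trueʳ {x} {true} refl = s≤s z≤n
        bits false false true true = s≤s z≤n
        bits false false false true = s≤s z≤n
        bits false false s false = z≤n

    SmallCover : (Fin m → Bool) → ℕ → Set
    SmallCover F s = ∃[ S ] Cover F (lookup S) × card (lookup S) < s

    smallCover? : ∀ F s → Dec (SmallCover F s)
    smallCover? F s = anySubset? (λ S → FinP.all? (λ j → (F j Bool.≟ true) →-dec (lookup S (fst j) ∨ lookup S (snd j) Bool.≟ true)) ×-dec (card (lookup S) <? s))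

    no-small : ∀ F s → ¬ SmallCover F s → ∀ S → Cover F S → s ≤ card S
    no-small F s h S c = ≮⇒≥ (λ lt → h (tabulate S
      , (λ j e → trans (cong₂ _∨_ (lookup∘tabulate S (fst j)) (lookup∘tabulate S (snd j))) (c j e))
      , subst (_< s) (sym (sum-cong-≗ (λ v → cong ⟦_⟧ (lookup∘tabulate S v)))) lt))

    firsts : (Fin m → Bool) → Fin n → Bool
    firsts F v = anyB (λ j → F j ∧ ⌊ v Fin.≟ fst j ⌋)

    firsts-cover : ∀ F → Cover F (firsts F)
    firsts-cover F j e = ∨-trueˡ (anyB-true (λ i → F i ∧ ⌊ fst j Fin.≟ fst i ⌋) j (trans (cong (_∧ ⌊ fst j Fin.≟ fst j ⌋) e) (≟-refl (fst j))))

    card-firsts : ∀ F → card (firsts F) ≤ card F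
    card-firsts F = begin
      card (firsts F)                                               ≤⟨ ∑-mono (λ v → ⟦anyB⟧≤∑ (λ j → F j ∧ ⌊ v Fin.≟ fst j ⌋)) ⟩
      ∑[ v < n ] ∑[ j < m ] ⟦ F j ∧ ⌊ v Fin.≟ fst j ⌋ ⟧             ≡⟨ ∑-comm (λ v j → ⟦ F j ∧ ⌊ v Fin.≟ fst j ⌋ ⟧) ⟩
      ∑[ j < m ] ∑[ v < n ] ⟦ F j ∧ ⌊ v Fin.≟ fst j ⌋ ⟧             ≡⟨ sum-cong-≗ (λ j → trans (sum-cong-≗ (λ v → ⟦∧⟧ (F j) ⌊ v Fin.≟ fst j ⌋)) (∑-δ (λ _ → ⟦ F j ⟧) (fst j))) ⟩
      card F ∎
      where open ≤-Reasoning

    -- Edges are deleted as long as every cover keeps at least `s` vertices. Once this is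
    -- impossible, `Combine` makes the remaining edges a matching, and taking one end of each gives
    -- a cover, so at least `s` edges remain.
    dual : ∀ fuel F s → card F < fuel → Bipartite F → (∀ S → Cover F S → s ≤ card S) →
      ∃[ M ] (∀ j → M j ≡ true → F j ≡ true) × Matching M × s ≤ card M
    dual (suc fuel) F s (s≤s lt) bip large
      with FinP.any? (λ j → (F j Bool.≟ true) ×-dec ¬? (smallCover? (remove F j) s))
    ... | yes (j , Fj , h) with dual fuel (remove F j) s (<-≤-trans (card-remove F j Fj) lt) (λ i e → bip i (remove-⊆ F j i e)) (no-small (remove F j) s h)
    ...   | M , M⊆ , matching , s≤ = M , (λ i e → remove-⊆ F j i (M⊆ i e)) , matching , s≤
    dual (suc fuel) F s (s≤s lt) bip large | no h = F , (λ _ → id) , matching , ≤-trans (large (firsts F) (firsts-cover F)) (card-firsts F)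
      where
      small : ∀ j → F j ≡ true → SmallCover (remove F j) s
      small j e = decidable-stable (smallCover? (remove F j) s) (λ ¬c → h (j , e , ¬c))
      matching : Matching F
      matching {x} j j′ Fj Fj′ t t′ with j Fin.≟ j′
      ... | yes p = p
      ... | no j≢j′ with small j Fj | small j′ Fj′
      ...   | S , cS , lS | S′ , cS′ , lS′ =
        ⊥-elim (Combine.impossible F bip s large x j j′ j≢j′ Fj Fj′ t t′ (lookup S) (lookup S′) cS cS′ lS lS′)

    minimum-cover : ∀ fuel F S → card S < fuel → Cover F S → ∃[ S′ ] Cover F S′ × (∀ S″ → Cover F S″ → card S′ ≤ card S″)
    minimum-cover (suc fuel) F S (s≤s lt) c with smallCover? F (card S)
    ... | yes (S′ , c′ , lt′) = minimum-cover fuel F (lookup S′) (<-≤-trans lt′ lt) c′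
    ... | no h = S , c , no-small F (card S) h

  könig : ∀ F → Bipartite F → ∃[ M ] ∃[ S ]
    (∀ j → M j ≡ true → F j ≡ true) × Matching M × Cover F S × card S ≤ card M
  könig F bip with minimum-cover _ F (λ _ → true) ≤-refl (λ _ _ → refl)
  ... | S , c , least with dual _ F (card S) ≤-refl bip least
  ...   | M , M⊆ , matching , s≤ = M , S , M⊆ , matching , c , s≤

-- The 3/2 bound for a bipartite subgraph.

square-≥ : ∀ t c → 8 * c * t ≤ 16 * (t * t) + c * c
square-≥ t c = [ above , below ]′ (≤-total c (4 * t))
  where
  open ≤-Reasoning
  above : c ≤ 4 * t → 8 * c * t ≤ 16 * (t * t) + c * c
  above h = begin
    8 * c * t                          ≤⟨ m≤m+n _ (d * d) ⟩
    8 * c * t + d * d                  ≡⟨ e₁ c t d ⟩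
    2 * c * (4 * t) + d * d            ≡⟨ cong (λ z → 2 * c * z + d * d) eq ⟩
    2 * c * (c + d) + d * d            ≡⟨ e₂ c d ⟩
    (c + d) * (c + d) + c * c          ≡⟨ cong (λ z → z * z + c * c) (sym eq) ⟩
    4 * t * (4 * t) + c * c            ≡⟨ e₃ t c ⟩
    16 * (t * t) + c * c ∎
    where
    d = 4 * t ∸ c
    eq : 4 * t ≡ c + d
    eq = sym (m+[n∸m]≡n h)
    e₁ : ∀ c t d → 8 * c * t + d * d ≡ 2 * c * (4 * t) + d * d
    e₁ = solve-∀
    e₂ : ∀ c d → 2 * c * (c + d) + d * d ≡ (c + d) * (c + d) + c * c
    e₂ = solve-∀
    e₃ : ∀ t c → 4 * t * (4 * t) + c * c ≡ 16 * (t * t) + c * c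
    e₃ = solve-∀
  below : 4 * t ≤ c → 8 * c * t ≤ 16 * (t * t) + c * c
  below h = begin
    8 * c * t                          ≤⟨ m≤m+n _ (d * d) ⟩
    8 * c * t + d * d                  ≡⟨ cong (λ z → 8 * z * t + d * d) (sym eq) ⟩
    8 * (4 * t + d) * t + d * d        ≡⟨ e t d ⟩
    16 * (t * t) + (4 * t + d) * (4 * t + d) ≡⟨ cong (λ z → 16 * (t * t) + z * z) eq ⟩
    16 * (t * t) + c * c ∎
    where
    d = c ∸ 4 * t
    eq : 4 * t + d ≡ c
    eq = m+[n∸m]≡n h
    e : ∀ t d → 8 * (4 * t + d) * t + d * d ≡ 16 * (t * t) + (4 * t + d) * (4 * t + d)
    e = solve-∀

module BipartiteMatching {n m : ℕ} (G : Graph n m) (side : Fin n → Bool)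
  (C M : Fin m → Bool) (bip : König.Bipartite G side C) (matchingM : Degrees.Matching G M) (B₀ B₁ Q : ℕ)
  (light : ∀ j → C j ≡ true → 2 * Degrees.ends G (Degrees.dg G C) j ≤ B₁)
  (heavy : ∀ j → M j ≡ true → C j ≡ false → B₀ ≤ 2 * Degrees.ends G (Degrees.dg G C) j)
  (0<B₁ : 0 < B₁) (close : (Q + 1) * B₁ ≤ (Q + 2) * B₀) where

  open Degrees G
  open König G side

  private
    M′ : Fin m → Bool
    M′ = proj₁ (könig C bip)
    X : Fin n → Bool
    X = proj₁ (proj₂ (könig C bip))
    M′⊆C : ∀ j → M′ j ≡ true → C j ≡ true
    M′⊆C = proj₁ (proj₂ (proj₂ (könig C bip)))
    matchingM′ : Matching M′
    matchingM′ = proj₁ (proj₂ (proj₂ (proj₂ (könig C bip))))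
    cover : Cover C X
    cover = proj₁ (proj₂ (proj₂ (proj₂ (proj₂ (könig C bip)))))
    X≤M′ : card X ≤ card M′
    X≤M′ = proj₂ (proj₂ (proj₂ (proj₂ (proj₂ (könig C bip)))))

    dg-matching : ∀ F → Matching F → ∀ v → dg F v ≤ 1
    dg-matching F mt v = size≤N {N = 1} {k = 0} (λ j → F j ∧ touches v j) (λ _ → zero) (λ _ → zero)
      (λ j j′ p p′ _ → mt j j′ (proj₁ (∧-true {F j} p)) (proj₁ (∧-true {F j′} p′)) (touching v j (proj₂ (∧-true {F j} p))) (touching v j′ (proj₂ (∧-true {F j′} p′))))

    covered uncovered : Fin m → Bool
    covered j = X (fst j) ∨ X (snd j)
    uncovered j = M j ∧ not (covered j)

    u : ℕ
    u = card uncovered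

    -- A covered edge of `M` is charged to an end in `X`; since `M` is a matching, no vertex is
    -- charged twice.
    M-split : card M ≤ card X + u
    M-split = begin
      card M                                               ≤⟨ ∑-mono (λ j → go (M j) (X (fst j)) (X (snd j))) ⟩
      ∑[ j < m ] (⟦ M j ⟧ * ends (λ v → ⟦ X v ⟧) j + ⟦ uncovered j ⟧) ≡⟨ ∑-distrib-+ (λ j → ⟦ M j ⟧ * ends (λ v → ⟦ X v ⟧) j) (λ j → ⟦ uncovered j ⟧) ⟩
      ∑[ j < m ] (⟦ M j ⟧ * ends (λ v → ⟦ X v ⟧) j) + u    ≡⟨ cong (_+ u) (sym (handshake (λ v → ⟦ X v ⟧) M)) ⟩
      ∑[ v < n ] (⟦ X v ⟧ * dg M v) + u                    ≤⟨ +-monoˡ-≤ u (∑-mono (λ v → ≤-trans (*-monoʳ-≤ ⟦ X v ⟧ (dg-matching M matchingM v)) (≤-reflexive (*-identityʳ ⟦ X v ⟧)))) ⟩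
      card X + u ∎
      where
      open ≤-Reasoning
      go : ∀ a b c → ⟦ a ⟧ ≤ ⟦ a ⟧ * (⟦ b ⟧ + ⟦ c ⟧) + ⟦ a ∧ not (b ∨ c) ⟧
      go false b c = z≤n
      go true true c = s≤s z≤n
      go true false true = s≤s z≤n
      go true false false = s≤s z≤n

    uncovered⊆M : ∀ j → uncovered j ≡ true → M j ≡ true
    uncovered⊆M j e = proj₁ (∧-true {M j} e)

    dg-uncovered≤1 : ∀ v → dg uncovered v ≤ 1
    dg-uncovered≤1 v = ≤-trans (dg-mono uncovered⊆M v) (dg-matching M matchingM v)

    -- The ends of the uncovered edges. These edges form a matching, so the indicator of `S` is
    -- their degree function, and sums over `S` become sums over edges.
    S : Fin n → Bool
    S v = ⌊ 1 ≤? dg uncovered v ⌋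

    ⟦S⟧ : ∀ v → ⟦ S v ⟧ ≡ dg uncovered v
    ⟦S⟧ v with 1 ≤? dg uncovered v
    ... | yes p = ≤-antisym p (dg-uncovered≤1 v)
    ... | no ¬p = sym (n<1⇒n≡0 (≰⇒> ¬p))

    S-misses-X : ∀ v → X v ≡ true → S v ≡ false
    S-misses-X v Xv with S v | ⟦S⟧ v
    ... | false | _ = refl
    ... | true | e = contradiction (trans e (∑-zero zero-term)) λ ()
      where
      zero-term : ∀ j → ⟦ uncovered j ∧ touches v j ⟧ ≡ 0
      zero-term j with touches v j in t
      ... | false = trans (⟦∧⟧ (uncovered j) false) (*-zeroʳ ⟦ uncovered j ⟧)
      ... | true with touching v j t
      ...   | inj₁ refl rewrite Xv = trans (⟦∧⟧ (M j ∧ false) true) (cong (_* 1) (trans (⟦∧⟧ (M j) false) (*-zeroʳ ⟦ M j ⟧)))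
      ...   | inj₂ refl rewrite Xv | ∨-trueʳ {X (fst j)} {true} refl = trans (⟦∧⟧ (M j ∧ false) true) (cong (_* 1) (trans (⟦∧⟧ (M j) false) (*-zeroʳ ⟦ M j ⟧)))

    E : Fin m → Bool
    E j = C j ∧ (S (fst j) ∨ S (snd j))

    E⊆C : ∀ j → E j ≡ true → C j ≡ true
    E⊆C j e = proj₁ (∧-true {C j} e)

    -- An edge of `C` has an end in the cover `X`, which `S` avoids; so at most one of its ends lies
    -- in `S`.
    one-end : ∀ j → ⟦ C j ⟧ * ends (λ v → ⟦ S v ⟧) j ≤ ⟦ E j ⟧
    one-end j with C j in Cj
    ... | false = z≤n
    ... | true with ∨-true {X (fst j)} (cover j Cj)
    ...   | inj₁ e rewrite S-misses-X (fst j) e = ≤-reflexive (+-identityʳ _)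
    ...   | inj₂ e rewrite S-misses-X (snd j) e = go (S (fst j))
      where
      go : ∀ a → ⟦ a ⟧ + 0 + 0 ≤ ⟦ a ∨ false ⟧
      go true = s≤s z≤n
      go false = z≤n

    -- `X` covers `C`, so an uncovered edge lies outside `C` and `heavy` applies to it; the
    -- `C`-degrees of its ends count edges of `E`.
    E-lower : u * B₀ ≤ 2 * card E
    E-lower = begin
      u * B₀                                                  ≡⟨ *-distribʳ-sum B₀ (λ j → ⟦ uncovered j ⟧) ⟩
      ∑[ j < m ] (⟦ uncovered j ⟧ * B₀)                       ≤⟨ ∑-mono go ⟩
      ∑[ j < m ] (2 * (⟦ uncovered j ⟧ * ends (dg C) j))      ≡⟨ sym (*-distribˡ-sum 2 (λ j → ⟦ uncovered j ⟧ * ends (dg C) j)) ⟩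
      2 * ∑[ j < m ] (⟦ uncovered j ⟧ * ends (dg C) j)        ≡⟨ cong (2 *_) (sym (handshake (dg C) uncovered)) ⟩
      2 * ∑[ v < n ] (dg C v * dg uncovered v)                ≡⟨ cong (2 *_) (sum-cong-≗ (λ v → trans (*-comm (dg C v) _) (cong (_* dg C v) (sym (⟦S⟧ v))))) ⟩
      2 * ∑[ v < n ] (⟦ S v ⟧ * dg C v)                       ≡⟨ cong (2 *_) (handshake (λ v → ⟦ S v ⟧) C) ⟩
      2 * ∑[ j < m ] (⟦ C j ⟧ * ends (λ v → ⟦ S v ⟧) j)       ≤⟨ *-monoʳ-≤ 2 (∑-mono one-end) ⟩
      2 * card E ∎
      where
      open ≤-Reasoning
      uncovered-heavy : ∀ j → uncovered j ≡ true → B₀ ≤ 2 * ends (dg C) j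
      uncovered-heavy j e with C j in Cj
      ... | false = heavy j (uncovered⊆M j e) Cj
      ... | true = contradiction (trans (sym (proj₂ (∧-true {M j} e))) (cong not (cover j Cj))) λ ()
      go : ∀ j → ⟦ uncovered j ⟧ * B₀ ≤ 2 * (⟦ uncovered j ⟧ * ends (dg C) j)
      go j with uncovered j in e
      ... | false = z≤n
      ... | true = subst₂ _≤_ (sym (+-identityʳ B₀)) (cong (2 *_) (sym (+-identityʳ (ends (dg C) j)))) (uncovered-heavy j e)

    E-degrees : ∑[ v < n ] dg E v ≡ 2 * card E
    E-degrees = trans (sum-cong-≗ (λ v → sym (+-identityʳ (dg E v)))) (trans (handshake (λ _ → 1) E)
      (trans (sym (*-distribʳ-sum 2 (λ j → ⟦ E j ⟧))) (*-comm (card E) 2)))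

    S-size : card S ≡ 2 * u
    S-size = trans (sum-cong-≗ (λ v → trans (⟦S⟧ v) (sym (+-identityʳ (dg uncovered v))))) (trans (handshake (λ _ → 1) uncovered)
      (trans (sym (*-distribʳ-sum 2 (λ j → ⟦ uncovered j ⟧))) (*-comm u 2)))

    E-light : 2 * ∑[ v < n ] (dg C v * dg E v) ≤ B₁ * card E
    E-light = begin
      2 * ∑[ v < n ] (dg C v * dg E v)                  ≡⟨ cong (2 *_) (handshake (dg C) E) ⟩
      2 * ∑[ j < m ] (⟦ E j ⟧ * ends (dg C) j)          ≡⟨ *-distribˡ-sum 2 (λ j → ⟦ E j ⟧ * ends (dg C) j) ⟩
      ∑[ j < m ] (2 * (⟦ E j ⟧ * ends (dg C) j))        ≤⟨ ∑-mono go ⟩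
      ∑[ j < m ] (B₁ * ⟦ E j ⟧)                         ≡⟨ sym (*-distribˡ-sum B₁ (λ j → ⟦ E j ⟧)) ⟩
      B₁ * card E ∎
      where
      open ≤-Reasoning
      go : ∀ j → 2 * (⟦ E j ⟧ * ends (dg C) j) ≤ B₁ * ⟦ E j ⟧
      go j with E j in e
      ... | false = z≤n
      ... | true = subst₂ _≤_ (cong (2 *_) (sym (+-identityʳ (ends (dg C) j)))) (sym (*-identityʳ B₁)) (light j (E⊆C j e))

    dg-E-zero : ∀ v → S v ≡ false → X v ≡ false → dg E v ≡ 0
    dg-E-zero v Sv Xv = ∑-zero go
      where
      go : ∀ j → ⟦ E j ∧ touches v j ⟧ ≡ 0
      go j with C j in Cj | touches v j in t
      ... | false | _ = refl
      ... | true | false = trans (⟦∧⟧ (S (fst j) ∨ S (snd j)) false) (*-zeroʳ ⟦ S (fst j) ∨ S (snd j) ⟧)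
      ... | true | true with touching v j t | ∨-true {X (fst j)} (cover j Cj)
      ...   | inj₁ refl | inj₁ e = contradiction (trans (sym Xv) e) λ ()
      ...   | inj₁ refl | inj₂ e rewrite Sv | S-misses-X (snd j) e = refl
      ...   | inj₂ refl | inj₁ e rewrite Sv | S-misses-X (fst j) e = refl
      ...   | inj₂ refl | inj₂ e = contradiction (trans (sym Xv) e) λ ()

    -- On `S` and `X`, outside of which `dg E` vanishes, the square of `dg E v` is compared with its
    -- tangent at `B₁ / 4`, the common degree in the extremal case. Enlarging one factor to `dg C v`
    -- prepares the use of `light` in `E-light`.
    pointwise : ∀ v → 8 * B₁ * dg E v ≤ 16 * (dg C v * dg E v) + B₁ * B₁ * (⟦ S v ⟧ + ⟦ X v ⟧)
    pointwise v = cases (S v) (X v) refl refl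
      where
      dominated : ∀ w → 1 ≤ w → 8 * B₁ * dg E v ≤ 16 * (dg C v * dg E v) + B₁ * B₁ * w
      dominated w 1≤w = ≤-trans (square-≥ (dg E v) B₁) (+-mono-≤ (*-monoʳ-≤ 16 (*-monoˡ-≤ (dg E v) (dg-mono E⊆C v)))
        (subst (_≤ B₁ * B₁ * w) (*-identityʳ (B₁ * B₁)) (*-monoʳ-≤ (B₁ * B₁) 1≤w)))
      cases : ∀ s x → S v ≡ s → X v ≡ x → 8 * B₁ * dg E v ≤ 16 * (dg C v * dg E v) + B₁ * B₁ * (⟦ s ⟧ + ⟦ x ⟧)
      cases true x _ _ = dominated (1 + ⟦ x ⟧) (s≤s z≤n)
      cases false true _ _ = dominated 1 ≤-refl
      cases false false Sv Xv rewrite dg-E-zero v Sv Xv = ≤-trans (≤-reflexive (*-zeroʳ (8 * B₁))) z≤n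

    E-upper : 8 * card E ≤ B₁ * (2 * u + card X)
    E-upper = *-cancelˡ-≤ B₁ {{>-nonZero 0<B₁}} (by-ineq 0 (+-mono-≤ total (*-monoʳ-≤ 8 E-light)) (e (card E) B₁ (2 * u + card X) (∑[ v < n ] (dg C v * dg E v))))
      where
      open ≤-Reasoning
      total : 8 * B₁ * (2 * card E) ≤ 16 * ∑[ v < n ] (dg C v * dg E v) + B₁ * B₁ * (2 * u + card X)
      total = begin
        8 * B₁ * (2 * card E)               ≡⟨ cong (8 * B₁ *_) (sym E-degrees) ⟩
        8 * B₁ * ∑[ v < n ] dg E v          ≡⟨ *-distribˡ-sum (8 * B₁) (dg E) ⟩
        ∑[ v < n ] (8 * B₁ * dg E v)        ≤⟨ ∑-mono pointwise ⟩
        ∑[ v < n ] (16 * (dg C v * dg E v) + B₁ * B₁ * (⟦ S v ⟧ + ⟦ X v ⟧))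
          ≡⟨ ∑-distrib-+ (λ v → 16 * (dg C v * dg E v)) (λ v → B₁ * B₁ * (⟦ S v ⟧ + ⟦ X v ⟧)) ⟩
        ∑[ v < n ] (16 * (dg C v * dg E v)) + ∑[ v < n ] (B₁ * B₁ * (⟦ S v ⟧ + ⟦ X v ⟧))
          ≡⟨ cong₂ _+_ (sym (*-distribˡ-sum 16 (λ v → dg C v * dg E v))) (sym (*-distribˡ-sum (B₁ * B₁) (λ v → ⟦ S v ⟧ + ⟦ X v ⟧))) ⟩
        16 * ∑[ v < n ] (dg C v * dg E v) + B₁ * B₁ * ∑[ v < n ] (⟦ S v ⟧ + ⟦ X v ⟧)
          ≡⟨ cong (λ z → 16 * ∑[ v < n ] (dg C v * dg E v) + B₁ * B₁ * z) (trans (∑-distrib-+ (λ v → ⟦ S v ⟧) (λ v → ⟦ X v ⟧)) (cong (_+ card X) S-size)) ⟩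
        16 * ∑[ v < n ] (dg C v * dg E v) + B₁ * B₁ * (2 * u + card X) ∎
      e : ∀ x b w y → b * (8 * x) + (16 * y + b * b * w + 8 * (b * x)) + 0 ≡ b * (b * w) + (8 * b * (2 * x) + 8 * (2 * y))
      e = solve-∀

    -- For `B₀ = B₁` the bounds on `card E` would give `4u ≤ 2u + card X`, that is `u` at most half
    -- of `card X`. The ratio `(Q + 2) / (Q + 1)` of `B₁` to `B₀` perturbs this, and turns the final
    -- 3/2 into `3/2 + 1/Q`.
    uncovered-bound : 2 * Q * u ≤ (Q + 2) * card X
    uncovered-bound = *-cancelˡ-≤ B₁ {{>-nonZero 0<B₁}} (by-ineq 0
      (+-mono-≤ (*-monoʳ-≤ (4 * u) close) (+-mono-≤ (*-monoʳ-≤ (4 * (Q + 2)) E-lower) (*-monoʳ-≤ (Q + 2) E-upper)))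
      (e B₁ B₀ Q u (card X) (card E)))
      where
      e : ∀ B₁ B₀ Q u x E → B₁ * (2 * Q * u) + (4 * u * ((Q + 2) * B₀) + (4 * (Q + 2) * (2 * E) + (Q + 2) * (B₁ * (2 * u + x)))) + 0
        ≡ B₁ * ((Q + 2) * x) + (4 * u * ((Q + 1) * B₁) + (4 * (Q + 2) * (u * B₀) + (Q + 2) * (8 * E)))
      e = solve-∀

  large-matching : ∃[ M′ ] (∀ j → M′ j ≡ true → C j ≡ true) × Matching M′ × 2 * Q * card M ≤ (3 * Q + 2) * card M′
  large-matching = M′ , M′⊆C , matchingM′ , (begin
    2 * Q * card M                        ≤⟨ *-monoʳ-≤ (2 * Q) M-split ⟩
    2 * Q * (card X + u)                  ≤⟨ by-ineq 0 uncovered-bound (e Q (card X) u) ⟩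
    (3 * Q + 2) * card X                  ≤⟨ *-monoʳ-≤ (3 * Q + 2) X≤M′ ⟩
    (3 * Q + 2) * card M′ ∎)
    where
    open ≤-Reasoning
    e : ∀ Q x u → 2 * Q * (x + u) + (Q + 2) * x + 0 ≡ (3 * Q + 2) * x + 2 * Q * u
    e = solve-∀

-- Two-sided concentration.

count-mono : ∀ {k} N (P Q : Vec (Fin k) N → Bool) → (∀ x → P x ≡ true → Q x ≡ true) → count P ≤ count Q
count-mono N P Q h = ∑V-mono N (λ x → go (P x) (Q x) (h x))
  where
  go : ∀ a b → (a ≡ true → b ≡ true) → ⟦ a ⟧ ≤ ⟦ b ⟧
  go false b h = z≤n
  go true b h rewrite h refl = ≤-refl

count-none : ∀ {k} N (P : Vec (Fin k) N → Bool) → (∀ x → ¬ P x ≡ true) → count P ≡ 0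
count-none {k} zero P h = go (P Vec.[]) (h Vec.[])
  where
  go : ∀ a → ¬ a ≡ true → ⟦ a ⟧ ≡ 0
  go false _ = refl
  go true h = contradiction refl h
count-none (suc N) P h = ∑-zero (λ c → count-none N (λ x → P (c Vec.∷ x)) (λ x → h (c Vec.∷ x)))

module Concentration {I N k : ℕ} (F : Fin I → Bool) (ρ : Fin I → Fin N) (t : Fin I → Fin (suc k))
  (injective : ∀ u u′ → F u ≡ true → F u′ ≡ true → ρ u ≡ ρ u′ → u ≡ u′) where

  D : ℕ
  D = size F ρ t injective

  X : Vec (Fin (suc k)) N → ℕ
  X = matches F ρ t injective

  above below deviates : ℕ → Vec (Fin (suc k)) N → Bool
  above h x = ⌊ D + suc k * h <? suc k * X x ⌋
  below h x = ⌊ suc k * X x + suc k * h <? D ⌋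
  deviates h x = above h x ∨ below h x

  -- When the mean `D / (k + 1)` is at most `σ * W`, the term `W` is the relative error `1/σ` of the
  -- tilt, and `suc σ * s` is the additive price of the failure factor `2 ^ s`. The two successors
  -- absorb the rounding of `D`.
  deviation : ℕ → ℕ → ℕ → ℕ
  deviation σ W s = suc W + suc σ * suc s

  module _ (σ W s : ℕ) .{{_ : NonZero σ}} (D≤ : D ≤ suc k * (σ * W)) where
    private
      h = deviation σ W s

      above-count : count (above h) * 2 ^ s ≤ suc k ^ N
      above-count = ≤-trans (*-monoˡ-≤ (2 ^ s) (count-mono N (above h) (λ x → ⌊ suc σ * (w + s) ≤? X x ⌋) implies))
        (upper-tail F ρ t injective σ w s D≤w)
        where
        Kσ = suc k * σ
        instance
          Kσ≢0 : NonZero Kσ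
          Kσ≢0 = m*n≢0 (suc k) σ
        w = suc (D / Kσ)
        D≤w : D ≤ suc k * (σ * w)
        D≤w = subst (D ≤_) (trans (*-comm w Kσ) (*-assoc (suc k) σ w)) (<⇒≤ (subst (_< w * Kσ) (sym (m≡m%n+[m/n]*n D Kσ)) (+-monoˡ-< (D / Kσ * Kσ) (m%n<n D Kσ))))
        w≤ : D / Kσ ≤ W
        w≤ = *-cancelʳ-≤ _ _ Kσ (≤-trans (m/n*n≤m D Kσ) (subst (D ≤_) (trans (sym (*-assoc (suc k) σ W)) (*-comm Kσ W)) D≤))
        implies : ∀ x → above h x ≡ true → ⌊ suc σ * (w + s) ≤? X x ⌋ ≡ true
        implies x e = true-⌊⌋ (suc σ * (w + s) ≤? X x) (*-cancelˡ-≤ (suc k) (lin (D / Kσ) (X x) (⌊⌋-true (D + suc k * h <? suc k * X x) e) (m/n*n≤m D Kσ) w≤))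
          where
          lin : ∀ q y → D + suc k * h < suc k * y → q * Kσ ≤ D → q ≤ W → suc k * (suc σ * (suc q + s)) ≤ suc k * y
          lin q y a b c = by-ineq (suc k + 1) (+-mono-≤ a (+-mono-≤ b (*-monoʳ-≤ (suc k) c))) (eq k σ q s W D y)
            where
            eq : ∀ k σ q s W D y → suc k * (suc σ * (suc q + s)) + (suc k * y + (D + suc k * W)) + (suc k + 1)
               ≡ suc k * y + (suc (D + suc k * (suc W + suc σ * suc s)) + (q * (suc k * σ) + suc k * q))
            eq = solve-∀

      below-count : count (below h) * 2 ^ s ≤ suc k ^ N
      -- For `q < s` the mean is below the allowed deviation and the event is empty; otherwise `s`
      -- can be taken out of `q`.
      below-count = [ dense , sparse ]′ (≤-<-connex s q)
        where
        Kτ = suc k * suc σ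
        q = D / Kτ
        D< : D < suc q * Kτ
        D< = subst (_< suc q * Kτ) (sym (m≡m%n+[m/n]*n D Kτ)) (+-monoˡ-< (q * Kτ) (m%n<n D Kτ))
        q≤W : q ≤ W
        q≤W = *-cancelʳ-≤ q W Kτ (≤-trans (m/n*n≤m D Kτ) (≤-trans D≤ (subst (suc k * (σ * W) ≤_) (eq (suc k) (suc σ) W) (*-monoʳ-≤ (suc k) (*-monoˡ-≤ W (n≤1+n σ))))))
          where
          eq : ∀ a b c → a * (b * c) ≡ c * (a * b)
          eq = solve-∀
        sparse : q < s → count (below h) * 2 ^ s ≤ suc k ^ N
        sparse q<s = subst (λ z → z * 2 ^ s ≤ suc k ^ N) (sym (count-none N (below h) (λ x e →
            n≮n D (<-trans (<-≤-trans D< (≤-trans (*-monoˡ-≤ Kτ q<s) (lin (X x)))) (⌊⌋-true (suc k * X x + suc k * h <? D) e)))))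
            z≤n
          where
          lin : ∀ y → s * Kτ ≤ suc k * y + suc k * h
          lin y = ≤-trans (m≤m+n _ (suc k * (y + suc W + suc σ))) (≤-reflexive (eq k σ s W y))
            where
            eq : ∀ k σ s W y → s * (suc k * suc σ) + suc k * (y + suc W + suc σ) ≡ suc k * y + suc k * (suc W + suc σ * suc s)
            eq = solve-∀
        dense : s ≤ q → count (below h) * 2 ^ s ≤ suc k ^ N
        dense s≤q = ≤-trans (*-monoˡ-≤ (2 ^ s) (count-mono N (below h) (λ x → ⌊ X x ≤? σ * w ⌋) implies))
            (lower-tail F ρ t injective σ w s (subst (_≤ D) (trans (*-comm q Kτ) (trans (*-assoc (suc k) (suc σ) q) (cong (λ z → suc k * (suc σ * z)) (sym w+s)))) (m/n*n≤m D Kτ)))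
          where
          w = q ∸ s
          w+s : w + s ≡ q
          w+s = m∸n+n≡m s≤q
          implies : ∀ x → below h x ≡ true → ⌊ X x ≤? σ * w ⌋ ≡ true
          implies x e = true-⌊⌋ (X x ≤? σ * w) (*-cancelˡ-≤ (suc k) (lin (X x) w (⌊⌋-true (suc k * X x + suc k * h <? D) e)
              (subst (λ z → D < suc z * Kτ) (sym w+s) D<) (≤-trans (m∸n≤m q s) q≤W)))
            where
            lin : ∀ y w → suc k * y + suc k * h < D → D < suc (w + s) * Kτ → w ≤ W → suc k * y ≤ suc k * (σ * w)
            lin y w a b c = by-ineq (suc k + 2) (+-mono-≤ a (+-mono-≤ b (*-monoʳ-≤ (suc k) c))) (eq k σ w s W D y)
              where
              eq : ∀ k σ w s W D y → suc k * y + (D + (suc (w + s) * (suc k * suc σ) + suc k * W)) + (suc k + 2)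
                 ≡ suc k * (σ * w) + (suc (suc k * y + suc k * (suc W + suc σ * suc s)) + (suc D + suc k * w))
              eq = solve-∀

    dense-deviates : count (deviates h) * 2 ^ s ≤ 2 * suc k ^ N
    dense-deviates = begin
      count (deviates h) * 2 ^ s                             ≤⟨ *-monoˡ-≤ (2 ^ s) (count-∨ (above h) (below h)) ⟩
      (count (above h) + count (below h)) * 2 ^ s            ≡⟨ *-distribʳ-+ (2 ^ s) (count (above h)) (count (below h)) ⟩
      count (above h) * 2 ^ s + count (below h) * 2 ^ s      ≤⟨ +-mono-≤ above-count below-count ⟩
      suc k ^ N + suc k ^ N                                  ≡⟨ cong (suc k ^ N +_) (sym (+-identityʳ _)) ⟩
      2 * suc k ^ N ∎
      where open ≤-Reasoning

  -- With a mean of at most `h` no downward deviation is possible, and an upward one needs more than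
  -- `S` matches.
  sparse-deviates : ∀ r p S h → 2 * (D * r) ≤ suc k → 2 * p ≤ suc r ^ suc S → S ≤ h → D ≤ suc k * h →
    count (deviates h) * p ≤ suc k ^ N
  sparse-deviates r p S h hr hp S≤h D≤ = ≤-trans
    (*-monoˡ-≤ p (count-mono N (deviates h) (λ x → ⌊ suc S ≤? X x ⌋) implies))
    (sparse-tail F ρ t injective r p (suc S) hr hp)
    where
    implies : ∀ x → deviates h x ≡ true → ⌊ suc S ≤? X x ⌋ ≡ true
    implies x e with ∨-true {above h x} e
    ... | inj₁ a = true-⌊⌋ (suc S ≤? X x) (≤-<-trans S≤h (*-cancelˡ-< (suc k) h (X x) (≤-<-trans (m≤n+m _ D) (⌊⌋-true (D + suc k * h <? suc k * X x) a))))
    ... | inj₂ b = contradiction (<-≤-trans (⌊⌋-true (suc k * X x + suc k * h <? D) b) (≤-trans D≤ (m≤n+m _ (suc k * X x)))) (n≮n _)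

  close-above : ∀ h x → deviates h x ≡ false → suc k * X x ≤ D + suc k * h
  close-above h x e = ≮⇒≥ (⌊⌋-false (D + suc k * h <? suc k * X x) (proj₁ (∨-false (above h x) _ e)))

  close-below : ∀ h x → deviates h x ≡ false → D ≤ suc k * X x + suc k * h
  close-below h x e = ≮⇒≥ (⌊⌋-false (suc k * X x + suc k * h <? D) (proj₂ (∨-false (above h x) _ e)))

-- A balanced bipartition crossed by a given matching.

bit : Fin 2 → Bool
bit zero = false
bit (suc _) = true

unbit : Bool → Fin 2
unbit false = zero
unbit true = suc zero

≟-unbit : ∀ z a → ⌊ z Fin.≟ unbit a ⌋ ≡ not (bit z xor a)
≟-unbit zero false = refl
≟-unbit zero true = refl
≟-unbit (suc zero) false = refl
≟-unbit (suc zero) true = refl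

-- A random bipartition under which every edge of the matching M crosses: one
-- random bit per vertex, except that the second end of an edge of M always
-- takes the opposite of the bit of the first end.
module Bipartition {n m : ℕ} (G : Graph n m)
  (M : Fin m → Bool) (matching : Degrees.Matching G M) (C : Fin m → Bool) where

  open Degrees G

  partner? : ∀ v → Dec (∃[ j ] M j ≡ true × v ≡ snd j)
  partner? v = FinP.any? (λ j → (M j Bool.≟ true) ×-dec (v Fin.≟ snd j))

  rep : Fin n → Fin n
  rep v with partner? v
  ... | yes (j , _) = fst j
  ... | no _ = v

  second : Fin n → Bool
  second v = ⌊ partner? v ⌋

  rep-injective : ∀ u v → second u ≡ second v → rep u ≡ rep v → u ≡ v
  rep-injective u v e r with partner? u | partner? v
  ... | no _ | no _ = r
  ... | yes (j , Mj , p) | yes (j′ , Mj′ , p′) with matching j j′ Mj Mj′ (inj₁ refl) (inj₁ r)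
  ...   | refl = trans p (sym p′)

  side : Vec (Fin 2) n → Fin n → Bool
  side x v = bit (lookup x (rep v)) xor second v

  cross : Vec (Fin 2) n → Fin m → Bool
  cross x j = side x (fst j) xor side x (snd j)

  crossing : Vec (Fin 2) n → Fin m → Bool
  crossing x j = C j ∧ cross x j

  rep-fst : ∀ j → M j ≡ true → rep (fst j) ≡ fst j × second (fst j) ≡ false
  rep-fst j Mj with partner? (fst j)
  ... | no _ = refl , refl
  ... | yes (j′ , Mj′ , p) with matching j j′ Mj Mj′ (inj₁ refl) (inj₂ p)
  ...   | refl = contradiction p (noLoop G j)

  rep-snd : ∀ j → M j ≡ true → rep (snd j) ≡ fst j × second (snd j) ≡ true
  rep-snd j Mj with partner? (snd j)
  ... | no h = contradiction (j , Mj , refl) h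
  ... | yes (j′ , Mj′ , p) with matching j j′ Mj Mj′ (inj₂ refl) (inj₂ p)
  ...   | refl = refl , refl

  M-crosses : ∀ x j → M j ≡ true → cross x j ≡ true
  M-crosses x j Mj rewrite proj₁ (rep-fst j Mj) | proj₂ (rep-fst j Mj) | proj₁ (rep-snd j Mj) | proj₂ (rep-snd j Mj) =
    go (bit (lookup x (fst j)))
    where
    go : ∀ b → (b xor false) xor (b xor true) ≡ true
    go false = refl
    go true = refl

  together : Fin n → Fin m → Bool
  together v j = ⌊ rep (other v j) Fin.≟ rep v ⌋

  at : Fin n → Fin m → Bool
  at v j = C j ∧ touches v j

  -- The two ends of an edge of `M` share a random bit, so the neighbours of `v` need not have
  -- distinct bits. Fixing the flag `second` of the far end separates them; an edge whose far end
  -- shares the bit of `v` itself is set aside in `joint`.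
  kind : Bool → Fin n → Fin m → Bool
  kind c v j = at v j ∧ (not (together v j) ∧ not (second (other v j) xor c))

  at-touching : ∀ {v j c} → at v j ∧ c ≡ true → Touching v j
  at-touching {v} {j} e = touching v j (proj₂ (∧-true {C j} (proj₁ (∧-true {at v j} e))))

  not-xor : ∀ {a c} → not (a xor c) ≡ true → a ≡ c
  not-xor {true} {true} _ = refl
  not-xor {false} {false} _ = refl

  kind-second : ∀ c v j → kind c v j ≡ true → second (other v j) ≡ c
  kind-second c v j e = not-xor (proj₂ (∧-true {not (together v j)} (proj₂ (∧-true {at v j} e))))

  -- The far bit that makes an edge of kind `c` cross when the bit of `v` is `b`. Keeping `b` as a
  -- parameter replaces conditioning on the bit of `v`: the union bound runs over both values.
  target : Bool → Fin n → Fin 2 → Fin 2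
  target c v b = unbit (not ((bit b xor second v) xor c))

  kind-injective : ∀ c v j j′ → kind c v j ≡ true → kind c v j′ ≡ true → rep (other v j) ≡ rep (other v j′) → j ≡ j′
  kind-injective c v j j′ e e′ r = other-injective v j j′ (at-touching {v} {j} e) (at-touching {v} {j′} e′)
    (rep-injective _ _ (trans (kind-second c v j e) (sym (kind-second c v j′ e′))) r)

  module Kind (c : Bool) (v : Fin n) (b : Fin 2) =
    Concentration (kind c v) (rep ∘ other v) (λ _ → target c v b) (kind-injective c v)

  joint : Fin n → Fin m → Bool
  joint v j = at v j ∧ together v j

  -- A vertex other than `v` with the same representative must carry the opposite flag, and
  -- representative and flag determine the vertex.
  joint≤1 : ∀ v → card (joint v) ≤ 1
  joint≤1 v = size≤N {N = 1} {k = 0} (joint v) (λ _ → zero) (λ _ → zero) (λ j j′ e e′ _ → other-injective v j j′ (at-touching {v} {j} e) (at-touching {v} {j′} e′)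
    (rep-injective _ _ (trans (opp j e) (sym (opp j′ e′))) (trans (rep≡ j e) (sym (rep≡ j′ e′)))))
    where
    rep≡ : ∀ j → joint v j ≡ true → rep (other v j) ≡ rep v
    rep≡ j e = ⌊⌋-true (rep (other v j) Fin.≟ rep v) (proj₂ (∧-true {at v j} e))
    opp : ∀ j → joint v j ≡ true → second (other v j) ≡ not (second v)
    opp j e with second (other v j) in p | second v in q
    ... | true | false = refl
    ... | false | true = refl
    ... | true | true = contradiction (rep-injective _ _ (trans p (sym q)) (rep≡ j e)) (other-≢ v j (at-touching {v} {j} e))
    ... | false | false = contradiction (rep-injective _ _ (trans p (sym q)) (rep≡ j e)) (other-≢ v j (at-touching {v} {j} e))

  cross-other : ∀ x v j → Touching v j → cross x j ≡ side x v xor side x (other v j)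
  cross-other x v j t with other-spec v j t
  ... | inj₁ (p , q) = cong₂ (λ a b → side x a xor side x b) (sym p) (sym q)
  ... | inj₂ (p , q) = trans (xor-comm (side x (fst j)) _) (cong₂ (λ a b → side x a xor side x b) (sym p) (sym q))

  degree-split : ∀ v b b′ → dg C v ≡ Kind.D false v b + Kind.D true v b′ + card (joint v)
  degree-split v b b′ = trans (sum-cong-≗ (λ j → bits (at v j) (together v j) (second (other v j))))
    (trans (∑-distrib-+ (λ j → ⟦ kind false v j ⟧ + ⟦ kind true v j ⟧) (λ j → ⟦ joint v j ⟧))
      (cong (_+ card (joint v)) (∑-distrib-+ (λ j → ⟦ kind false v j ⟧) (λ j → ⟦ kind true v j ⟧))))
    where
    bits : ∀ a r s → ⟦ a ⟧ ≡ ⟦ a ∧ (not r ∧ not (s xor false)) ⟧ + ⟦ a ∧ (not r ∧ not (s xor true)) ⟧ + ⟦ a ∧ r ⟧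
    bits false r s = refl
    bits true true s = refl
    bits true false true = refl
    bits true false false = refl

  joint-crossing : Vec (Fin 2) n → Fin n → ℕ
  joint-crossing x v = ∑[ j < m ] ⟦ joint v j ∧ cross x j ⟧

  joint-crossing≤ : ∀ x v → joint-crossing x v ≤ card (joint v)
  joint-crossing≤ x v = ∑-mono (λ j → go (joint v j) (cross x j))
    where
    go : ∀ a b → ⟦ a ∧ b ⟧ ≤ ⟦ a ⟧
    go false b = z≤n
    go true b = ⟦⟧≤1 b

  crossing-split : ∀ x v → let b = lookup x (rep v) in
    dg (crossing x) v ≡ Kind.X false v b x + Kind.X true v b x + joint-crossing x v
  crossing-split x v = trans (sum-cong-≗ pointwise)
    (trans (∑-distrib-+ (λ j → ⟦ kind false v j ∧ hitsB false j ⟧ + ⟦ kind true v j ∧ hitsB true j ⟧) (λ j → ⟦ joint v j ∧ cross x j ⟧))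
      (cong (_+ joint-crossing x v) (∑-distrib-+ (λ j → ⟦ kind false v j ∧ hitsB false j ⟧) (λ j → ⟦ kind true v j ∧ hitsB true j ⟧))))
    where
    hitsB : Bool → Fin m → Bool
    hitsB c j = ⌊ lookup x (rep (other v j)) Fin.≟ target c v (lookup x (rep v)) ⌋
    bits : ∀ c r s z sv → ⟦ (c ∧ (sv xor (z xor s))) ∧ true ⟧ ≡
      ⟦ ((c ∧ true) ∧ (not r ∧ not (s xor false))) ∧ not (z xor not (sv xor false)) ⟧
      + ⟦ ((c ∧ true) ∧ (not r ∧ not (s xor true))) ∧ not (z xor not (sv xor true)) ⟧ + ⟦ ((c ∧ true) ∧ r) ∧ (sv xor (z xor s)) ⟧
    bits false r s z sv = refl
    bits true true s z sv = cong ⟦_⟧ (∧-identityʳ (sv xor (z xor s)))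
    bits true false true true true = refl
    bits true false true true false = refl
    bits true false true false true = refl
    bits true false true false false = refl
    bits true false false true true = refl
    bits true false false true false = refl
    bits true false false false true = refl
    bits true false false false false = refl
    pointwise : ∀ j → ⟦ crossing x j ∧ touches v j ⟧ ≡ ⟦ kind false v j ∧ hitsB false j ⟧ + ⟦ kind true v j ∧ hitsB true j ⟧ + ⟦ joint v j ∧ cross x j ⟧
    pointwise j with touches v j in e
    ... | false = untouched (C j) (cross x j)
      where
      untouched : ∀ a b {p q r} → ⟦ (a ∧ b) ∧ false ⟧ ≡ ⟦ ((a ∧ false) ∧ p) ∧ q ⟧ + ⟦ ((a ∧ false) ∧ r) ∧ hitsB true j ⟧ + ⟦ ((a ∧ false) ∧ together v j) ∧ b ⟧
      untouched true true = refl
      untouched true false = refl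
      untouched false b = refl
    ... | true rewrite cross-other x v j (touching v j e)
        | ≟-unbit (lookup x (rep (other v j))) (not ((bit (lookup x (rep v)) xor second v) xor false))
        | ≟-unbit (lookup x (rep (other v j))) (not ((bit (lookup x (rep v)) xor second v) xor true))
        = bits (C j) (together v j) (second (other v j)) (bit (lookup x (rep (other v j)))) (side x v)

  module _ (σ W s : ℕ) .{{_ : NonZero σ}} (bounded : ∀ v → dg C v ≤ 2 * (σ * W)) (8n<2^s : 8 * n < 2 ^ s) where
    private
      h : ℕ
      h = suc W + suc σ * suc s

      bad : Vec (Fin 2) n → Bool
      bad x = anyB (λ v → anyB (λ b → Kind.deviates false v b h x ∨ Kind.deviates true v b h x))

      D≤ : ∀ c v b → Kind.D c v b ≤ 2 * (σ * W)
      D≤ c v b = ≤-trans (go c) (bounded v)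
        where
        open ≤-Reasoning
        go : ∀ c → Kind.D c v b ≤ dg C v
        go false = subst (Kind.D false v b ≤_) (sym (degree-split v b b)) (≤-trans (m≤m+n _ (Kind.D true v b)) (m≤m+n _ (card (joint v))))
        go true = subst (Kind.D true v b ≤_) (sym (degree-split v b b)) (≤-trans (m≤n+m _ (Kind.D false v b)) (m≤m+n _ (card (joint v))))

      -- The factor 8 counts two values of the bit, two kinds and two tails for each vertex.
      few-bad : count bad * 2 ^ s ≤ 8 * n * 2 ^ n
      few-bad = begin
        count bad * 2 ^ s
          ≤⟨ *-monoˡ-≤ (2 ^ s) (≤-trans (count-anyB (λ v x → anyB (λ b → Kind.deviates false v b h x ∨ Kind.deviates true v b h x)))
               (∑-mono (λ v → ≤-trans (count-anyB (λ b x → Kind.deviates false v b h x ∨ Kind.deviates true v b h x))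
                 (∑-mono (λ b → count-∨ (Kind.deviates false v b h) (Kind.deviates true v b h)))))) ⟩
        sum (λ v → sum (λ b → each v b)) * 2 ^ s
          ≡⟨ trans (*-distribʳ-sum (2 ^ s) (λ v → sum (λ b → each v b))) (sum-cong-≗ (λ v → *-distribʳ-sum (2 ^ s) (each v))) ⟩
        sum (λ v → sum (λ b → each v b * 2 ^ s))
          ≤⟨ ∑-bounded (λ v → ∑-bounded (λ b → bound v b)) ⟩
        n * (2 * (4 * 2 ^ n))
          ≡⟨ e n (2 ^ n) ⟩
        8 * n * 2 ^ n ∎
        where
        open ≤-Reasoning
        each : Fin n → Fin 2 → ℕ
        each v b = count (Kind.deviates false v b h) + count (Kind.deviates true v b h)
        e : ∀ n p → n * (2 * (4 * p)) ≡ 8 * n * p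
        e = solve-∀
        bound : ∀ v b → each v b * 2 ^ s ≤ 4 * 2 ^ n
        bound v b = begin
          each v b * 2 ^ s  ≡⟨ *-distribʳ-+ (2 ^ s) (count (Kind.deviates false v b h)) (count (Kind.deviates true v b h)) ⟩
          count (Kind.deviates false v b h) * 2 ^ s + count (Kind.deviates true v b h) * 2 ^ s
            ≤⟨ +-mono-≤ (Kind.dense-deviates false v b σ W s (D≤ false v b)) (Kind.dense-deviates true v b σ W s (D≤ true v b)) ⟩
          2 * 2 ^ n + 2 * 2 ^ n  ≡⟨ e′ (2 ^ n) ⟩
          4 * 2 ^ n ∎
          where
          e′ : ∀ p → 2 * p + 2 * p ≡ 4 * p
          e′ = solve-∀

      good : ∃[ x ] bad x ≡ false
      good = avoid n bad (*-cancelʳ-< (2 ^ s) _ _ (≤-<-trans few-bad (subst (8 * n * 2 ^ n <_) (*-comm (2 ^ s) (2 ^ n)) (*-monoˡ-< (2 ^ n) {{m^n≢0 2 n}} 8n<2^s))))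

    -- Each of the two kinds contributes an error `2 * h`, and the joint edge, of which there is at
    -- most one, contributes 1.
    balanced : ∃[ x ] ∀ v → (2 * dg (crossing x) v ≤ dg C v + (4 * h + 1)) × (dg C v ≤ 2 * dg (crossing x) v + (4 * h + 1))
    balanced = x , λ v → above v , below v
      where
      x : Vec (Fin 2) n
      x = proj₁ good
      module _ (v : Fin n) where
        b = lookup x (rep v)
        fine : Kind.deviates false v b h x ≡ false × Kind.deviates true v b h x ≡ false
        fine = ∨-false (Kind.deviates false v b h x) _
          (anyB-false (λ b → Kind.deviates false v b h x ∨ Kind.deviates true v b h x)
            (anyB-false (λ v → anyB (λ b → Kind.deviates false v b h x ∨ Kind.deviates true v b h x)) (proj₂ good) v) b)
        J = card (joint v)
        above : 2 * dg (crossing x) v ≤ dg C v + (4 * h + 1)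
        above = subst₂ (λ p q → 2 * p ≤ q + (4 * h + 1)) (sym (crossing-split x v)) (sym (degree-split v b b))
          (by-ineq 0 (+-mono-≤ (Kind.close-above false v b h x (proj₁ fine)) (+-mono-≤ (Kind.close-above true v b h x (proj₂ fine))
             (+-mono-≤ (*-monoʳ-≤ 2 (joint-crossing≤ x v)) (joint≤1 v))))
            (e (Kind.X false v b x) (Kind.X true v b x) (joint-crossing x v) (Kind.D false v b) (Kind.D true v b) J h))
          where
          e : ∀ x y z p q r h → 2 * (x + y + z) + (p + 2 * h + (q + 2 * h + (2 * r + 1))) + 0 ≡ p + q + r + (4 * h + 1) + (2 * x + (2 * y + (2 * z + r)))
          e = solve-∀
        below : dg C v ≤ 2 * dg (crossing x) v + (4 * h + 1)
        below = subst₂ (λ p q → p ≤ 2 * q + (4 * h + 1)) (sym (degree-split v b b)) (sym (crossing-split x v))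
          (by-ineq (2 * joint-crossing x v) (+-mono-≤ (Kind.close-below false v b h x (proj₁ fine)) (+-mono-≤ (Kind.close-below true v b h x (proj₂ fine)) (joint≤1 v)))
            (e (Kind.X false v b x) (Kind.X true v b x) (joint-crossing x v) (Kind.D false v b) (Kind.D true v b) J h))
          where
          e : ∀ x y z p q r h → p + q + r + (2 * x + 2 * h + (2 * y + 2 * h + 1)) + 2 * z ≡ 2 * (x + y + z) + (4 * h + 1) + (p + (q + r))
          e = solve-∀

-- The random partition of the reference subgraph.

module Sampling {n m : ℕ} (G : Graph n m) (k b : ℕ) where

  open Degrees G
  -- `suc (b + k * suc b)` computes to `K * β`, so the reference has parameters `K * β` and
  -- `K * β - 1`.
  open Existence G (b + k * suc b)

  K β : ℕ
  K = suc k
  β = suc b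

  H : Fin m → Bool
  H = proj₁ reference

  H-light : ∀ j → H j ≡ true → ends (dg H) j ≤ K * β
  H-light = proj₁ (proj₂ reference)

  H-heavy : ∀ j → H j ≡ false → K * β ≤ suc (ends (dg H) j)
  H-heavy = proj₂ (proj₂ reference)

  dg-H≤ : ∀ v → dg H v ≤ K * β
  dg-H≤ = dg-bounded H (K * β) H-light

  module At (v : Fin n) (i : Fin K) =
    Concentration {k = k} (λ j → H j ∧ touches v j) id (λ _ → i) (λ _ _ _ _ e → e)

  bad : ℕ → Partition m K → Bool
  bad h p = anyB (λ v → anyB (λ i → At.deviates v i h p))

  module _ (L σ W : ℕ) .{{_ : NonZero σ}} (n<2^L : n < 2 ^ L) (β≤σW : β ≤ σ * W) where

    -- For `K ≤ 4n²` the required `2 n² K` is at most `8 n⁴ ≤ 2 ^ (4 * L + 3)`, which fixes the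
    -- exponent. The union bound over vertices and parts spends `n * K` of `n² K`; the remaining `n`
    -- is the reciprocal of the failure probability.
    deviationH : ℕ
    deviationH = suc W + suc σ * suc (4 * L + 3)

    private
      h = deviationH

      few-deviations : 0 < n → ∀ v i → count (At.deviates v i h) * (n * n * K) ≤ K ^ m
      few-deviations 0<n v i = [ many-parts , few-parts ]′ (≤-total (4 * (n * n)) K)
        where
        few-parts : K ≤ 4 * (n * n) → count (At.deviates v i h) * (n * n * K) ≤ K ^ m
        few-parts K≤ = *-cancelˡ-≤ 2 (begin
          2 * (count (At.deviates v i h) * (n * n * K))     ≡⟨ e₁ (count (At.deviates v i h)) (n * n) K ⟩
          count (At.deviates v i h) * (2 * (n * n) * K)     ≤⟨ *-monoʳ-≤ (count (At.deviates v i h)) (begin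
             2 * (n * n) * K                      ≤⟨ *-monoʳ-≤ (2 * (n * n)) K≤ ⟩
             2 * (n * n) * (4 * (n * n))          ≡⟨ e₂ n ⟩
             n * n * (n * n) * 8                  ≤⟨ *-monoˡ-≤ 8 (*-mono-≤ (*-mono-≤ n≤ n≤) (*-mono-≤ n≤ n≤)) ⟩
             2 ^ L * 2 ^ L * (2 ^ L * 2 ^ L) * 2 ^ 3 ≡⟨ pow ⟩
             2 ^ (4 * L + 3)                      ∎) ⟩
          count (At.deviates v i h) * 2 ^ (4 * L + 3)       ≤⟨ At.dense-deviates v i σ W (4 * L + 3) (≤-trans (dg-H≤ v) (*-monoʳ-≤ K β≤σW)) ⟩
          2 * K ^ m ∎)
          where
          open ≤-Reasoning
          n≤ : n ≤ 2 ^ L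
          n≤ = <⇒≤ n<2^L
          e₁ : ∀ c x K → 2 * (c * (x * K)) ≡ c * (2 * x * K)
          e₁ = solve-∀
          e₂ : ∀ n → 2 * (n * n) * (4 * (n * n)) ≡ n * n * (n * n) * 8
          e₂ = solve-∀
          pow : 2 ^ L * 2 ^ L * (2 ^ L * 2 ^ L) * 2 ^ 3 ≡ 2 ^ (4 * L + 3)
          pow = trans (cong (λ z → z * z * 2 ^ 3) (sym (^-distribˡ-+-* 2 L L)))
            (trans (cong (_* 2 ^ 3) (sym (^-distribˡ-+-* 2 (L + L) (L + L))))
              (trans (sym (^-distribˡ-+-* 2 (L + L + (L + L)) 3)) (cong (λ z → 2 ^ (z + 3)) (e₃ L))))
            where
            e₃ : ∀ L → L + L + (L + L) ≡ 4 * L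
            e₃ = solve-∀
        -- The union bound over the k parts needs a bound decaying in k, and k is not bounded in terms of n;
        -- when k ≥ 4n², no vertex has four edges in one part, except with probability below 1/(n²k).
        many-parts : 4 * (n * n) ≤ K → count (At.deviates v i h) * (n * n * K) ≤ K ^ m
        many-parts ≤K = At.sparse-deviates v i r (n * n * K) 3 h
            (≤-trans (*-monoʳ-≤ 2 (*-monoˡ-≤ r (dg≤n H v))) (subst (_≤ K) (e₁ r n) (m/n*n≤m K (2 * n))))
            (begin
              2 * (n * n * K)                         ≤⟨ m≤m+n _ (2 * (n * n * K)) ⟩
              2 * (n * n * K) + 2 * (n * n * K)       ≡⟨ e₂ n K ⟩
              2 * n * (2 * n) * K                     ≤⟨ *-mono-≤ (*-mono-≤ 2n≤ 2n≤) K≤ ⟩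
              suc r * suc r * (suc r * suc r)         ≡⟨ e₃ (suc r) ⟩
              suc r ^ 4 ∎)
            (≤-trans (≤-trans (m≤n+m 3 (4 * L)) (≤-trans (n≤1+n _) (m≤m+n _ (σ * suc (4 * L + 3))))) (m≤n+m _ (suc W)))
            (≤-trans (dg≤n H v) (≤-trans (≤-trans (m≤n*m n n {{nonZero-n}}) (≤-trans (m≤n*m (n * n) 4) ≤K)) (m≤m*n K h)))
          where
          open ≤-Reasoning
          nonZero-n : NonZero n
          nonZero-n = >-nonZero 0<n
          instance
            nz : NonZero (2 * n)
            nz = m*n≢0 2 n {{_}} {{nonZero-n}}
          -- The largest tilt with `2 * (n * r) ≤ K`. As `K ≥ (2n)²`, both `2n ≤ r + 1` and
          -- `K ≤ (r + 1)²` follow, hence `(r + 1)⁴ ≥ 4 n² K`.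
          r = K / (2 * n)
          e₁ : ∀ r n → r * (2 * n) ≡ 2 * (n * r)
          e₁ = solve-∀
          e₂ : ∀ n K → 2 * (n * n * K) + 2 * (n * n * K) ≡ 2 * n * (2 * n) * K
          e₂ = solve-∀
          e₃ : ∀ r → r * r * (r * r) ≡ r * (r * (r * (r * 1)))
          e₃ = solve-∀
          e₄ : ∀ n → 4 * (n * n) ≡ 2 * n * (2 * n)
          e₄ = solve-∀
          K< : K < suc r * (2 * n)
          K< = subst (_< suc r * (2 * n)) (sym (m≡m%n+[m/n]*n K (2 * n))) (+-monoˡ-< (r * (2 * n)) (m%n<n K (2 * n)))
          2n≤ : 2 * n ≤ suc r
          2n≤ = *-cancelʳ-≤ (2 * n) (suc r) (2 * n) (≤-trans (subst (_≤ K) (e₄ n) ≤K) (<⇒≤ K<))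
          K≤ : K ≤ suc r * suc r
          K≤ = ≤-trans (<⇒≤ K<) (*-monoʳ-≤ (suc r) 2n≤)

    few-bad : count (bad h) * n ≤ K ^ m
    few-bad = go n refl
      where
      open ≤-Reasoning
      go : ∀ n′ → n′ ≡ n → count (bad h) * n ≤ K ^ m
      go zero refl = subst (_≤ K ^ m) (sym (*-zeroʳ (count (bad h)))) z≤n
      go (suc n′) eq = *-cancelʳ-≤ _ _ (n * K) {{subst (λ z → NonZero (z * K)) eq _}} (begin
        count (bad h) * n * (n * K)        ≡⟨ e (count (bad h)) n K ⟩
        count (bad h) * (n * n * K)        ≤⟨ *-monoˡ-≤ (n * n * K) (≤-trans (count-anyB (λ v p → anyB (λ i → At.deviates v i h p)))
                                                 (∑-mono (λ v → count-anyB (λ i p → At.deviates v i h p)))) ⟩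
        sum (λ v → sum (each v)) * (n * n * K)  ≡⟨ trans (*-distribʳ-sum (n * n * K) (λ v → sum (each v))) (sum-cong-≗ (λ v → *-distribʳ-sum (n * n * K) (each v))) ⟩
        sum (λ v → sum (λ i → each v i * (n * n * K))) ≤⟨ ∑-bounded (λ v → ∑-bounded (few-deviations (subst (0 <_) eq (s≤s z≤n)) v)) ⟩
        n * (K * K ^ m)                    ≡⟨ trans (sym (*-assoc n K (K ^ m))) (*-comm (n * K) (K ^ m)) ⟩
        K ^ m * (n * K) ∎)
        where
        each : Fin n → Fin K → ℕ
        each v i = count (At.deviates v i h)
        e : ∀ c n K → c * n * (n * K) ≡ c * (n * n * K)
        e = solve-∀

  module Good (h : ℕ) (p : Partition m K) (good : bad h p ≡ false) where

    part : Fin K → Fin m → Bool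
    part i j = H j ∧ ⌊ lookup p j Fin.≟ i ⌋

    X≡dg : ∀ v i → At.X v i p ≡ dg (part i) v
    X≡dg v i = sum-cong-≗ (λ j → cong ⟦_⟧ (go (H j) (touches v j) ⌊ lookup p j Fin.≟ i ⌋))
      where
      go : ∀ a b c → (a ∧ b) ∧ c ≡ (a ∧ c) ∧ b
      go false b c = refl
      go true true true = refl
      go true true false = refl
      go true false true = refl
      go true false false = refl

    fine : ∀ v i → At.deviates v i h p ≡ false
    fine v i = anyB-false (λ i → At.deviates v i h p) (anyB-false (λ v → anyB (λ i → At.deviates v i h p)) good v) i

    part-above : ∀ i v → K * dg (part i) v ≤ dg H v + K * h
    part-above i v = subst (λ z → K * z ≤ dg H v + K * h) (X≡dg v i) (At.close-above v i h p (fine v i))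

    part-below : ∀ i v → dg H v ≤ K * dg (part i) v + K * h
    part-below i v = subst (λ z → dg H v ≤ K * z + K * h) (X≡dg v i) (At.close-below v i h p (fine v i))

    dg-part≤ : ∀ i v → dg (part i) v ≤ β + h
    dg-part≤ i v = *-cancelˡ-≤ K (≤-trans (part-above i v) (subst (dg H v + K * h ≤_) (sym (*-distribˡ-+ K β h)) (+-monoˡ-≤ (K * h) (dg-H≤ v))))

    -- Degrees of arbitrary coresets and of their union.

    module Coresets (g E R L : ℕ) (C : Fin K → Fin m → Bool)
      (C⊆ : ∀ i j → C i j ≡ true → lookup p j ≡ i)
      (C-light : ∀ i j → C i j ≡ true → ends (dg (C i)) j ≤ β)
      (C-heavy : ∀ i j → lookup p j ≡ i → C i j ≡ false → β ≤ ends (dg (C i)) j + g)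
      (n<2^L : n < 2 ^ L) (b≤RE : β + h ≤ R * E) where

      g′ Δ : ℕ
      g′ = 2 * h + 1 + g
      Δ = E + 2 * g′ * (R * suc L)

      dg-C≤ : ∀ i v → dg (C i) v ≤ β
      dg-C≤ i = dg-bounded (C i) β (C-light i)

      private
        module _ (i : Fin K) where
          C∖H H∖C : Fin m → Bool
          C∖H j = C i j ∧ not (part i j)
          H∖C j = part i j ∧ not (C i j)

          -- Both sides are the degree in the union of `C i` and the part. Common edges thus cancel,
          -- and only the two differences enter the expansion argument.
          exchange : ∀ v → dg (C i) v + dg H∖C v ≡ dg (part i) v + dg C∖H v
          exchange v = trans (sym (∑-distrib-+ (λ j → ⟦ C i j ∧ touches v j ⟧) (λ j → ⟦ H∖C j ∧ touches v j ⟧)))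
            (trans (sum-cong-≗ (λ j → go (C i j) (part i j) (touches v j)))
              (∑-distrib-+ (λ j → ⟦ part i j ∧ touches v j ⟧) (λ j → ⟦ C∖H j ∧ touches v j ⟧)))
            where
            go : ∀ a b t → ⟦ a ∧ t ⟧ + ⟦ (b ∧ not a) ∧ t ⟧ ≡ ⟦ b ∧ t ⟧ + ⟦ (a ∧ not b) ∧ t ⟧
            go true true t = refl
            go true false t = +-identityʳ ⟦ t ⟧
            go false true t = sym (+-identityʳ ⟦ t ⟧)
            go false false t = refl

          exchange-ends : ∀ j → ends (dg (C i)) j + ends (dg H∖C) j ≡ ends (dg (part i)) j + ends (dg C∖H) j
          exchange-ends j = trans (interchange (dg (C i) (fst j)) _ _ _)
            (trans (cong₂ _+_ (exchange (fst j)) (exchange (snd j))) (interchange (dg (part i) (fst j)) _ _ _))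
            where
            interchange : ∀ a b c d → (a + b) + (c + d) ≡ (a + c) + (b + d)
            interchange = solve-∀

          not-true⇒false : ∀ {a} → not a ≡ true → a ≡ false
          not-true⇒false {false} _ = refl

          -- An edge of `C i` bounds the degrees in `C i` by `β`; its absence from the reference
          -- bounds those of the part from below by `β - 2h - 1`. The 1 is the gap between the two
          -- parameters of the reference.
          exchange-C : ∀ j → C∖H j ≡ true → ends (dg C∖H) j ≤ ends (dg H∖C) j + g′
          exchange-C j e = by-ineq g (+-mono-≤ (C-light i j Cj) β≤)
              (trans (e₁ (ends (dg C∖H) j) (ends (dg (part i)) j) h g β) (trans (cong (_+ (β + 2 * h + 1 + g)) (sym (exchange-ends j))) (e₂ (ends (dg (C i)) j) (ends (dg H∖C) j) h g β)))
            where
            Cj = proj₁ (∧-true {C i j} e)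
            Hj : H j ≡ false
            Hj = trans (sym (trans (cong (H j ∧_) (true-⌊⌋ (lookup p j Fin.≟ i) (C⊆ i j Cj))) (∧-identityʳ (H j)))) (not-true⇒false (proj₂ (∧-true {C i j} e)))
            β≤ : β ≤ ends (dg (part i)) j + 2 * h + 1
            β≤ = *-cancelˡ-≤ K (by-ineq k (+-mono-≤ (H-heavy j Hj) (+-mono-≤ (part-below i (fst j)) (part-below i (snd j))))
                   (e₃ k β (dg H (fst j)) (dg H (snd j)) (dg (part i) (fst j)) (dg (part i) (snd j)) h))
              where
              e₃ : ∀ k β x y z w h → suc k * β + (suc (x + y) + (suc k * z + suc k * h + (suc k * w + suc k * h))) + k
                ≡ suc k * (z + w + 2 * h + 1) + (suc k * β + (x + y))
              e₃ = solve-∀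
            e₁ : ∀ a c h g β → a + (β + (c + 2 * h + 1)) + g ≡ c + a + (β + 2 * h + 1 + g)
            e₁ = solve-∀
            e₂ : ∀ x y h g β → x + y + (β + 2 * h + 1 + g) ≡ y + (2 * h + 1 + g) + (x + β)
            e₂ = solve-∀

          exchange-H : ∀ j → H∖C j ≡ true → ends (dg H∖C) j ≤ ends (dg C∖H) j + g′
          exchange-H j e = by-ineq 1 (+-mono-≤ ≤β (C-heavy i j pj (not-true⇒false (proj₂ (∧-true {part i j} e)))))
              (trans (e₁ (ends (dg H∖C) j) (ends (dg (C i)) j) h g β) (trans (cong (_+ (β + 2 * h + 1 + g)) (exchange-ends j)) (e₂ (ends (dg (part i)) j) (ends (dg C∖H) j) h g β)))
            where
            Hi = ∧-true {H j} (proj₁ (∧-true {part i j} e))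
            pj : lookup p j ≡ i
            pj = ⌊⌋-true (lookup p j Fin.≟ i) (proj₂ Hi)
            ≤β : ends (dg (part i)) j ≤ β + 2 * h
            ≤β = *-cancelˡ-≤ K (by-ineq 0 (+-mono-≤ (H-light j (proj₁ Hi)) (+-mono-≤ (part-above i (fst j)) (part-above i (snd j))))
                   (e₃ k β (dg H (fst j)) (dg H (snd j)) (dg (part i) (fst j)) (dg (part i) (snd j)) h))
              where
              e₃ : ∀ k β x y z w h → suc k * (z + w) + (suc k * β + (x + suc k * h + (y + suc k * h))) + 0
                ≡ suc k * (β + 2 * h) + (x + y + (suc k * z + suc k * w))
              e₃ = solve-∀
            e₁ : ∀ a c h g β → a + (β + 2 * h + (c + g)) + 1 ≡ c + a + (β + 2 * h + 1 + g)
            e₁ = solve-∀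
            e₂ : ∀ x y h g β → x + y + (β + 2 * h + 1 + g) ≡ y + (2 * h + 1 + g) + (x + β)
            e₂ = solve-∀

          -- By `exchange` the gap to be bounded is that between the degrees of the two differences,
          -- to which the expansion argument applies; `coreset-below` swaps their roles.
          coreset-above : ∀ v → dg (C i) v ≤ dg (part i) v + Δ
          coreset-above v = by-ineq 0 (Exchange.degrees-close G C∖H H∖C g′ (β + h) E R L exchange-C exchange-H
              (λ u → ≤-trans (dg-mono (λ j e → proj₁ (∧-true {part i j} e)) u) (dg-part≤ i u)) (s≤s z≤n) b≤RE n<2^L v)
            (trans (e₁ (dg (C i) v) (dg H∖C v) Δ) (trans (cong (_+ Δ) (exchange v)) (e₂ (dg (part i) v) (dg C∖H v) Δ)))
            where
            e₁ : ∀ x y d → x + (y + d) + 0 ≡ x + y + d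
            e₁ = solve-∀
            e₂ : ∀ x y d → x + y + d ≡ x + d + y
            e₂ = solve-∀

          coreset-below : ∀ v → dg (part i) v ≤ dg (C i) v + Δ
          coreset-below v = by-ineq 0 (Exchange.degrees-close G H∖C C∖H g′ (β + h) E R L exchange-H exchange-C
              (λ u → ≤-trans (dg-mono (λ j e → proj₁ (∧-true {C i j} e)) u) (≤-trans (dg-C≤ i u) (m≤m+n β h))) (s≤s z≤n) b≤RE n<2^L v)
            (trans (e₁ (dg (part i) v) (dg C∖H v) Δ) (trans (cong (_+ Δ) (sym (exchange v))) (e₂ (dg (C i) v) (dg H∖C v) Δ)))
            where
            e₁ : ∀ x y d → x + (y + d) + 0 ≡ x + y + d
            e₁ = solve-∀
            e₂ : ∀ x y d → x + y + d ≡ x + d + y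
            e₂ = solve-∀

      Γ : ℕ
      Γ = h + Δ

      C-vs-H : ∀ i v → K * dg (C i) v ≤ dg H v + K * Γ
      C-vs-H i v = by-ineq 0 (+-mono-≤ (*-monoʳ-≤ K (coreset-above i v)) (part-above i v)) (e k (dg (C i) v) (dg (part i) v) (dg H v) h Δ)
        where
        e : ∀ k c x H h Δ → suc k * c + (suc k * (x + Δ) + (H + suc k * h)) + 0 ≡ H + suc k * (h + Δ) + (suc k * c + suc k * x)
        e = solve-∀

      H-vs-C : ∀ i v → dg H v ≤ K * dg (C i) v + K * Γ
      H-vs-C i v = by-ineq 0 (+-mono-≤ (*-monoʳ-≤ K (coreset-below i v)) (part-below i v)) (e k (dg (C i) v) (dg (part i) v) (dg H v) h Δ)
        where
        e : ∀ k c x H h Δ → H + (suc k * (c + Δ) + (suc k * x + suc k * h)) + 0 ≡ suc k * c + suc k * (h + Δ) + (suc k * x + H)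
        e = solve-∀

      union : Fin m → Bool
      union j = C (lookup p j) j

      dg-union : ∀ v → dg union v ≡ ∑[ i < K ] dg (C i) v
      dg-union v = trans (sum-cong-≗ (λ j → sym (∑-single (λ i → ⟦ C i j ∧ touches v j ⟧) (lookup p j) (λ i i≢ → go i j i≢))))
          (∑-comm (λ j i → ⟦ C i j ∧ touches v j ⟧))
        where
        go : ∀ i j → i ≢ lookup p j → ⟦ C i j ∧ touches v j ⟧ ≡ 0
        go i j i≢ with C i j in e
        ... | false = refl
        ... | true = contradiction (sym (C⊆ i j e)) i≢

      dg-union≤ : ∀ v → dg union v ≤ K * β
      dg-union≤ v = subst (_≤ K * β) (sym (dg-union v)) (∑-bounded (λ i → dg-C≤ i v))

      union-above : ∀ v → dg union v ≤ dg H v + K * Γ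
      union-above v = *-cancelˡ-≤ K (subst (λ z → K * z ≤ K * (dg H v + K * Γ)) (sym (dg-union v))
        (subst (_≤ K * (dg H v + K * Γ)) (sym (*-distribˡ-sum K (λ i → dg (C i) v))) (∑-bounded (λ i → C-vs-H i v))))

      union-below : ∀ v → dg H v ≤ dg union v + K * Γ
      union-below v = *-cancelˡ-≤ K (begin
        K * dg H v                                     ≡⟨ sym (∑-const K (dg H v)) ⟩
        ∑[ i < K ] dg H v                              ≤⟨ ∑-mono (λ i → H-vs-C i v) ⟩
        ∑[ i < K ] (K * dg (C i) v + K * Γ)            ≡⟨ ∑-distrib-+ (λ i → K * dg (C i) v) (λ _ → K * Γ) ⟩
        ∑[ i < K ] (K * dg (C i) v) + ∑[ i < K ] (K * Γ) ≡⟨ cong₂ _+_ (sym (*-distribˡ-sum K (λ i → dg (C i) v))) (∑-const K (K * Γ)) ⟩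
        K * ∑[ i < K ] dg (C i) v + K * (K * Γ)        ≡⟨ sym (*-distribˡ-+ K (∑[ i < K ] dg (C i) v) (K * Γ)) ⟩
        K * (∑[ i < K ] dg (C i) v + K * Γ)            ≡⟨ cong (λ z → K * (z + K * Γ)) (sym (dg-union v)) ⟩
        K * (dg union v + K * Γ) ∎)
        where open ≤-Reasoning

      -- The edge lies in the coreset of its own part, where its edge degree is at most `β`. Passing
      -- from the union to `H`, and from `H` to `K` times that coreset, costs `K * Γ` each at both
      -- ends, hence the 4.
      union-light : ∀ j → union j ≡ true → ends (dg union) j ≤ K * β + 4 * (K * Γ)
      union-light j e = by-ineq 0
        (+-mono-≤ (+-mono-≤ (union-above (fst j)) (union-above (snd j)))
          (+-mono-≤ (+-mono-≤ (H-vs-C i (fst j)) (H-vs-C i (snd j))) (*-monoʳ-≤ K (C-light i j e))))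
        (e₁ k β Γ (dg union (fst j)) (dg union (snd j)) (dg H (fst j)) (dg H (snd j)) (dg (C i) (fst j)) (dg (C i) (snd j)))
        where
        i = lookup p j
        e₁ : ∀ k β Γ u u′ H H′ c c′ → u + u′ + (H + suc k * Γ + (H′ + suc k * Γ) + (suc k * c + suc k * Γ + (suc k * c′ + suc k * Γ) + suc k * β)) + 0
          ≡ suc k * β + 4 * (suc k * Γ) + (u + u′ + (H + H′ + suc k * (c + c′)))
        e₁ = solve-∀

      union-heavy : ∀ j → union j ≡ false → K * β ≤ ends (dg union) j + (4 * (K * Γ) + K * g)
      union-heavy j e = by-ineq 0
        (+-mono-≤ (+-mono-≤ (union-below (fst j)) (union-below (snd j)))
          (+-mono-≤ (+-mono-≤ (C-vs-H i (fst j)) (C-vs-H i (snd j))) (*-monoʳ-≤ K (C-heavy i j refl e))))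
        (e₁ k β Γ g (dg union (fst j)) (dg union (snd j)) (dg H (fst j)) (dg H (snd j)) (dg (C i) (fst j)) (dg (C i) (snd j)))
        where
        i = lookup p j
        e₁ : ∀ k β Γ g u u′ H H′ c c′ → suc k * β + (u + suc k * Γ + (u′ + suc k * Γ) + (H + suc k * Γ + (H′ + suc k * Γ) + suc k * (c + c′ + g))) + 0
          ≡ u + u′ + (4 * (suc k * Γ) + suc k * g) + (H + H′ + (suc k * c + suc k * c′ + suc k * β))
        e₁ = solve-∀

-- From a near-EDCS to a large matching.

module NearEDCS {n m : ℕ} (G : Graph n m) (U M : Fin m → Bool) (matching : Degrees.Matching G M)
  (B z : ℕ) (bounded : ∀ v → Degrees.dg G U v ≤ B)
  (light : ∀ j → U j ≡ true → Degrees.ends G (Degrees.dg G U) j ≤ B + z)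
  (heavy : ∀ j → U j ≡ false → B ≤ Degrees.ends G (Degrees.dg G U) j + z)
  (σ W s Q : ℕ) .{{_ : NonZero σ}} (B≤ : B ≤ 2 * (σ * W)) (8n<2^s : 8 * n < 2 ^ s) (0<B : 0 < B) where

  open Degrees G

  open Bipartition G M matching U

  private
    y total : ℕ
    y = 4 * (suc W + suc σ * suc s) + 1
    total = 2 * y + z

    Balanced : Vec (Fin 2) n → Set
    Balanced x = ∀ v → (2 * dg (crossing x) v ≤ dg U v + y) × (dg U v ≤ 2 * dg (crossing x) v + y)

    module _ (total≤ : (2 * Q + 3) * total ≤ B) (x : Vec (Fin 2) n) (balance : Balanced x) where

      bip : ∀ j → crossing x j ≡ true → side x (snd j) ≡ not (side x (fst j))
      bip j e = xor-not (side x (fst j)) (side x (snd j)) (proj₂ (∧-true {U j} e))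
        where
        xor-not : ∀ a b → a xor b ≡ true → b ≡ not a
        xor-not true false _ = refl
        xor-not false true _ = refl

      light-lin : ∀ a b c d y → 2 * a ≤ c + y → 2 * b ≤ d + y → c + d ≤ B + z → 2 * (a + b) ≤ B + (2 * y + z)
      light-lin a b c d y p q r = by-ineq 0 (+-mono-≤ (+-mono-≤ p q) r) (eq a b c d B z y)
        where
        eq : ∀ a b c d B z y → 2 * (a + b) + (c + y + (d + y) + (B + z)) + 0 ≡ B + (2 * y + z) + (2 * a + 2 * b + (c + d))
        eq = solve-∀

      light′ : ∀ j → crossing x j ≡ true → 2 * ends (dg (crossing x)) j ≤ B + total
      light′ j e = light-lin (dg (crossing x) (fst j)) (dg (crossing x) (snd j)) (dg U (fst j)) (dg U (snd j)) y (proj₁ (balance (fst j))) (proj₁ (balance (snd j))) (light j (proj₁ (∧-true {U j} e)))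

      heavy-lin : ∀ a b c d y → c ≤ 2 * a + y → d ≤ 2 * b + y → B ≤ c + d + z → B ≤ (2 * y + z) + 2 * (a + b)
      heavy-lin a b c d y p q r = by-ineq 0 (+-mono-≤ (+-mono-≤ p q) r) (eq a b c d B z y)
        where
        eq : ∀ a b c d B z y → B + (2 * a + y + (2 * b + y) + (c + d + z)) + 0 ≡ (2 * y + z) + 2 * (a + b) + (c + d + B)
        eq = solve-∀

      heavy′ : ∀ j → M j ≡ true → crossing x j ≡ false → B ∸ total ≤ 2 * ends (dg (crossing x)) j
      heavy′ j Mj e = m≤n+o⇒m∸n≤o B total (heavy-lin (dg (crossing x) (fst j)) (dg (crossing x) (snd j)) (dg U (fst j)) (dg U (snd j)) y (proj₂ (balance (fst j))) (proj₂ (balance (snd j))) (heavy j Uj))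
        where
        -- Every edge of `M` crosses, so one outside the crossing subgraph is outside `U` itself.
        Uj : U j ≡ false
        Uj = trans (sym (trans (cong (U j ∧_) (M-crosses x j Mj)) (∧-identityʳ (U j)))) e

      -- Collecting terms leaves `B` with coefficient 1 against `t` with coefficient
      -- `(Q + 1) + (Q + 2)`; this is the origin of `2 * Q + 3`.
      close-lin : ∀ t → (2 * Q + 3) * t ≤ B → (Q + 1) * (B + t) ≤ (Q + 2) * (B ∸ t)
      close-lin t t≤ = by-ineq 0 t≤ (trans (cong (λ b → (Q + 1) * (b + t) + b + 0) (sym B≡)) (eq Q (B ∸ t) t))
        where
        B≡ : B ∸ t + t ≡ B
        B≡ = m∸n+n≡m (≤-trans (m≤n*m t (2 * Q + 3) {{>-nonZero (≤-trans (s≤s z≤n) (m≤n+m 3 (2 * Q)))}}) t≤)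
        eq : ∀ Q b t → (Q + 1) * (b + t + t) + (b + t) + 0 ≡ (Q + 2) * b + (2 * Q + 3) * t
        eq = solve-∀

      module Result = BipartiteMatching G (side x) (crossing x) M bip matching (B ∸ total) (B + total) Q
        light′ heavy′ (≤-trans 0<B (m≤m+n B total)) (close-lin total total≤)

      conclusion : ∃[ M′ ] (∀ j → M′ j ≡ true → U j ≡ true) × Matching M′ × 2 * Q * card M ≤ (3 * Q + 2) * card M′
      conclusion = proj₁ Result.large-matching
        , (λ j e → proj₁ (∧-true {U j} (proj₁ (proj₂ Result.large-matching) j e)))
        , proj₂ (proj₂ Result.large-matching)

  large-matching : (2 * Q + 3) * total ≤ B →
    ∃[ M′ ] (∀ j → M′ j ≡ true → U j ≡ true) × Matching M′ × 2 * Q * card M ≤ (3 * Q + 2) * card M′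
  large-matching total≤ = conclusion total≤ (proj₁ b) (proj₂ b)
    where
    b : ∃ Balanced
    b = balanced σ W s (λ v → ≤-trans (bounded v) B≤) 8n<2^s

-- Choice of parameters.

div-ceil : ∀ a d .{{_ : NonZero d}} → (a ≤ d * suc (a / d)) × (d * suc (a / d) ≤ a + d)
div-ceil a d = <⇒≤ (subst₂ _<_ (sym (m≡m%n+[m/n]*n a d)) (*-comm (suc (a / d)) d) (+-monoˡ-< (a / d * d) (m%n<n a d)))
  , subst₂ _≤_ (eq d (a / d)) (+-comm d a) (+-monoʳ-≤ d (m/n*n≤m a d))
  where
  eq : ∀ d q → d + q * d ≡ d * suc q
  eq = solve-∀

-- With `σ + 1 ≤ 2σ` and `4L + 4 ≤ 8L` the logarithmic term is at most `16 σ² L`; rounding adds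
-- `2σ`. Together these make the 18.
σh-bound : ∀ σ L W β .{{_ : NonZero σ}} .{{_ : NonZero L}} → σ * W ≤ β + σ → 18 * (σ * σ * L) ≤ β →
  σ * (suc W + suc σ * suc (4 * L + 3)) ≤ 2 * β
σh-bound (suc s) (suc l) W β hW h18 = by-ineq (suc s * (10 * s + 10 * l + 14 * s * l)) (+-mono-≤ hW h18) (e s l W β)
  where
  e : ∀ s l W β → suc s * (suc W + suc (suc s) * suc (4 * suc l + 3)) + (β + suc s + β) + suc s * (10 * s + 10 * l + 14 * s * l)
    ≡ 2 * β + (suc s * W + 18 * (suc s * suc s * suc l))
  e = solve-∀

σg′-bound : ∀ σ h g β → σ * h ≤ 2 * β → σ ≤ β → σ * g ≤ β → σ * (2 * h + 1 + g) ≤ 6 * β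
σg′-bound σ h g β a b c = by-ineq 0 (+-mono-≤ (*-monoʳ-≤ 2 a) (+-mono-≤ b c)) (e σ h g β)
  where
  e : ∀ σ h g β → σ * (2 * h + 1 + g) + (2 * (2 * β) + (β + β)) + 0 ≡ 6 * β + (2 * (σ * h) + (σ + σ * g))
  e = solve-∀

RE-bound : ∀ x β h R → x ≤ β + h + R → h ≤ β → R ≤ β → x ≤ 3 * β
RE-bound x β h R a b c = by-ineq 0 (+-mono-≤ a (+-mono-≤ b c)) (e x β h R)
  where
  e : ∀ x β h R → x + (β + h + R + (β + β)) + 0 ≡ 3 * β + (x + (h + R))
  e = solve-∀

-- As `L + 1 ≤ 2L`, the second summand is at most `4 R² L g′`, and `27 = 3 + 4 * 6`.
RΔ-bound : ∀ R E g′ L β .{{_ : NonZero L}} → R * E ≤ 3 * β → R * R * L * g′ ≤ 6 * β → R * (E + 2 * g′ * (R * suc L)) ≤ 27 * β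
RΔ-bound R E g′ (suc l) β a b = by-ineq (2 * g′ * R * R * l) (+-mono-≤ a (*-monoʳ-≤ 4 b)) (e R E g′ l β)
  where
  e : ∀ R E g′ l β → R * (E + 2 * g′ * (R * suc (suc l))) + (3 * β + 4 * (6 * β)) + 2 * g′ * R * R * l
    ≡ 27 * β + (R * E + 4 * (R * R * suc l * g′))
  e = solve-∀

-- `98 = 80 + 10 + 8`: the logarithmic term by `R + 1 ≤ 2R` and `L + 4 ≤ 5L`, the constant summands,
-- and the rounding of `W`.
Ry-bound : ∀ R L W B β .{{_ : NonZero R}} .{{_ : NonZero L}} → R * W ≤ B + R → R * R * L ≤ β →
  R * (2 * (4 * (suc W + suc R * suc (L + 3)) + 1)) ≤ 8 * B + 98 * β
Ry-bound (suc r) (suc l) W B β a b = by-ineq (suc r * (58 * r + 82 * l + 90 * r * l)) (+-mono-≤ (*-monoʳ-≤ 8 a) (*-monoʳ-≤ 98 b)) (e r l W B β)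
  where
  e : ∀ r l W B β → suc r * (2 * (4 * (suc W + suc (suc r) * suc (suc l + 3)) + 1)) + (8 * (B + suc r) + 98 * β) + suc r * (58 * r + 82 * l + 90 * r * l)
    ≡ 8 * B + 98 * β + (8 * (suc r * W) + 98 * (suc r * suc r * suc l))
  e = solve-∀

-- `223 = 8 + 98 + 4 * (2 + 27) + 1`; the slack `98 * (k * β)` enlarges `98 * β` to `98 * (K * β)`.
R-total-bound : ∀ R y K h Δ g β .{{_ : NonZero K}} → R * (2 * y) ≤ 8 * (K * β) + 98 * β →
  R * h ≤ 2 * β → R * Δ ≤ 27 * β → R * g ≤ β → R * (2 * y + (4 * (K * (h + Δ)) + K * g)) ≤ 223 * (K * β)
R-total-bound R y (suc k) h Δ g β a b c d = by-ineq (98 * (k * β)) (+-mono-≤ a (+-mono-≤ (*-monoʳ-≤ (4 * suc k) (+-mono-≤ b c)) (*-monoʳ-≤ (suc k) d)))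
  (e R y k h Δ g β)
  where
  e : ∀ R y k h Δ g β → R * (2 * y + (4 * (suc k * (h + Δ)) + suc k * g)) + (8 * (suc k * β) + 98 * β + (4 * suc k * (2 * β + 27 * β) + suc k * β)) + 98 * (k * β)
    ≡ 223 * (suc k * β) + (R * (2 * y) + (4 * suc k * (R * h + R * Δ) + suc k * (R * g)))
  e = solve-∀

total-bound : ∀ c Q t x .{{_ : NonZero c}} → 892 ≤ c → 2 ≤ Q → c * Q * t ≤ 223 * x → (2 * Q + 3) * t ≤ x
total-bound c Q t x 892≤c 2≤Q h = *-cancelˡ-≤ c (begin
  c * ((2 * Q + 3) * t)    ≤⟨ *-monoʳ-≤ c (*-monoˡ-≤ t 2Q+3≤4Q) ⟩
  c * (4 * Q * t)          ≡⟨ e₁ c Q t ⟩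
  4 * (c * Q * t)          ≤⟨ *-monoʳ-≤ 4 h ⟩
  4 * (223 * x)            ≡⟨ sym (*-assoc 4 223 x) ⟩
  892 * x                  ≤⟨ *-monoˡ-≤ x 892≤c ⟩
  c * x ∎)
  where
  open ≤-Reasoning
  e₁ : ∀ c Q t → c * (4 * Q * t) ≡ 4 * (c * Q * t)
  e₁ = solve-∀
  2Q+3≤4Q : 2 * Q + 3 ≤ 4 * Q
  2Q+3≤4Q = by-ineq 1 (*-monoʳ-≤ 2 2≤Q) (e Q)
    where
    e : ∀ Q → 2 * Q + 3 + 2 * Q + 1 ≡ 4 * Q + 4
    e = solve-∀

-- In Parameters all errors add up to at most 223 kβ/R = 223 kβ/(cQ), while the last step
-- needs (2Q + 3) · total ≤ kβ; as 2Q + 3 ≤ 4Q this asks for c ≥ 4 · 223 = 892.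
spread : ℕ → ℕ → ℕ → ℕ
spread c Q L = c * Q * (c * Q) * L

module Parameters (c Q L β k g : ℕ) .{{_ : NonZero c}} .{{_ : NonZero Q}} .{{_ : NonZero L}}
  (892≤c : 892 ≤ c) (2≤Q : 2 ≤ Q) (β-large : 18 * (spread c Q L * spread c Q L * L) ≤ β) (g-small : spread c Q L * g ≤ β) where

  R σ : ℕ
  R = c * Q
  σ = spread c Q L

  K : ℕ
  K = suc k

  instance
    R≢0 : NonZero R
    R≢0 = m*n≢0 c Q
    σ≢0 : NonZero σ
    σ≢0 = m*n≢0 (R * R) L {{m*n≢0 R R}}

  W h E W₂ g′ Δ Γ y total : ℕ
  W = suc (β / σ)
  h = suc W + suc σ * suc (4 * L + 3)
  E = suc ((β + h) / R)
  -- The error of the bipartition is not amplified, so precision `1/R` suffices here, where sampling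
  -- takes `1/σ`.
  W₂ = suc (K * β / R)
  g′ = 2 * h + 1 + g
  Δ = E + 2 * g′ * (R * suc L)
  Γ = h + Δ
  y = 4 * (suc W₂ + suc R * suc (L + 3)) + 1
  total = 2 * y + (4 * (K * Γ) + K * g)

  β≤σW : β ≤ σ * W
  β≤σW = proj₁ (div-ceil β σ)

  β+h≤RE : β + h ≤ R * E
  β+h≤RE = proj₁ (div-ceil (β + h) R)

  Kβ≤2RW₂ : K * β ≤ 2 * (R * W₂)
  Kβ≤2RW₂ = ≤-trans (proj₁ (div-ceil (K * β) R)) (m≤n*m (R * W₂) 2)

  private
    σ≤β : σ ≤ β
    σ≤β = ≤-trans (≤-trans (m≤m*n σ (σ * L) {{m*n≢0 σ L}}) (≤-trans (≤-reflexive (sym (*-assoc σ σ L))) (m≤n*m (σ * σ * L) 18))) β-large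

    R≤σ : R ≤ σ
    R≤σ = ≤-trans (m≤m*n R (R * L) {{m*n≢0 R L}}) (≤-reflexive (sym (*-assoc R R L)))

    σh≤2β : σ * h ≤ 2 * β
    σh≤2β = σh-bound σ L W β (proj₂ (div-ceil β σ)) β-large

    h≤β : h ≤ β
    h≤β = *-cancelˡ-≤ 2 (≤-trans (*-monoˡ-≤ h (≤-trans (≤-trans 2≤Q (m≤n*m Q c)) R≤σ)) σh≤2β)

    RΔ≤27β : R * Δ ≤ 27 * β
    RΔ≤27β = RΔ-bound R E g′ L β (RE-bound (R * E) β h R (proj₂ (div-ceil (β + h) R)) h≤β (≤-trans R≤σ σ≤β)) (σg′-bound σ h g β σh≤2β σ≤β g-small)

    R-total≤ : R * total ≤ 223 * (K * β)
    R-total≤ = R-total-bound R y K h Δ g β (Ry-bound R L W₂ (K * β) β (proj₂ (div-ceil (K * β) R)) σ≤β)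
      (≤-trans (*-monoˡ-≤ h R≤σ) σh≤2β) RΔ≤27β (≤-trans (*-monoˡ-≤ g R≤σ) g-small)

  total≤ : (2 * Q + 3) * total ≤ K * β
  total≤ = total-bound c Q total (K * β) 892≤c 2≤Q R-total≤

-- Passage between rational and natural parameters.

fromℕᵘ : ℕ → ℚᵘ.ℚᵘ
fromℕᵘ a = ℚᵘ.mkℚᵘ (pos a) 0

toℚᵘ-toℚ : ∀ a → ℚ.toℚᵘ (toℚ a) ℚᵘ.≃ fromℕᵘ a
toℚᵘ-toℚ a = ℚP.toℚᵘ-fromℚᵘ (fromℕᵘ a)

toℚ-+ : ∀ a b → toℚ (a + b) ≡ toℚ a ℚ.+ toℚ b
toℚ-+ a b = ℚP.toℚᵘ-injective (begin
  ℚ.toℚᵘ (toℚ (a + b))                      ≈⟨ toℚᵘ-toℚ (a + b) ⟩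
  fromℕᵘ (a + b)                            ≈⟨ ℚᵘ.*≡* (cong (ℤ._* pos 1) (trans (ℤP.pos-+ a b) (sym (cong₂ ℤ._+_ (ℤP.*-identityʳ (pos a)) (ℤP.*-identityʳ (pos b)))))) ⟩
  fromℕᵘ a ℚᵘ.+ fromℕᵘ b                    ≈⟨ ℚᵘP.+-cong (ℚᵘP.≃-sym (toℚᵘ-toℚ a)) (ℚᵘP.≃-sym (toℚᵘ-toℚ b)) ⟩
  ℚ.toℚᵘ (toℚ a) ℚᵘ.+ ℚ.toℚᵘ (toℚ b)        ≈⟨ ℚᵘP.≃-sym (ℚP.toℚᵘ-homo-+ (toℚ a) (toℚ b)) ⟩
  ℚ.toℚᵘ (toℚ a ℚ.+ toℚ b) ∎)
  where open import Relation.Binary.Reasoning.Setoid ℚᵘP.≃-setoid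

toℚ-* : ∀ a b → toℚ (a * b) ≡ toℚ a ℚ.* toℚ b
toℚ-* a b = ℚP.toℚᵘ-injective (begin
  ℚ.toℚᵘ (toℚ (a * b))                      ≈⟨ toℚᵘ-toℚ (a * b) ⟩
  fromℕᵘ (a * b)                            ≈⟨ ℚᵘ.*≡* (cong (ℤ._* pos 1) (ℤP.pos-* a b)) ⟩
  fromℕᵘ a ℚᵘ.* fromℕᵘ b                    ≈⟨ ℚᵘP.*-cong (ℚᵘP.≃-sym (toℚᵘ-toℚ a)) (ℚᵘP.≃-sym (toℚᵘ-toℚ b)) ⟩
  ℚ.toℚᵘ (toℚ a) ℚᵘ.* ℚ.toℚᵘ (toℚ b)        ≈⟨ ℚᵘP.≃-sym (ℚP.toℚᵘ-homo-* (toℚ a) (toℚ b)) ⟩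
  ℚ.toℚᵘ (toℚ a ℚ.* toℚ b) ∎)
  where open import Relation.Binary.Reasoning.Setoid ℚᵘP.≃-setoid

toℚ-mono : ∀ {a b} → a ≤ b → toℚ a ℚ.≤ toℚ b
toℚ-mono {a} {b} a≤b = ℚP.toℚᵘ-cancel-≤ (ℚᵘP.≤-respˡ-≃ (ℚᵘP.≃-sym (toℚᵘ-toℚ a)) (ℚᵘP.≤-respʳ-≃ (ℚᵘP.≃-sym (toℚᵘ-toℚ b))
  (ℚᵘ.*≤* (ℤP.*-monoʳ-≤-nonNeg (pos 1) (ℤ.+≤+ a≤b)))))

toℚ-cancel : ∀ {a b} → toℚ a ℚ.≤ toℚ b → a ≤ b
toℚ-cancel {a} {b} h = go (ℚᵘP.≤-respˡ-≃ (toℚᵘ-toℚ a) (ℚᵘP.≤-respʳ-≃ (toℚᵘ-toℚ b) (ℚP.toℚᵘ-mono-≤ h)))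
  where
  go : fromℕᵘ a ℚᵘ.≤ fromℕᵘ b → a ≤ b
  go (ℚᵘ.*≤* p) = ℤP.drop‿+≤+ (subst₂ ℤ._≤_ (ℤP.*-identityʳ (pos a)) (ℤP.*-identityʳ (pos b)) p)

toℚ-≥0 : ∀ a → 0ℚ ℚ.≤ toℚ a
toℚ-≥0 a = toℚ-mono {0} {a} z≤n

toℚ-positive : ∀ a .{{_ : NonZero a}} → 0ℚ ℚ.< toℚ a
toℚ-positive a = ℚP.≰⇒> (λ h → n≮n 0 (<-≤-trans (>-nonZero⁻¹ a) (toℚ-cancel {a} {0} h)))

toℚ-^ : ∀ a e → toℚ (a ^ e) ≡ toℚ a ^ℚ e
toℚ-^ a zero = refl
toℚ-^ a (suc e) = trans (toℚ-* a (a ^ e)) (cong (toℚ a ℚ.*_) (toℚ-^ a e))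

ℚ-*-≥0 : ∀ {a b} → 0ℚ ℚ.≤ a → 0ℚ ℚ.≤ b → 0ℚ ℚ.≤ a ℚ.* b
ℚ-*-≥0 {a} {b} p q = subst (ℚ._≤ a ℚ.* b) (ℚP.*-zeroʳ a) (ℚP.*-monoˡ-≤-nonNeg a {{ℚ.nonNegative p}} q)

ℚ-*-mono : ∀ {a b c d} → 0ℚ ℚ.≤ a → 0ℚ ℚ.≤ d → a ℚ.≤ b → c ℚ.≤ d → a ℚ.* c ℚ.≤ b ℚ.* d
ℚ-*-mono {a} {b} {c} {d} 0≤a 0≤d p q = ℚP.≤-trans (ℚP.*-monoˡ-≤-nonNeg a {{ℚ.nonNegative 0≤a}} q) (ℚP.*-monoʳ-≤-nonNeg d {{ℚ.nonNegative 0≤d}} p)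

^ℚ-≥0 : ∀ {a} e → 0ℚ ℚ.≤ a → 0ℚ ℚ.≤ a ^ℚ e
^ℚ-≥0 zero h = toℚ-≥0 1
^ℚ-≥0 (suc e) h = ℚ-*-≥0 h (^ℚ-≥0 e h)

^ℚ-mono : ∀ {a b} e → 0ℚ ℚ.≤ a → a ℚ.≤ b → a ^ℚ e ℚ.≤ b ^ℚ e
^ℚ-mono zero _ _ = ℚP.≤-refl
^ℚ-mono (suc e) 0≤a h = ℚ-*-mono 0≤a (^ℚ-≥0 e (ℚP.≤-trans 0≤a h)) h (^ℚ-mono e 0≤a h)

inv-spec : ∀ x → 0ℚ ℚ.< x → (x ℚ.* inv x ≡ 1ℚ) × (0ℚ ℚ.≤ inv x)
inv-spec x@(ℚ.mkℚ (pos zero) d c) h = contradiction h (ℚP.<-irrefl (sym (ℚP.↥p≡0⇒p≡0 x refl)))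
inv-spec x@(ℚ.mkℚ (pos (suc a)) d c) h = ℚP.*-inverseʳ x , ℚP.nonNegative⁻¹ (ℚ.1/ x)
inv-spec x@(ℚ.mkℚ ℤ.-[1+ a ] d c) (ℚ.*<* ())

-- `ceiling x` is `- floor (- x)`, so this is an upper bound on a floor, negated. It also makes the
-- ceiling nonnegative, so that the absolute value does not change it.
ceiling-lower : ∀ N x → toℚ N ℚ.≤ x → N ≤ ℤ.∣ ℚ.ceiling x ∣
ceiling-lower N x@(ℚ.mkℚ num d c) h = ℤP.drop‿+≤+ (subst (pos N ℤ.≤_) (sym (ℤP.0≤i⇒+∣i∣≡i (ℤP.≤-trans (ℤ.+≤+ z≤n) N≤ceil))) N≤ceil)
  where
  Nd≤ : pos N ℤ.* pos (suc d) ℤ.≤ num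
  Nd≤ = go (ℚᵘP.≤-respˡ-≃ (toℚᵘ-toℚ N) (ℚP.toℚᵘ-mono-≤ h))
    where
    go : fromℕᵘ N ℚᵘ.≤ ℚᵘ.mkℚᵘ num d → pos N ℤ.* pos (suc d) ℤ.≤ num
    go (ℚᵘ.*≤* p) = subst (pos N ℤ.* pos (suc d) ℤ.≤_) (ℤP.*-identityʳ num) p
  floor≤ : ∀ y → ℚ.↥ y ≡ ℤ.- num → ℚ.↧ y ≡ pos (suc d) → ℚ.floor y ℤ.≤ ℤ.- pos N
  floor≤ y@(ℚ.mkℚ num′ d′ _) refl refl = ℤP.*-cancelʳ-≤-pos (ℚ.floor y) (ℤ.- pos N) (pos (suc d))
    (ℤP.≤-trans (ℤD.[n/d]*d≤n num′ (pos (suc d))) (subst (num′ ℤ.≤_) (ℤP.neg-distribˡ-* (pos N) (pos (suc d))) (ℤP.neg-mono-≤ Nd≤)))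
  N≤ceil : pos N ℤ.≤ ℚ.ceiling x
  N≤ceil = subst (ℤ._≤ ℚ.ceiling x) (ℤP.neg-involutive (pos N)) (ℤP.neg-mono-≤ (floor≤ (ℚ.- x) (ℚP.↥-neg x) (ℚP.↧-neg x)))

-- `q` is the integer part of `1/ε`, nonzero as `ε < 1`. Its lower bound on `1/ε` serves `betaOf`
-- and `lambdaOf`; the upper bound, with `Q = q + 1`, puts `1/Q` below `ε` in the final ratio.
inverse-floor : ∀ ε → 0ℚ ℚ.< ε → ε ℚ.< 1ℚ → ∃[ q ] NonZero q × (toℚ q ℚ.* ε ℚ.≤ 1ℚ) × (1ℚ ℚ.≤ toℚ (suc q) ℚ.* ε)
inverse-floor ε@(ℚ.mkℚ (pos zero) d c) h _ = contradiction h (ℚP.<-irrefl (sym (ℚP.↥p≡0⇒p≡0 ε refl)))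
inverse-floor (ℚ.mkℚ ℤ.-[1+ a ] d c) (ℚ.*<* ()) _
inverse-floor ε@(ℚ.mkℚ (pos (suc a)) d c) _ (ℚ.*<* lt) = q , q≢0 , below , above
  where
  q = suc d / suc a
  a<d : suc a ≤ suc d
  a<d = <⇒≤ (ℤP.drop‿+<+ (subst₂ ℤ._<_ (ℤP.*-identityʳ (pos (suc a))) (ℤP.*-identityˡ (pos (suc d))) lt))
  q≢0 : NonZero q
  q≢0 = >-nonZero (m≥n⇒m/n>0 {suc d} {suc a} a<d)
  scaled : ∀ r → ℚ.toℚᵘ (toℚ r ℚ.* ε) ℚᵘ.≃ fromℕᵘ r ℚᵘ.* ℚᵘ.mkℚᵘ (pos (suc a)) d
  scaled r = ℚᵘP.≃-trans (ℚP.toℚᵘ-homo-* (toℚ r) ε) (ℚᵘP.*-cong (toℚᵘ-toℚ r) ℚᵘP.≃-refl)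
  numerator : ∀ r → (pos r ℤ.* pos (suc a)) ℤ.* pos 1 ≡ pos (r * suc a)
  numerator r = trans (ℤP.*-identityʳ (pos r ℤ.* pos (suc a))) (sym (ℤP.pos-* r (suc a)))
  denominator : pos 1 ℤ.* pos (1 * suc d) ≡ pos (suc d)
  denominator = trans (ℤP.*-identityˡ (pos (1 * suc d))) (cong pos (+-identityʳ (suc d)))
  below : toℚ q ℚ.* ε ℚ.≤ 1ℚ
  below = ℚP.toℚᵘ-cancel-≤ (ℚᵘP.≤-respˡ-≃ (ℚᵘP.≃-sym (scaled q))
    (ℚᵘ.*≤* (subst₂ ℤ._≤_ (sym (numerator q)) (sym denominator) (ℤ.+≤+ (m/n*n≤m (suc d) (suc a))))))
  above : 1ℚ ℚ.≤ toℚ (suc q) ℚ.* ε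
  above = ℚP.toℚᵘ-cancel-≤ (ℚᵘP.≤-respʳ-≃ (ℚᵘP.≃-sym (scaled (suc q)))
    (ℚᵘ.*≤* (subst₂ ℤ._≤_ (sym denominator) (sym (numerator (suc q)))
      (ℤ.+≤+ (<⇒≤ (subst (_< suc q * suc a) (sym (m≡m%n+[m/n]*n (suc d) (suc a))) (+-monoˡ-< (q * suc a) (m%n<n (suc d) (suc a)))))))))

betaOf-lower : ∀ N q n ε → 0ℚ ℚ.< ε → toℚ q ℚ.* ε ℚ.≤ 1ℚ → N * q ^ 6 * Lg n ^ 7 ≤ betaOf (toℚ N) n ε
betaOf-lower N q n ε 0<ε qε≤1 = ceiling-lower (N * q ^ 6 * Lg n ^ 7) _ (subst (ℚ._≤ toℚ N ℚ.* (inv ε ^ℚ 6) ℚ.* (toℚ (Lg n) ^ℚ 7))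
    (sym (trans (toℚ-* (N * q ^ 6) (Lg n ^ 7)) (cong₂ ℚ._*_ (trans (toℚ-* N (q ^ 6)) (cong (toℚ N ℚ.*_) (toℚ-^ q 6))) (toℚ-^ (Lg n) 7))))
    (ℚP.*-monoʳ-≤-nonNeg (toℚ (Lg n) ^ℚ 7) {{ℚ.nonNegative (^ℚ-≥0 7 (toℚ-≥0 (Lg n)))}}
      (ℚP.*-monoˡ-≤-nonNeg (toℚ N) {{ℚ.nonNegative (toℚ-≥0 N)}} (^ℚ-mono 6 (toℚ-≥0 q) q≤inv))))
  where
  q≤inv : toℚ q ℚ.≤ inv ε
  q≤inv = subst₂ ℚ._≤_ (trans (ℚP.*-assoc (toℚ q) ε (inv ε)) (trans (cong (toℚ q ℚ.*_) (proj₁ (inv-spec ε 0<ε))) (ℚP.*-identityʳ (toℚ q)))) (ℚP.*-identityˡ (inv ε))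
    (ℚP.*-monoʳ-≤-nonNeg (inv ε) {{ℚ.nonNegative (proj₂ (inv-spec ε 0<ε))}} qε≤1)

-- `N` cancels against its inverse and `L` against its inverse, which leaves `(q ε)² ≤ 1`.
lambdaOf-upper : ∀ N q n ε .{{_ : NonZero N}} → 0ℚ ℚ.< ε → toℚ q ℚ.* ε ℚ.≤ 1ℚ →
  ∀ σ → σ ≤ N * (q * q) * (Lg n * Lg n) → toℚ σ ℚ.* lambdaOf (inv (toℚ N)) n ε ℚ.≤ 1ℚ
lambdaOf-upper N q n ε 0<ε qε≤1 σ σ≤ = begin
  toℚ σ ℚ.* lam                                        ≤⟨ ℚP.*-monoʳ-≤-nonNeg lam {{ℚ.nonNegative lam≥0}} (toℚ-mono σ≤) ⟩
  toℚ (N * (q * q) * (L * L)) ℚ.* lam                  ≡⟨ cong (ℚ._* lam) (trans (toℚ-* (N * (q * q)) (L * L)) (cong₂ ℚ._*_ (trans (toℚ-* N (q * q)) (cong (toℚ N ℚ.*_) (toℚ-* q q))) (toℚ-* L L))) ⟩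
  toℚ N ℚ.* (toℚ q ℚ.* toℚ q) ℚ.* (toℚ L ℚ.* toℚ L) ℚ.* (cλ ℚ.* (t ℚ.* (t ℚ.* 1ℚ)))
    ≡⟨ ring (toℚ N) (toℚ q) (toℚ L) cλ ε (inv (toℚ L)) ⟩
  (toℚ N ℚ.* cλ) ℚ.* ((toℚ q ℚ.* ε) ℚ.* (toℚ q ℚ.* ε)) ℚ.* ((toℚ L ℚ.* inv (toℚ L)) ℚ.* (toℚ L ℚ.* inv (toℚ L)))
    ≡⟨ cong₂ (λ a b → a ℚ.* ((toℚ q ℚ.* ε) ℚ.* (toℚ q ℚ.* ε)) ℚ.* (b ℚ.* b)) (proj₁ (inv-spec (toℚ N) (toℚ-positive N))) (proj₁ (inv-spec (toℚ L) (toℚ-positive L))) ⟩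
  1ℚ ℚ.* ((toℚ q ℚ.* ε) ℚ.* (toℚ q ℚ.* ε)) ℚ.* 1ℚ      ≡⟨ trans (ℚP.*-identityʳ _) (ℚP.*-identityˡ _) ⟩
  (toℚ q ℚ.* ε) ℚ.* (toℚ q ℚ.* ε)                      ≤⟨ ℚ-*-mono qε≥0 (toℚ-≥0 1) qε≤1 qε≤1 ⟩
  1ℚ ∎
  where
  open ℚP.≤-Reasoning
  L = Lg n
  cλ = inv (toℚ N)
  lam = lambdaOf cλ n ε
  t = ε ℚ.* inv (toℚ L)
  qε≥0 : 0ℚ ℚ.≤ toℚ q ℚ.* ε
  qε≥0 = ℚ-*-≥0 (toℚ-≥0 q) (ℚP.<⇒≤ 0<ε)
  lam≥0 : 0ℚ ℚ.≤ lam
  lam≥0 = ℚ-*-≥0 (proj₂ (inv-spec (toℚ N) (toℚ-positive N))) (^ℚ-≥0 2 (ℚ-*-≥0 (ℚP.<⇒≤ 0<ε) (proj₂ (inv-spec (toℚ L) (toℚ-positive L)))))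
  ring : ∀ N q L c e i → N ℚ.* (q ℚ.* q) ℚ.* (L ℚ.* L) ℚ.* (c ℚ.* ((e ℚ.* i) ℚ.* ((e ℚ.* i) ℚ.* 1ℚ)))
    ≡ (N ℚ.* c) ℚ.* ((q ℚ.* e) ℚ.* (q ℚ.* e)) ℚ.* ((L ℚ.* i) ℚ.* (L ℚ.* i))
  ring = solveℚ 6 (λ N q L c e i → N :* (q :* q) :* (L :* L) :* (c :* ((e :* i) :* ((e :* i) :* con 1ℚ)))
    := (N :* c) :* ((q :* e) :* (q :* e)) :* ((L :* i) :* (L :* i))) refl
    where open ℚS.+-*-Solver renaming (solve to solveℚ)

-- The rational slack `lam * β` is at most `β / σ`, and as `β ∸ d` is a natural number the quotient
-- may be rounded down. This supplies the natural slack `g` of the combinatorial part.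
slack-from-ratio : ∀ σ β d lam .{{_ : NonZero σ}} → toℚ σ ℚ.* lam ℚ.≤ 1ℚ →
  (1ℚ ℚ.- lam) ℚ.* toℚ β ℚ.≤ toℚ d → β ≤ d + β / σ
slack-from-ratio σ β d lam hσ h = ≤-trans (m≤n+m∸n β d) (+-monoʳ-≤ d quotient)
  where
  scaled : σ * β ≤ σ * d + β
  scaled = toℚ-cancel (subst₂ ℚ._≤_ (sym (trans (toℚ-* σ β) (ring (toℚ σ) (toℚ β) lam)))
      (sym (trans (toℚ-+ (σ * d) β) (cong₂ ℚ._+_ (toℚ-* σ d) (sym (ℚP.*-identityˡ (toℚ β))))))
      (ℚP.+-mono-≤ (ℚP.*-monoˡ-≤-nonNeg (toℚ σ) {{ℚ.nonNegative (toℚ-≥0 σ)}} h) (ℚP.*-monoʳ-≤-nonNeg (toℚ β) {{ℚ.nonNegative (toℚ-≥0 β)}} hσ)))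
    where
    ring : ∀ s b l → s ℚ.* b ≡ s ℚ.* ((1ℚ ℚ.- l) ℚ.* b) ℚ.+ (s ℚ.* l) ℚ.* b
    ring = solveℚ 3 (λ s b l → s :* b := s :* ((con 1ℚ :- l) :* b) :+ (s :* l) :* b) refl
      where open ℚS.+-*-Solver renaming (solve to solveℚ)
  quotient : β ∸ d ≤ β / σ
  quotient = subst (_≤ β / σ) (m*n/n≡m (β ∸ d) σ) (/-monoˡ-≤ σ (subst (_≤ β) (trans (sym (*-distribˡ-∸ σ β d)) (*-comm σ (β ∸ d)))
    (m≤n+o⇒m∸n≤o (σ * β) (σ * d) scaled)))

-- `(3Q + 2) / (2Q)` is `3/2 + 1/Q`, and `1/Q ≤ ε`.
ratio-conclusion : ∀ Q ε a b .{{_ : NonZero Q}} → 1ℚ ℚ.≤ toℚ Q ℚ.* ε → 2 * Q * a ≤ (3 * Q + 2) * b →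
  toℚ a ℚ.≤ ((toℚ 1 ℚ.+ ½) ℚ.+ ε) ℚ.* toℚ b
ratio-conclusion Q ε a b hQ h = ℚP.*-cancelˡ-≤-pos (toℚ 2 ℚ.* toℚ Q) {{ℚ.positive 0<2Q}} (begin
  toℚ 2 ℚ.* toℚ Q ℚ.* toℚ a                            ≡⟨ sym (trans (toℚ-* (2 * Q) a) (cong (ℚ._* toℚ a) (toℚ-* 2 Q))) ⟩
  toℚ (2 * Q * a)                                      ≤⟨ toℚ-mono h ⟩
  toℚ ((3 * Q + 2) * b)                                ≡⟨ trans (toℚ-* (3 * Q + 2) b) (cong (ℚ._* toℚ b) (trans (toℚ-+ (3 * Q) 2) (cong (ℚ._+ toℚ 2) (toℚ-* 3 Q)))) ⟩
  (toℚ 3 ℚ.* toℚ Q ℚ.+ toℚ 2) ℚ.* toℚ b                ≡⟨ cong (λ z → (toℚ 3 ℚ.* toℚ Q ℚ.+ z) ℚ.* toℚ b) (sym (ℚP.*-identityʳ (toℚ 2))) ⟩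
  (toℚ 3 ℚ.* toℚ Q ℚ.+ toℚ 2 ℚ.* 1ℚ) ℚ.* toℚ b         ≤⟨ ℚP.*-monoʳ-≤-nonNeg (toℚ b) {{ℚ.nonNegative (toℚ-≥0 b)}} (ℚP.+-monoʳ-≤ (toℚ 3 ℚ.* toℚ Q) (ℚP.*-monoˡ-≤-nonNeg (toℚ 2) hQ)) ⟩
  (toℚ 3 ℚ.* toℚ Q ℚ.+ toℚ 2 ℚ.* (toℚ Q ℚ.* ε)) ℚ.* toℚ b ≡⟨ ring (toℚ Q) ε (toℚ b) ⟩
  toℚ 2 ℚ.* toℚ Q ℚ.* (((toℚ 1 ℚ.+ ½) ℚ.+ ε) ℚ.* toℚ b) ∎)
  where
  open ℚP.≤-Reasoning
  0<2Q : 0ℚ ℚ.< toℚ 2 ℚ.* toℚ Q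
  0<2Q = subst (0ℚ ℚ.<_) (toℚ-* 2 Q) (toℚ-positive (2 * Q) {{m*n≢0 2 Q}})
  ring : ∀ Q e b → (toℚ 3 ℚ.* Q ℚ.+ toℚ 2 ℚ.* (Q ℚ.* e)) ℚ.* b ≡ toℚ 2 ℚ.* Q ℚ.* (((toℚ 1 ℚ.+ ½) ℚ.+ e) ℚ.* b)
  ring = solveℚ 3 (λ Q e b → (con (toℚ 3) :* Q :+ con (toℚ 2) :* (Q :* e)) :* b := con (toℚ 2) :* Q :* (((con (toℚ 1) :+ con ½) :+ e) :* b)) refl
    where open ℚS.+-*-Solver renaming (solve to solveℚ)

-- Transfer to subsets and the coreset statement.

n<2^Lg : ∀ n → n < 2 ^ Lg n
n<2^Lg n = ≰⇒> (λ h → n≮n ⌊log₂ n ⌋ (subst (_≤ ⌊log₂ n ⌋) (⌊log₂[2^n]⌋≡n (Lg n)) (⌊log₂⌋-mono-≤ h)))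

∣∣≡card : ∀ {m} (M : Subset m) → ∣ M ∣ ≡ card (lookup M)
∣∣≡card Vec.[] = refl
∣∣≡card (true Vec.∷ M) = cong suc (∣∣≡card M)
∣∣≡card (false Vec.∷ M) = ∣∣≡card M

∈-unionAll : ∀ {m k} (C : Fin k → Subset m) i {j} → j Subset.∈ C i → j Subset.∈ unionAll C
∈-unionAll {k = k} C i {j} j∈ = go (∈-allFin i)
  where
  go : ∀ {is} → i ∈ is → j Subset.∈ Subset.⋃ (List.map C is)
  go (here refl) = x∈p∪q⁺ (inj₁ j∈)
  go (there {x} i∈) = x∈p∪q⁺ {p = C x} (inj₂ (go i∈))

module _ {n m : ℕ} (G : Graph n m) where
  open Degrees G

  edgeDeg≡ends : ∀ H j → edgeDeg G H j ≡ ends (dg (lookup H)) j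
  edgeDeg≡ends H j = cong₂ _+_ (deg≡dg H (fst j)) (deg≡dg H (snd j))

  fromIsMatching : ∀ M → IsMatching G M → Matching (lookup M)
  fromIsMatching M h {v} j j′ Mj Mj′ t t′ with j Fin.≟ j′
  ... | yes p = p
  ... | no j≢j′ = contradiction (share t t′) (h j j′ (lookup⇒[]= j M Mj) (lookup⇒[]= j′ M Mj′) j≢j′)
    where
    share : Touching v j → Touching v j′ → ShareVertex (edge G j) (edge G j′)
    share (inj₁ p) (inj₁ q) = inj₁ (inj₁ (trans (sym p) q))
    share (inj₁ p) (inj₂ q) = inj₁ (inj₂ (trans (sym p) q))
    share (inj₂ p) (inj₁ q) = inj₂ (inj₁ (trans (sym p) q))
    share (inj₂ p) (inj₂ q) = inj₂ (inj₂ (trans (sym p) q))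

  toIsMatching : ∀ M → Matching (lookup M) → IsMatching G M
  toIsMatching M h j j′ j∈ j′∈ j≢j′ s = j≢j′ (go s)
    where
    shared : ∀ v → Touching v j → Touching v j′ → j ≡ j′
    shared v = h {v} j j′ ([]=⇒lookup j∈) ([]=⇒lookup j′∈)
    go : ShareVertex (edge G j) (edge G j′) → j ≡ j′
    go (inj₁ (inj₁ p)) = shared (fst j) (inj₁ refl) (inj₁ p)
    go (inj₁ (inj₂ p)) = shared (fst j) (inj₁ refl) (inj₂ p)
    go (inj₂ (inj₁ p)) = shared (snd j) (inj₂ refl) (inj₁ p)
    go (inj₂ (inj₂ p)) = shared (snd j) (inj₂ refl) (inj₂ p)

  size-bound : ∀ H β → (∀ j → H j ≡ true → ends (dg H) j ≤ β) → card H ≤ n * β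
  size-bound H β h = begin
    card H                              ≤⟨ ∑-mono (λ j → m≤m*n ⟦ H j ⟧ 2) ⟩
    ∑[ j < m ] (⟦ H j ⟧ * 2)            ≡⟨ sym (handshake (λ _ → 1) H) ⟩
    ∑[ v < n ] (1 * dg H v)             ≤⟨ ∑-bounded (λ v → ≤-trans (≤-reflexive (+-identityʳ (dg H v))) (dg-bounded H β h v)) ⟩
    n * β ∎
    where open ≤-Reasoning

  module Main (c q b k : ℕ) .{{_ : NonZero c}} .{{_ : NonZero q}} (892≤c : 892 ≤ c)
    (β-large : 18 * (spread c (suc q) (Lg n) * spread c (suc q) (Lg n) * Lg n) ≤ suc b) where

    private
      Q R σ : ℕ
      Q = suc q
      R = c * Q
      σ = spread c Q (Lg n)

    private
      instance
        σ≢0′ : NonZero σ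
        σ≢0′ = m*n≢0 (R * R) (Lg n) {{m*n≢0 R R {{m*n≢0 c Q}} {{m*n≢0 c Q}}}}

      g : ℕ
      g = suc b / σ

      g-small : σ * g ≤ suc b
      g-small = subst (_≤ suc b) (*-comm g σ) (m/n*n≤m (suc b) σ)

      module P = Parameters c Q (Lg n) (suc b) k g 892≤c (s≤s (>-nonZero⁻¹ q)) β-large g-small
      module S = Sampling G k b

      8n<2^s : 8 * n < 2 ^ (Lg n + 3)
      8n<2^s = subst (8 * n <_) (trans (*-comm 8 (2 ^ Lg n)) (sym (^-distribˡ-+-* 2 (Lg n) 3))) (*-monoʳ-< 8 (n<2^Lg n))

    Bad : List (Partition m (suc k))
    Bad = select m (S.bad P.h)

    few-Bad : length Bad * n ≤ suc k ^ m
    few-Bad = subst (λ z → z * n ≤ suc k ^ m) (sym (length-select m (S.bad P.h)))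
      (S.few-bad (Lg n) σ P.W (n<2^Lg n) P.β≤σW)

    module _ (p : Partition m (suc k)) (p∉ : p ∉ Bad) (C : Fin (suc k) → Fin m → Bool)
      (C⊆ : ∀ i j → C i j ≡ true → lookup p j ≡ i)
      (C-light : ∀ i j → C i j ≡ true → ends (dg (C i)) j ≤ suc b)
      (C-heavy : ∀ i j → lookup p j ≡ i → C i j ≡ false → suc b ≤ ends (dg (C i)) j + g)
      (M : Fin m → Bool) (matching : Matching M) where

      private
        module U = S.Good.Coresets P.h p (∉-select m (S.bad P.h) p p∉) g P.E R (Lg n) C C⊆ C-light C-heavy (n<2^Lg n) P.β+h≤RE

        z : ℕ
        z = 4 * (suc k * P.Γ) + suc k * g

        module N = NearEDCS G U.union M matching (suc k * suc b) z U.dg-union≤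
          (λ j e → ≤-trans (U.union-light j e) (+-monoʳ-≤ (suc k * suc b) (m≤m+n (4 * (suc k * P.Γ)) (suc k * g))))
          U.union-heavy R P.W₂ (Lg n + 3) Q {{P.R≢0}} P.Kβ≤2RW₂ 8n<2^s (s≤s z≤n)

      matching-in-union : ∃[ M′ ] (∀ j → M′ j ≡ true → C (lookup p j) j ≡ true) × Matching M′ × 2 * Q * card M ≤ (3 * Q + 2) * card M′
      matching-in-union = N.large-matching P.total≤

private
  -- Replacing `Q = q + 1` by `2q` costs `2 ^ 2` in `σ` and `2 ^ 4` in its square, whence 4 and
  -- `288 = 18 * 16`; the powers of `c` come from `σ`.
  λ-scale β-scale : ℕ → ℕ
  λ-scale c = 4 * (c * c)
  β-scale c = 288 * (c * c * (c * c))

  parameter-bounds : ∀ c q L .{{_ : NonZero c}} .{{_ : NonZero q}} .{{_ : NonZero L}} →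
    let σ = spread c (suc q) L in
    (18 * (σ * σ * L) ≤ β-scale c * q ^ 6 * L ^ 7) × (σ ≤ λ-scale c * (q * q) * (L * L))
  parameter-bounds c q L = β-bound , σ-bound
    where
    open ≤-Reasoning
    R = c * suc q
    R′ = c * (2 * q)
    R≤R′ : R ≤ R′
    R≤R′ = *-monoʳ-≤ c (subst (suc q ≤_) (cong (q +_) (sym (+-identityʳ q))) (subst (_≤ q + q) (+-comm q 1) (+-monoʳ-≤ q (>-nonZero⁻¹ q))))
    σ≤σ′ : R * R * L ≤ R′ * R′ * L
    σ≤σ′ = *-monoˡ-≤ L (*-mono-≤ R≤R′ R≤R′)
    β-bound : 18 * (R * R * L * (R * R * L) * L) ≤ β-scale c * q ^ 6 * L ^ 7
    β-bound = begin
      18 * (R * R * L * (R * R * L) * L)          ≤⟨ *-monoʳ-≤ 18 (*-monoˡ-≤ L (*-mono-≤ σ≤σ′ σ≤σ′)) ⟩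
      -- The left side has order `q⁴ L⁵`; the factor `q² L⁴`, which is at least 1, raises it to the
      -- exponents of `betaOf`.
      18 * (R′ * R′ * L * (R′ * R′ * L) * L)      ≤⟨ m≤m*n _ (q * q * (L * L * (L * L))) {{m*n≢0 (q * q) (L * L * (L * L)) {{m*n≢0 q q}} {{m*n≢0 (L * L) (L * L) {{m*n≢0 L L}} {{m*n≢0 L L}}}}}} ⟩
      18 * (R′ * R′ * L * (R′ * R′ * L) * L) * (q * q * (L * L * (L * L))) ≡⟨ e 18 2 c q L ⟩
      β-scale c * q ^ 6 * L ^ 7 ∎
      where
      e : ∀ a b c q L → a * (c * (b * q) * (c * (b * q)) * L * (c * (b * q) * (c * (b * q)) * L) * L) * (q * q * (L * L * (L * L)))
        ≡ a * (b * b * (b * b)) * (c * c * (c * c)) * (q * (q * (q * (q * (q * (q * 1)))))) * (L * (L * (L * (L * (L * (L * (L * 1)))))))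
      e = solve-∀
    σ-bound : R * R * L ≤ λ-scale c * (q * q) * (L * L)
    σ-bound = begin
      R * R * L                             ≤⟨ σ≤σ′ ⟩
      R′ * R′ * L                           ≤⟨ m≤m*n _ L ⟩
      R′ * R′ * L * L                       ≡⟨ e c q L ⟩
      λ-scale c * (q * q) * (L * L) ∎
      where
      e : ∀ c q L → c * (2 * q) * (c * (2 * q)) * L * L ≡ 4 * (c * c) * (q * q) * (L * L)
      e = solve-∀

  ∉⇒false : ∀ {m} {H : Subset m} {j} → lookup H j ≡ false → j Subset.∉ H
  ∉⇒false e j∈ = contradiction (trans (sym ([]=⇒lookup j∈)) e) λ ()

Coreset : ∀ {n m} → Graph n m → (k β : ℕ) (β⁻ ε : ℚ) → Set
Coreset {n} {m} G k β β⁻ ε =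
  Σ (List (Partition m k)) λ Bad → (length Bad * n ^ 1 ≤ k ^ m) ×
    (∀ (p : Partition m k) → p ∉ Bad →
      ∀ (C : Fin k → Subset m) → (∀ i → IsEDCS G p i (C i) β β⁻) →
      ∀ (M : Subset m) → IsMatching G M →
      Σ (Subset m) λ M′ → M′ ⊆ unionAll C × IsMatching G M′ ×
        (toℚ ∣ M ∣ ℚ.≤ ((toℚ 1 ℚ.+ ½) ℚ.+ ε) ℚ.* toℚ ∣ M′ ∣))

module _ {n m : ℕ} (G : Graph n m) (ε : ℚ) (c q b k : ℕ) .{{_ : NonZero c}} .{{_ : NonZero q}} (892≤c : 892 ≤ c)
  (lam : ℚ) (β-large : 18 * (spread c (suc q) (Lg n) * spread c (suc q) (Lg n) * Lg n) ≤ suc b)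
  (σlam≤1 : toℚ (spread c (suc q) (Lg n)) ℚ.* lam ℚ.≤ 1ℚ) (1≤Qε : 1ℚ ℚ.≤ toℚ (suc q) ℚ.* ε) where
  open Degrees G

  private
    module A = Main G c q b k 892≤c β-large

    R σ : ℕ
    R = c * suc q
    σ = spread c (suc q) (Lg n)

    module _ (p : Partition m (suc k)) (p∉ : p ∉ A.Bad) (C : Fin (suc k) → Subset m)
      (edcs : ∀ i → IsEDCS G p i (C i) (suc b) ((1ℚ ℚ.- lam) ℚ.* toℚ (suc b)))
      (M : Subset m) (isMatching : IsMatching G M) where

      instance
        σ-nonZero : NonZero σ
        σ-nonZero = m*n≢0 (R * R) (Lg n) {{m*n≢0 R R {{m*n≢0 c (suc q)}} {{m*n≢0 c (suc q)}}}}

      heavy : ∀ i j → lookup p j ≡ i → lookup (C i) j ≡ false → suc b ≤ ends (dg (lookup (C i))) j + suc b / σ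
      heavy i j pj e = subst (λ d → suc b ≤ d + suc b / σ) (edgeDeg≡ends G (C i) j)
        (slack-from-ratio σ (suc b) (edgeDeg G (C i) j) lam σlam≤1 (IsEDCS.P2 (edcs i) j pj (∉⇒false e)))

      result : ∃[ f ] (∀ j → f j ≡ true → lookup (C (lookup p j)) j ≡ true) × Matching f × 2 * suc q * card (lookup M) ≤ (3 * suc q + 2) * card f
      result = A.matching-in-union p p∉ (lookup ∘ C)
        (λ i j e → IsEDCS.subgraph (edcs i) j (lookup⇒[]= j (C i) e))
        (λ i j e → subst (_≤ suc b) (edgeDeg≡ends G (C i) j) (IsEDCS.P1 (edcs i) j (lookup⇒[]= j (C i) e)))
        heavy (lookup M) (fromIsMatching G M isMatching)

      toSubset : (∃[ f ] (∀ j → f j ≡ true → lookup (C (lookup p j)) j ≡ true) × Matching f × 2 * suc q * card (lookup M) ≤ (3 * suc q + 2) * card f) →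
        Σ (Subset m) λ M′ → M′ ⊆ unionAll C × IsMatching G M′ × (toℚ ∣ M ∣ ℚ.≤ ((toℚ 1 ℚ.+ ½) ℚ.+ ε) ℚ.* toℚ ∣ M′ ∣)
      toSubset (f , f⊆ , matching-f , size) = M′
          , (λ {j} j∈ → ∈-unionAll C (lookup p j) (lookup⇒[]= j (C (lookup p j)) (f⊆ j (trans (sym (lookup-M′ j)) ([]=⇒lookup j∈)))))
          , toIsMatching G M′ (λ j j′ e e′ → matching-f j j′ (trans (sym (lookup-M′ j)) e) (trans (sym (lookup-M′ j′)) e′))
          , ratio-conclusion (suc q) ε ∣ M ∣ ∣ M′ ∣ 1≤Qε (subst₂ (λ x y → 2 * suc q * x ≤ (3 * suc q + 2) * y) (sym (∣∣≡card M)) (sym card-M′) size)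
        where
        M′ : Subset m
        M′ = tabulate f
        lookup-M′ : ∀ j → lookup M′ j ≡ f j
        lookup-M′ = lookup∘tabulate f
        card-M′ : ∣ M′ ∣ ≡ card f
        card-M′ = trans (∣∣≡card M′) (sum-cong-≗ (λ j → cong ⟦_⟧ (lookup-M′ j)))

  coreset-suc : Coreset G (suc k) (suc b) ((1ℚ ℚ.- lam) ℚ.* toℚ (suc b)) ε
  coreset-suc = A.Bad , subst (λ z → length A.Bad * z ≤ suc k ^ m) (sym (*-identityʳ n)) A.few-Bad
    , λ p p∉ C edcs M isMatching → toSubset p p∉ C edcs M isMatching (result p p∉ C edcs M isMatching)

module _ (c : ℕ) .{{c≢0 : NonZero c}} (892≤c : 892 ≤ c) {n m : ℕ} (k : ℕ) (G : Graph n m) (ε : ℚ) where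

  coreset-at : ∀ q .{{_ : NonZero q}} lam β → let σ = spread c (suc q) (Lg n) in
    18 * (σ * σ * Lg n) ≤ β → toℚ σ ℚ.* lam ℚ.≤ 1ℚ → 1ℚ ℚ.≤ toℚ (suc q) ℚ.* ε →
    Coreset G (suc k) β ((1ℚ ℚ.- lam) ℚ.* toℚ β) ε
  -- The lower bound on `β` is positive, so `β` is a successor, as the sampling argument
  -- presupposes.
  coreset-at q lam zero h _ _ = contradiction (<-≤-trans (>-nonZero⁻¹ (18 * (σ * σ * Lg n)) {{m*n≢0 18 (σ * σ * Lg n) {{_}} {{m*n≢0 (σ * σ) (Lg n) {{m*n≢0 σ σ {{σ≢0}} {{σ≢0}}}}}}}}) h) (n≮n 0)
    where
    R = c * suc q
    σ = R * R * Lg n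
    σ≢0 : NonZero σ
    σ≢0 = m*n≢0 (R * R) (Lg n) {{m*n≢0 R R {{m*n≢0 c (suc q)}} {{m*n≢0 c (suc q)}}}}
  coreset-at q lam (suc b) h hσ hQ = coreset-suc G ε c q b k 892≤c lam h hσ hQ

  coreset : 0ℚ ℚ.< ε → ε ℚ.< 1ℚ → let lam = lambdaOf (inv (toℚ (λ-scale c))) n ε ; β = betaOf (toℚ (β-scale c)) n ε in
    Coreset G (suc k) β ((1ℚ ℚ.- lam) ℚ.* toℚ β) ε
  coreset 0<ε ε<1 = go (inverse-floor ε 0<ε ε<1)
    where
    go : (∃[ q ] NonZero q × (toℚ q ℚ.* ε ℚ.≤ 1ℚ) × (1ℚ ℚ.≤ toℚ (suc q) ℚ.* ε)) →
      Coreset G (suc k) (betaOf (toℚ (β-scale c)) n ε) ((1ℚ ℚ.- lambdaOf (inv (toℚ (λ-scale c))) n ε) ℚ.* toℚ (betaOf (toℚ (β-scale c)) n ε)) ε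
    go (q , q≢0 , qε≤1 , 1≤Qε) = coreset-at q {{q≢0}} _ _
      (≤-trans (proj₁ (parameter-bounds c q (Lg n) {{c≢0}} {{q≢0}})) (betaOf-lower (β-scale c) q n ε 0<ε qε≤1))
      (lambdaOf-upper (λ-scale c) q n ε {{m*n≢0 4 (c * c) {{_}} {{m*n≢0 c c}}}} 0<ε qε≤1 _ (proj₂ (parameter-bounds c q (Lg n) {{c≢0}} {{q≢0}})))
      1≤Qε

edcs-size : ∀ {n m k β β⁻} (G : Graph n m) (p : Partition m k) i H → IsEDCS G p i H β β⁻ → ∣ H ∣ ≤ 1 * n * β
edcs-size {n} {β = β} G p i H edcs = subst₂ _≤_ (sym (∣∣≡card H)) (cong (_* β) (sym (+-identityʳ n)))
  (size-bound G (lookup H) β (λ j e → subst (_≤ β) (edgeDeg≡ends G H j) (IsEDCS.P1 edcs j (lookup⇒[]= j H e))))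

inv-positive : ∀ x → 0ℚ ℚ.< x → 0ℚ ℚ.< inv x
inv-positive x 0<x = ℚP.≰⇒> (λ h → contradiction (toℚ-cancel {1} {0} (subst (ℚ._≤ 0ℚ) (proj₁ (inv-spec x 0<x))
  (subst (x ℚ.* inv x ℚ.≤_) (ℚP.*-zeroʳ x) (ℚP.*-monoˡ-≤-nonNeg x {{ℚ.nonNegative (ℚP.<⇒≤ 0<x)}} h)))) λ ())

theorem5p2 : ∃[ cλ ] ∃[ cβ ] ∃[ cSize ] ∃[ c ] ∃[ n₀ ]
    (0ℚ ℚ.< cλ) × (0ℚ ℚ.< cβ) × (1 ≤ c) ×
    (∀ (n m k : ℕ) (G : Graph n m) (ε : ℚ) → n₀ ≤ n → 1 ≤ k → 0ℚ ℚ.< ε → ε ℚ.< 1ℚ →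
      let λ' = lambdaOf cλ n ε
          β = betaOf cβ n ε
          β⁻ = (1ℚ ℚ.- λ') ℚ.* toℚ β
      in
      -- high probability: at most a 1/n^c fraction of the k^m partitions is bad
      (Σ (List (Partition m k)) λ Bad → (length Bad * n ^ c ≤ k ^ m) ×
        (∀ (p : Partition m k) → p ∉ Bad →
          ∀ (C : Fin k → Subset m) → (∀ i → IsEDCS G p i (C i) β β⁻) →
          ∀ (M : Subset m) → IsMatching G M →
          Σ (Subset m) λ M' → M' ⊆ unionAll C × IsMatching G M' ×
            (toℚ ∣ M ∣ ℚ.≤ ((toℚ 1 ℚ.+ ½) ℚ.+ ε) ℚ.* toℚ ∣ M' ∣)))
      ×
      -- size: every such EDCS has O(n β) edges
      (∀ (p : Partition m k) (i : Fin k) (H : Subset m) →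
        IsEDCS G p i H β β⁻ → ∣ H ∣ ≤ cSize * n * β))
-- After the two scales come the size constant 1, the failure exponent 1 and the threshold `n₀ = 0`.
-- The value 892 is the least `c` that `total-bound` admits.
theorem5p2 = inv (toℚ (λ-scale 892)) , toℚ (β-scale 892) , 1 , 1 , 0
  , inv-positive _ (toℚ-positive (λ-scale 892))
  , toℚ-positive (β-scale 892)
  , ≤-refl
  , λ { n m (suc k) G ε _ _ 0<ε ε<1 → coreset 892 ≤-refl k G ε 0<ε ε<1 , edcs-size G }
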